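{- Let $m\ge1$ and let $\mathcal{V}$ be an $\mathfrak{N}_0$-equivariant coefficient system in $\mathfrak{o}_m$-modules on $\mathfrak{X}_+$ which is strictly of level $1$. Then the natural map (the transition map $\mathcal{V}(\mathfrak{e}_0)\to\mathcal{V}(\mathfrak{v}_0)$ followed by $\mathcal{V}(\mathfrak{v}_0)\to H_0(\overline{\mathfrak{X}}_+,\mathcal{V})$) is an isomorphism $$\mathcal{V}(\mathfrak{e}_0)\xrightarrow{\ \cong\ }H_0(\overline{\mathfrak{X}}_+,\mathcal{V})^{\mathfrak{N}_0}.$$
   Context: $K/\mathbb{Q}_p$ is a finite extension with ring of integers $\mathfrak{o}$, uniformizer $\pi_K$, residue field $k$; $\mathfrak{o}_m=\mathfrak{o}/\pi_K^m$. **Half tree.** $\mathfrak{X}$ is the Bruhat–Tits tree of $\mathrm{PGL}_2(\mathbb{Q}_p)$, $\mathfrak{v}_0$ the vertex fixed by $\mathrm{PGL}_2(\mathbb{Z}_p)$; $\varphi=\begin{pmatrix}p&0\\0&1\end{pmatrix}$, $\mathfrak{N}_0=\begin{pmatrix}1&\mathbb{Z}_p\\0&1\end{pmatrix}$; $\mathfrak{v}_i=\varphi^i\mathfrak{v}_0$, $\mathfrak{e}_i=\{\mathfrak{v}_i,\mathfrak{v}_{i-1}\}$. The half tree $\mathfrak{X}_+$ has vertices $\mathfrak{X}_+^0=\coprod_{i\ge0}\mathfrak{N}_0\mathfrak{v}_i$ and edges $\mathfrak{X}_+^1=\coprod_{i\ge0}\mathfrak{N}_0\mathfrak{e}_i$,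 where $\mathfrak{e}_0$ is a loose end containing only the vertex $\mathfrak{v}_0$; $\overline{\mathfrak{X}}_+$ is $\mathfrak{X}_+$ with the edge $\mathfrak{e}_0$ removed. **Coefficient systems.** A coefficient system $\mathcal{V}$ on a half tree assigns a module $\mathcal{V}(\sigma)$ to every vertex and edge $\sigma$, and linear transition maps $r_y^\tau:\mathcal{V}(\tau)\to\mathcal{V}(y)$ for each vertex $y$ of an edge $\tau$. $H_0$ is the cokernel of $\bigoplus_{\tau\ \rm edge}\mathcal{V}(\tau)\to\bigoplus_{y\ \rm vertex}\mathcal{V}(y)$, $v\in\mathcal V(\tau)\mapsto\sum_{y\in\tau}r_y^\tau(v)$. $\mathcal{V}$ is $H$-equivariant (for a monoid $H$ acting on the half tree) if there are given linear maps $g_\sigma:\mathcal{V}(\sigma)\to\mathcal{V}(g\sigma)$ ($g\in H$) with $g_{h\sigma}\circ h_\sigma=(gh)_\sigma$, $1_\sigma=\mathrm{id}$, compatible with transition maps. Exactness of sequences of coefficient systems (and hence subobjects, subquotients) is tested on every vertex and edge. **Strictly of level 1.** An $\mathfrak{N}_0$-equivariant coefficient system $\mathcal{V}$ in $\mathfrak{o}_m$-modules on $\mathfrak{X}_+$ is strictly of level $1$ over $k$ if the $\mathfrak{o}_m$-action factors through $k$ and: (a) all transition maps are injective (viewed as inclusions); (b) for all $i\ge0$, $\mathcal{V}(\mathfrak{v}_i)=\mathfrak{N}_0^{p^i}\cdot\mathcal{V}(\mathfrak{e}_{i+1})$ (i.e. as an $\mathfrak{N}_0^{p^i}$-representation $\mathcal{V}(\mathfrak{v}_i)$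 is generated by $\mathcal{V}(\mathfrak{e}_{i+1})$) and $\mathcal{V}(\mathfrak{e}_i)=\mathcal{V}(\mathfrak{v}_i)^{\mathfrak{N}_0^{p^i}}$; (c) $\dim_k\mathcal{V}(\mathfrak{e}_i)$ is finite and independent of $i\ge0$. $\mathcal{V}$ is strictly of level $1$ if it admits a finite filtration (by $\mathfrak{N}_0$-equivariant sub coefficient systems) all of whose subquotients are strictly of level $1$ over $k$.
   Formalization: The formal theorem additionally assumes that the natural map from V(e_0) to H_0 takes values in the N_0-invariants; without this the claim fails, e.g. for the constant system with fibre k^2 on which N_0 = Z_p acts by n -> (1 n; 0 1). -}

module Defs where

open import Level using (Level; _⊔_; suc; 0ℓ)
open import Algebra.Apartness.Bundles using (HeytingField; HeytingCommutativeRing)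
open import Algebra.Bundles using (CommutativeMonoid; CommutativeRing; Monoid; Ring)
import Algebra.Definitions as AlgDefs
open import Algebra.Structures using (IsCommutativeRing)
open import Algebra.Module.Bundles using (LeftModule; LeftSemimodule)
open import Algebra.Module.Morphism.Structures using (module LeftModuleMorphisms)
open import Algebra.Morphism.Structures using (module RingMorphisms)
import Algebra.Module.Properties.LeftModule as LeftModuleProperties
import Algebra.Properties.AbelianGroup as AbelianGroupProperties
import Algebra.Properties.CommutativeSemigroup as CommutativeSemigroupProperties
import Algebra.Properties.Monoid.Sum as MonoidSum
import Algebra.Properties.Ring as RingProperties
import Algebra.Properties.Semiring.Divisibility as Divisibility
import Algebra.Properties.Semiring.Exp as Exp
import Algebra.Solver.Ring.NaturalCoefficients.Default as RingSolver
open import Data.Fin.Base as Fin using (Fin; inject₁; fromℕ)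
open import Data.Integer.Base using (ℤ; +_)
import Data.Integer.Properties as ℤ-properties
open import Data.List.Base using (List; []; _∷_; _++_; map)
import Data.List.Properties as Listₚ
open import Data.Nat.Base as ℕ using (ℕ)
open import Data.Product.Base using (Σ; Σ-syntax; ∃; ∃-syntax; _×_; _,_; proj₁; proj₂)
open import Data.Sum.Base using (_⊎_)
open import Data.Vec.Functional using (Vector)
open import Function.Bundles using (_⇔_; mk⇔)
open import Function.Definitions using (Injective)
import Relation.Binary.Reasoning.Setoid as SetoidReasoning
open import Relation.Binary.Bundles using (Setoid)
open import Relation.Binary.PropositionalEquality as ≡ using (_≡_)
open import Relation.Nullary using (¬_)
open import Relation.Unary using (Pred)

private
  variable
    a c ℓ ℓ₁ ℓ₂ r s ℓr ℓs : Level

module QuotientRing {c ℓ : Level} (R : CommutativeRing c ℓ) (s : CommutativeRing.Carrier R) where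
  open CommutativeRing R
  open Divisibility semiring using (_∣_; _,_)
  open RingProperties ring
  open AbelianGroupProperties +-abelianGroup using (⁻¹-∙-comm)
  open SetoidReasoning setoid

  infix 4 _≡ₛ_

  record _≡ₛ_ (x y : Carrier) : Set (c ⊔ ℓ) where
    constructor congruent
    field
      divides : s ∣ x - y

  private
    cancel : ∀ x y → x + (- y) + y ≈ x
    cancel x y = trans (+-assoc _ _ _) (trans (+-congˡ (-‿inverseˡ y)) (+-identityʳ x))

    exchange : ∀ x y u v → (x + y) + (u + v) ≈ (x + u) + (y + v)
    exchange x y u v = begin
      (x + y) + (u + v) ≈⟨ +-assoc x y (u + v) ⟩
      x + (y + (u + v)) ≈⟨ +-congˡ (sym (+-assoc y u v)) ⟩
      x + ((y + u) + v) ≈⟨ +-congˡ (+-congʳ (+-comm y u)) ⟩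
      x + ((u + y) + v) ≈⟨ +-congˡ (+-assoc u y v) ⟩
      x + (u + (y + v)) ≈⟨ sym (+-assoc x u (y + v)) ⟩
      (x + u) + (y + v) ∎

  abstract
    ≈⇒≡ₛ : ∀ {x y} → x ≈ y → x ≡ₛ y
    ≈⇒≡ₛ {x} {y} x≈y = congruent (0# , trans (zeroˡ s) (sym (trans (+-congʳ x≈y) (-‿inverseʳ y))))

    ≡ₛ-sym : ∀ {x y} → x ≡ₛ y → y ≡ₛ x
    ≡ₛ-sym {x} {y} (congruent (q , e)) = congruent (- q , (begin
      - q * s      ≈⟨ sym (-‿distribˡ-* q s) ⟩
      - (q * s)    ≈⟨ -‿cong e ⟩
      - (x - y)    ≈⟨ sym (⁻¹-∙-comm x (- y)) ⟩
      - x + - (- y) ≈⟨ +-congˡ (-‿involutive y) ⟩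
      - x + y      ≈⟨ +-comm _ _ ⟩
      y - x        ∎))

    ≡ₛ-trans : ∀ {x y z} → x ≡ₛ y → y ≡ₛ z → x ≡ₛ z
    ≡ₛ-trans {x} {y} {z} (congruent (q , e)) (congruent (q′ , e′)) = congruent (q + q′ , (begin
      (q + q′) * s      ≈⟨ distribʳ s q q′ ⟩
      q * s + q′ * s    ≈⟨ +-cong e e′ ⟩
      (x - y) + (y - z) ≈⟨ sym (+-assoc _ _ _) ⟩
      (x - y) + y - z   ≈⟨ +-congʳ (cancel x y) ⟩
      x - z             ∎))

    ≡ₛ-+-cong : ∀ {x y u v} → x ≡ₛ y → u ≡ₛ v → x + u ≡ₛ y + v
    ≡ₛ-+-cong {x} {y} {u} {v} (congruent (q , e)) (congruent (q′ , e′)) = congruent (q + q′ , (begin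
      (q + q′) * s          ≈⟨ distribʳ s q q′ ⟩
      q * s + q′ * s        ≈⟨ +-cong e e′ ⟩
      (x - y) + (u - v)     ≈⟨ exchange x (- y) u (- v) ⟩
      (x + u) + (- y + - v) ≈⟨ +-congˡ (⁻¹-∙-comm y v) ⟩
      (x + u) - (y + v)     ∎))

    ≡ₛ-‿cong : ∀ {x y} → x ≡ₛ y → - x ≡ₛ - y
    ≡ₛ-‿cong {x} {y} (congruent (q , e)) = congruent (- q , (begin
      - q * s     ≈⟨ sym (-‿distribˡ-* q s) ⟩
      - (q * s)   ≈⟨ -‿cong e ⟩
      - (x - y)   ≈⟨ sym (⁻¹-∙-comm x (- y)) ⟩
      - x - (- y) ∎))

    ≡ₛ-*-congˡ : ∀ {x y} z → x ≡ₛ y → z * x ≡ₛ z * y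
    ≡ₛ-*-congˡ {x} {y} z (congruent (q , e)) = congruent (z * q , (begin
      (z * q) * s       ≈⟨ *-assoc z q s ⟩
      z * (q * s)       ≈⟨ *-congˡ e ⟩
      z * (x - y)       ≈⟨ distribˡ z x (- y) ⟩
      z * x + z * - y   ≈⟨ +-congˡ (sym (-‿distribʳ-* z y)) ⟩
      z * x - z * y     ∎))

    ≡ₛ-*-cong : ∀ {x y u v} → x ≡ₛ y → u ≡ₛ v → x * u ≡ₛ y * v
    ≡ₛ-*-cong {x} {y} {u} {v} p q = ≡ₛ-trans (≡ₛ-*-congˡ x q)
      (≡ₛ-trans (≈⇒≡ₛ (*-comm x v)) (≡ₛ-trans (≡ₛ-*-congˡ v p) (≈⇒≡ₛ (*-comm v y))))

    isCommutativeRing-⧸ : IsCommutativeRing _≡ₛ_ _+_ _*_ -_ 0# 1#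
    isCommutativeRing-⧸ = record
      { isRing = record
        { +-isAbelianGroup = record
          { isGroup = record
            { isMonoid = record
              { isSemigroup = record
                { isMagma = record
                  { isEquivalence = record { refl = ≈⇒≡ₛ refl ; sym = ≡ₛ-sym ; trans = ≡ₛ-trans }
                  ; ∙-cong = ≡ₛ-+-cong }
                ; assoc = λ x y z → ≈⇒≡ₛ (+-assoc x y z) }
              ; identity = (λ x → ≈⇒≡ₛ (+-identityˡ x)) , (λ x → ≈⇒≡ₛ (+-identityʳ x)) }
            ; inverse = (λ x → ≈⇒≡ₛ (-‿inverseˡ x)) , (λ x → ≈⇒≡ₛ (-‿inverseʳ x))
            ; ⁻¹-cong = ≡ₛ-‿cong }
          ; comm = λ x y → ≈⇒≡ₛ (+-comm x y) }
        ; *-cong = ≡ₛ-*-cong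
        ; *-assoc = λ x y z → ≈⇒≡ₛ (*-assoc x y z)
        ; *-identity = (λ x → ≈⇒≡ₛ (*-identityˡ x)) , (λ x → ≈⇒≡ₛ (*-identityʳ x))
        ; distrib = (λ x y z → ≈⇒≡ₛ (distribˡ x y z)) , (λ x y z → ≈⇒≡ₛ (distribʳ x y z)) }
      ; *-comm = λ x y → ≈⇒≡ₛ (*-comm x y) }

  quotientRing : CommutativeRing c (c ⊔ ℓ)
  quotientRing = record
    { Carrier = Carrier ; _≈_ = _≡ₛ_ ; _+_ = _+_ ; _*_ = _*_ ; -_ = -_ ; 0# = 0# ; 1# = 1#
    ; isCommutativeRing = isCommutativeRing-⧸ }

infixl 7 _⧸_

_⧸_ : (R : CommutativeRing c ℓ) → CommutativeRing.Carrier R → CommutativeRing c (c ⊔ ℓ)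
R ⧸ s = QuotientRing.quotientRing R s

module Localisation {c ℓ ℓ₁ : Level} (R : CommutativeRing c ℓ)
  (S : Pred (CommutativeRing.Carrier R) ℓ₁) (1∈S : S (CommutativeRing.1# R))
  (*-closed : ∀ {x y} → S x → S y → S (CommutativeRing._*_ R x y)) where

  open CommutativeRing R
  open SetoidReasoning setoid
  open RingProperties ring using (-‿distribʳ-*)
  open RingSolver commutativeSemiring

  record Fraction : Set (c ⊔ ℓ₁) where
    constructor _/_[_]
    field
      num   : Carrier
      den   : Carrier
      den∈S : S den

  open Fraction public

  infix 4 _≃_

  record _≃_ (x y : Fraction) : Set (c ⊔ ℓ ⊔ ℓ₁) where
    constructor equal
    field
      multiplier   : Carrier
      multiplier∈S : S multiplier
      cross        : multiplier * (den y * num x) ≈ multiplier * (den x * num y)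

  private
    exact : ∀ {x y} → den y * num x ≈ den x * num y → x ≃ y
    exact e = equal 1# 1∈S (*-congˡ e)

  _⊕_ _⊗_ : Fraction → Fraction → Fraction
  x ⊕ y = (den y * num x + den x * num y) / den x * den y [ *-closed (den∈S x) (den∈S y) ]
  x ⊗ y = (num x * num y) / den x * den y [ *-closed (den∈S x) (den∈S y) ]

  ⊖_ : Fraction → Fraction
  ⊖ x = (- num x) / den x [ den∈S x ]

  ι : Carrier → Fraction
  ι x = x / 1# [ 1∈S ]

  abstract
    ≃-refl : ∀ {x} → x ≃ x
    ≃-refl = exact refl

    ≃-sym : ∀ {x y} → x ≃ y → y ≃ x
    ≃-sym (equal u u∈S e) = equal u u∈S (sym e)

    ≃-trans : ∀ {x y z} → x ≃ y → y ≃ z → x ≃ z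
    ≃-trans {x} {y} {z} (equal u u∈S e) (equal v v∈S f) =
      equal ((u * v) * den y) (*-closed (*-closed u∈S v∈S) (den∈S y)) (begin
        ((u * v) * den y) * (den z * num x)
          ≈⟨ solve 5 (λ u v b c x → ((u :* v) :* b) :* (c :* x) := (v :* c) :* (u :* (b :* x))) refl u v (den y) (den z) (num x) ⟩
        (v * den z) * (u * (den y * num x))
          ≈⟨ *-congˡ e ⟩
        (v * den z) * (u * (den x * num y))
          ≈⟨ solve 5 (λ u v a c y → (v :* c) :* (u :* (a :* y)) := (u :* a) :* (v :* (c :* y))) refl u v (den x) (den z) (num y) ⟩
        (u * den x) * (v * (den z * num y))
          ≈⟨ *-congˡ f ⟩
        (u * den x) * (v * (den y * num z))
          ≈⟨ solve 5 (λ u v a b z → (u :* a) :* (v :* (b :* z)) := ((u :* v) :* b) :* (a :* z)) refl u v (den x) (den y) (num z) ⟩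
        ((u * v) * den y) * (den x * num z) ∎)

    ⊕-cong : ∀ {x x′ y y′} → x ≃ x′ → y ≃ y′ → x ⊕ y ≃ x′ ⊕ y′
    ⊕-cong {x} {x′} {y} {y′} (equal u u∈S e) (equal v v∈S f) = equal (u * v) (*-closed u∈S v∈S) (begin
      (u * v) * ((den x′ * den y′) * (den y * num x + den x * num y))
        ≈⟨ solve 8 (λ u v a a′ b b′ x y →
             (u :* v) :* ((a′ :* b′) :* (b :* x :+ a :* y))
             := (v :* (b′ :* b)) :* (u :* (a′ :* x)) :+ (u :* (a′ :* a)) :* (v :* (b′ :* y)))
           refl u v (den x) (den x′) (den y) (den y′) (num x) (num y) ⟩
      (v * (den y′ * den y)) * (u * (den x′ * num x)) + (u * (den x′ * den x)) * (v * (den y′ * num y))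
        ≈⟨ +-cong (*-congˡ e) (*-congˡ f) ⟩
      (v * (den y′ * den y)) * (u * (den x * num x′)) + (u * (den x′ * den x)) * (v * (den y * num y′))
        ≈⟨ solve 8 (λ u v a a′ b b′ x y →
             (v :* (b′ :* b)) :* (u :* (a :* x)) :+ (u :* (a′ :* a)) :* (v :* (b :* y))
             := (u :* v) :* ((a :* b) :* (b′ :* x :+ a′ :* y)))
           refl u v (den x) (den x′) (den y) (den y′) (num x′) (num y′) ⟩
      (u * v) * ((den x * den y) * (den y′ * num x′ + den x′ * num y′)) ∎)

    ⊗-cong : ∀ {x x′ y y′} → x ≃ x′ → y ≃ y′ → x ⊗ y ≃ x′ ⊗ y′
    ⊗-cong {x} {x′} {y} {y′} (equal u u∈S e) (equal v v∈S f) = equal (u * v) (*-closed u∈S v∈S) (begin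
      (u * v) * ((den x′ * den y′) * (num x * num y))
        ≈⟨ solve 6 (λ u v a b x y → (u :* v) :* ((a :* b) :* (x :* y)) := (u :* (a :* x)) :* (v :* (b :* y)))
           refl u v (den x′) (den y′) (num x) (num y) ⟩
      (u * (den x′ * num x)) * (v * (den y′ * num y))
        ≈⟨ *-cong e f ⟩
      (u * (den x * num x′)) * (v * (den y * num y′))
        ≈⟨ solve 6 (λ u v a b x y → (u :* (a :* x)) :* (v :* (b :* y)) := (u :* v) :* ((a :* b) :* (x :* y)))
           refl u v (den x) (den y) (num x′) (num y′) ⟩
      (u * v) * ((den x * den y) * (num x′ * num y′)) ∎)

    private
      neg-out : ∀ u a x → u * (a * - x) ≈ - (u * (a * x))
      neg-out u a x = trans (*-congˡ (sym (-‿distribʳ-* a x))) (sym (-‿distribʳ-* u (a * x)))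

    ⊖-cong : ∀ {x y} → x ≃ y → ⊖ x ≃ ⊖ y
    ⊖-cong {x} {y} (equal u u∈S e) = equal u u∈S
      (trans (neg-out u (den y) (num x)) (trans (-‿cong e) (sym (neg-out u (den x) (num y)))))

    ⊕-comm : ∀ x y → x ⊕ y ≃ y ⊕ x
    ⊕-comm x y = exact (solve 4 (λ a b x y → (b :* a) :* (b :* x :+ a :* y) := (a :* b) :* (a :* y :+ b :* x))
      refl (den x) (den y) (num x) (num y))

    ⊕-inverseʳ : ∀ x → x ⊕ (⊖ x) ≃ ι 0#
    ⊕-inverseʳ x = exact (begin
      1# * (den x * num x + den x * - num x) ≈⟨ *-congˡ (sym (distribˡ (den x) (num x) (- num x))) ⟩
      1# * (den x * (num x - num x))         ≈⟨ *-congˡ (*-congˡ (-‿inverseʳ (num x))) ⟩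
      1# * (den x * 0#)                      ≈⟨ solve 1 (λ a → con 1 :* (a :* con 0) := (a :* a) :* con 0) refl (den x) ⟩
      (den x * den x) * 0#                   ∎)

    ⊕-identityˡ : ∀ x → ι 0# ⊕ x ≃ x
    ⊕-identityˡ x = exact (solve 2 (λ a x → a :* (a :* con 0 :+ con 1 :* x) := (con 1 :* a) :* x) refl (den x) (num x))

    ⊗-identityˡ : ∀ x → ι 1# ⊗ x ≃ x
    ⊗-identityˡ x = exact (solve 2 (λ a x → a :* (con 1 :* x) := (con 1 :* a) :* x) refl (den x) (num x))

    ⊗-comm : ∀ x y → x ⊗ y ≃ y ⊗ x
    ⊗-comm x y = exact (solve 4 (λ a b x y → (b :* a) :* (x :* y) := (a :* b) :* (y :* x))
      refl (den x) (den y) (num x) (num y))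

    ⊗-distribˡ : ∀ x y z → x ⊗ (y ⊕ z) ≃ (x ⊗ y) ⊕ (x ⊗ z)
    ⊗-distribˡ x y z = exact (solve 6 (λ a b c x y z →
      ((a :* b) :* (a :* c)) :* (x :* (c :* y :+ b :* z))
      := (a :* (b :* c)) :* ((a :* c) :* (x :* y) :+ (a :* b) :* (x :* z)))
      refl (den x) (den y) (den z) (num x) (num y) (num z))

    ι-cong : ∀ {x y} → x ≈ y → ι x ≃ ι y
    ι-cong x≈y = exact (*-congˡ x≈y)

    ι-+ : ∀ x y → ι (x + y) ≃ ι x ⊕ ι y
    ι-+ x y = exact (solve 2 (λ x y → (con 1 :* con 1) :* (x :+ y) := con 1 :* (con 1 :* x :+ con 1 :* y)) refl x y)

    ι-* : ∀ x y → ι (x * y) ≃ ι x ⊗ ι y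
    ι-* x y = exact (solve 2 (λ x y → (con 1 :* con 1) :* (x :* y) := con 1 :* (x :* y)) refl x y)

    1/x*x≈1 : ∀ x (x∈S : S x) → (1# / x [ x∈S ]) ⊗ ι x ≃ ι 1#
    1/x*x≈1 x x∈S = exact (solve 1 (λ x → con 1 :* (con 1 :* x) := (x :* con 1) :* con 1) refl x)

    isCommutativeRing-S⁻¹ : IsCommutativeRing _≃_ _⊕_ _⊗_ ⊖_ (ι 0#) (ι 1#)
    isCommutativeRing-S⁻¹ = record
      { isRing = record
        { +-isAbelianGroup = record
          { isGroup = record
            { isMonoid = record
              { isSemigroup = record
                { isMagma = record
                  { isEquivalence = record { refl = ≃-refl ; sym = ≃-sym ; trans = ≃-trans }
                  ; ∙-cong = ⊕-cong }
                ; assoc = λ x y z → exact (solve 6 (λ a b c x y z →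
                    (a :* (b :* c)) :* (c :* (b :* x :+ a :* y) :+ (a :* b) :* z)
                    := ((a :* b) :* c) :* ((b :* c) :* x :+ a :* (c :* y :+ b :* z)))
                    refl (den x) (den y) (den z) (num x) (num y) (num z)) }
              ; identity = ⊕-identityˡ , λ x → ≃-trans (⊕-comm x (ι 0#)) (⊕-identityˡ x) }
            ; inverse = (λ x → ≃-trans (⊕-comm (⊖ x) x) (⊕-inverseʳ x)) , ⊕-inverseʳ
            ; ⁻¹-cong = ⊖-cong }
          ; comm = ⊕-comm }
        ; *-cong = ⊗-cong
        ; *-assoc = λ x y z → exact (solve 6 (λ a b c x y z →
            (a :* (b :* c)) :* ((x :* y) :* z) := ((a :* b) :* c) :* (x :* (y :* z)))
            refl (den x) (den y) (den z) (num x) (num y) (num z))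
        ; *-identity = ⊗-identityˡ , λ x → ≃-trans (⊗-comm x (ι 1#)) (⊗-identityˡ x)
        ; distrib = ⊗-distribˡ , λ x y z → ≃-trans (⊗-comm (y ⊕ z) x)
            (≃-trans (⊗-distribˡ x y z) (⊕-cong (⊗-comm x y) (⊗-comm x z))) }
      ; *-comm = ⊗-comm }

  localisation : CommutativeRing (c ⊔ ℓ₁) (c ⊔ ℓ ⊔ ℓ₁)
  localisation = record
    { Carrier = Fraction ; _≈_ = _≃_ ; _+_ = _⊕_ ; _*_ = _⊗_ ; -_ = ⊖_ ; 0# = ι 0# ; 1# = ι 1#
    ; isCommutativeRing = isCommutativeRing-S⁻¹ }

  open RingMorphisms rawRing (CommutativeRing.rawRing localisation)

  abstract
    ι-isRingHomomorphism : IsRingHomomorphism ι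
    ι-isRingHomomorphism = record
      { isSemiringHomomorphism = record
        { isNearSemiringHomomorphism = record
          { +-isMonoidHomomorphism = record
            { isMagmaHomomorphism = record { isRelHomomorphism = record { cong = ι-cong } ; homo = ι-+ }
            ; ε-homo = ≃-refl }
          ; *-homo = ι-* }
        ; 1#-homo = ≃-refl }
      ; -‿homo = λ x → ≃-refl }

module Matrices {c ℓ : Level} (R : CommutativeRing c ℓ) where
  open CommutativeRing R
  open RingSolver commutativeSemiring

  record M₂ : Set c where
    constructor mat
    field e₁₁ e₁₂ e₂₁ e₂₂ : Carrier

  infix 4 _≈ₘ_

  record _≈ₘ_ (g h : M₂) : Set ℓ where
    constructor entries
    private
      module G = M₂ g
      module H = M₂ h
    field
      eq₁₁ : G.e₁₁ ≈ H.e₁₁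
      eq₁₂ : G.e₁₂ ≈ H.e₁₂
      eq₂₁ : G.e₂₁ ≈ H.e₂₁
      eq₂₂ : G.e₂₂ ≈ H.e₂₂

  infixl 7 _*ₘ_
  infixr 7 _•_

  _*ₘ_ : M₂ → M₂ → M₂
  mat a b c d *ₘ mat a′ b′ c′ d′ =
    mat (a * a′ + b * c′) (a * b′ + b * d′) (c * a′ + d * c′) (c * b′ + d * d′)

  1ₘ : M₂
  1ₘ = mat 1# 0# 0# 1#

  _•_ : Carrier → M₂ → M₂
  u • mat a b c d = mat (u * a) (u * b) (u * c) (u * d)

  private
    assoc₁ : ∀ a b a′ b′ c′ d′ x y →
      (a * a′ + b * c′) * x + (a * b′ + b * d′) * y ≈ a * (a′ * x + b′ * y) + b * (c′ * x + d′ * y)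
    assoc₁ = solve 8 (λ a b a′ b′ c′ d′ x y →
      (a :* a′ :+ b :* c′) :* x :+ (a :* b′ :+ b :* d′) :* y
      := a :* (a′ :* x :+ b′ :* y) :+ b :* (c′ :* x :+ d′ :* y)) refl

    1x+0y : ∀ x y → 1# * x + 0# * y ≈ x
    1x+0y = solve 2 (λ x y → con 1 :* x :+ con 0 :* y := x) refl

    0x+1y : ∀ x y → 0# * x + 1# * y ≈ y
    0x+1y = solve 2 (λ x y → con 0 :* x :+ con 1 :* y := y) refl

    x1+y0 : ∀ x y → x * 1# + y * 0# ≈ x
    x1+y0 = solve 2 (λ x y → x :* con 1 :+ y :* con 0 := x) refl

    x0+y1 : ∀ x y → x * 0# + y * 1# ≈ y
    x0+y1 = solve 2 (λ x y → x :* con 0 :+ y :* con 1 := y) refl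

  M₂-monoid : Monoid c ℓ
  M₂-monoid = record
    { Carrier = M₂ ; _≈_ = _≈ₘ_ ; _∙_ = _*ₘ_ ; ε = 1ₘ
    ; isMonoid = record
      { isSemigroup = record
        { isMagma = record
          { isEquivalence = record
            { refl  = entries refl refl refl refl
            ; sym   = λ (entries p q r s) → entries (sym p) (sym q) (sym r) (sym s)
            ; trans = λ (entries p q r s) (entries p′ q′ r′ s′) →
                entries (trans p p′) (trans q q′) (trans r r′) (trans s s′) }
          ; ∙-cong = λ (entries p q r s) (entries p′ q′ r′ s′) → entries
              (+-cong (*-cong p p′) (*-cong q r′)) (+-cong (*-cong p q′) (*-cong q s′))
              (+-cong (*-cong r p′) (*-cong s r′)) (+-cong (*-cong r q′) (*-cong s s′)) }
        ; assoc = λ (mat a b c d) (mat a′ b′ c′ d′) (mat x y z w) → entries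
            (assoc₁ a b a′ b′ c′ d′ x z) (assoc₁ a b a′ b′ c′ d′ y w)
            (assoc₁ c d a′ b′ c′ d′ x z) (assoc₁ c d a′ b′ c′ d′ y w) }
      ; identity =
          (λ (mat a b c d) → entries (1x+0y a c) (1x+0y b d) (0x+1y a c) (0x+1y b d))
        , (λ (mat a b c d) → entries (x1+y0 a b) (x0+y1 a b) (x1+y0 c d) (x0+y1 c d)) } }

  private module M = Monoid M₂-monoid

  record GL₂ : Set (c ⊔ ℓ) where
    field
      matrix   : M₂
      inverse  : M₂
      inverseˡ : inverse *ₘ matrix ≈ₘ 1ₘ
      inverseʳ : matrix *ₘ inverse ≈ₘ 1ₘ

  private
    abstract
      telescope : ∀ {a b a′ b′} → a *ₘ a′ ≈ₘ 1ₘ → b *ₘ b′ ≈ₘ 1ₘ → (a *ₘ b) *ₘ (b′ *ₘ a′) ≈ₘ 1ₘ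
      telescope {a} {b} {a′} {b′} p q = begin
        (a *ₘ b) *ₘ (b′ *ₘ a′)  ≈⟨ M.assoc a b (b′ *ₘ a′) ⟩
        a *ₘ (b *ₘ (b′ *ₘ a′))  ≈⟨ M.∙-congˡ (M.sym (M.assoc b b′ a′)) ⟩
        a *ₘ ((b *ₘ b′) *ₘ a′)  ≈⟨ M.∙-congˡ (M.∙-congʳ q) ⟩
        a *ₘ (1ₘ *ₘ a′)         ≈⟨ M.∙-congˡ (M.identityˡ a′) ⟩
        a *ₘ a′                 ≈⟨ p ⟩
        1ₘ                      ∎
        where open SetoidReasoning M.setoid

      1ₘ*1ₘ≈1ₘ : 1ₘ *ₘ 1ₘ ≈ₘ 1ₘ
      1ₘ*1ₘ≈1ₘ = M.identityˡ 1ₘ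

      unipotent-inverse : ∀ {x y} → y + x ≈ 0# → mat 1# x 0# 1# *ₘ mat 1# y 0# 1# ≈ₘ 1ₘ
      unipotent-inverse {x} {y} e = entries (x1+y0 1# x) (trans (+-cong (*-identityˡ y) (*-identityʳ x)) e)
                                            (0x+1y 1# 0#) (0x+1y y 1#)

      diagonal-inverse : ∀ {x y} → x * y ≈ 1# → mat x 0# 0# 1# *ₘ mat y 0# 0# 1# ≈ₘ 1ₘ
      diagonal-inverse {x} {y} e = entries (trans (+-cong e (zeroˡ 0#)) (+-identityʳ 1#)) (x0+y1 x 0#)
                                           (0x+1y y 0#) (0x+1y 0# 1#)

  infixl 7 _∙_
  infixr 8 _^ᴳ_

  _∙_ : GL₂ → GL₂ → GL₂
  g ∙ h = record
    { matrix   = matrix g *ₘ matrix h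
    ; inverse  = inverse h *ₘ inverse g
    ; inverseˡ = telescope (inverseˡ h) (inverseˡ g)
    ; inverseʳ = telescope (inverseʳ g) (inverseʳ h)
    }
    where open GL₂

  1ᴳ : GL₂
  1ᴳ = record { matrix = 1ₘ ; inverse = 1ₘ ; inverseˡ = 1ₘ*1ₘ≈1ₘ ; inverseʳ = 1ₘ*1ₘ≈1ₘ }

  _^ᴳ_ : GL₂ → ℕ → GL₂
  g ^ᴳ ℕ.zero  = 1ᴳ
  g ^ᴳ ℕ.suc i = g ∙ (g ^ᴳ i)

  unipotent : Carrier → GL₂
  unipotent x = record
    { matrix = mat 1# x 0# 1# ; inverse = mat 1# (- x) 0# 1#
    ; inverseˡ = unipotent-inverse (-‿inverseʳ x) ; inverseʳ = unipotent-inverse (-‿inverseˡ x) }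

  diagonal : ∀ x x⁻¹ → x⁻¹ * x ≈ 1# → GL₂
  diagonal x x⁻¹ e = record
    { matrix = mat x 0# 0# 1# ; inverse = mat x⁻¹ 0# 0# 1#
    ; inverseˡ = diagonal-inverse e ; inverseʳ = diagonal-inverse (trans (*-comm x x⁻¹) e) }

  open Exp semiring using (_^_)

  diagonal-^ : ∀ x x⁻¹ e i → GL₂.matrix (diagonal x x⁻¹ e ^ᴳ i) ≈ₘ mat (x ^ i) 0# 0# 1#
  diagonal-^ x x⁻¹ e ℕ.zero    = M.refl
  diagonal-^ x x⁻¹ e (ℕ.suc i) = M.trans (M.∙-congˡ (diagonal-^ x x⁻¹ e i)) (entries
    (trans (+-congˡ (zeroˡ 0#)) (+-identityʳ _)) (x0+y1 x 0#) (0x+1y (x ^ i) 0#) (0x+1y 0# 1#))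

  1•g1 : ∀ g → g ≈ₘ 1# • (g *ₘ 1ₘ)
  1•g1 g = M.trans (M.sym (M.identityʳ g))
    (entries (sym (*-identityˡ _)) (sym (*-identityˡ _)) (sym (*-identityˡ _)) (sym (*-identityˡ _)))

  private
    unipotent-diagonal₀ : ∀ {x y z δ} → δ ≈ₘ mat x 0# 0# 1# → y ≈ x * z →
      mat 1# y 0# 1# *ₘ δ ≈ₘ 1# • ((mat 1# 0# 0# 1# *ₘ δ) *ₘ mat 1# z 0# 1#)
    unipotent-diagonal₀ {x} {y} {z} {δ} d e = begin
      mat 1# y 0# 1# *ₘ δ
        ≈⟨ M.∙-congˡ d ⟩
      mat 1# y 0# 1# *ₘ mat x 0# 0# 1#
        ≈⟨ entries (solve 2 (λ x y → con 1 :* x :+ y :* con 0 := x :* con 1 :+ con 0 :* con 0) refl x y)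
                   (trans (x0+y1 1# y) (trans e (sym (trans (+-congˡ (zeroˡ 1#)) (+-identityʳ _)))))
                   (solve 1 (λ x → con 0 :* x :+ con 1 :* con 0 := con 0 :* con 1 :+ con 1 :* con 0) refl x)
                   (solve 1 (λ z → con 0 :* con 0 :+ con 1 :* con 1 := con 0 :* z :+ con 1 :* con 1) refl z) ⟩
      mat x 0# 0# 1# *ₘ mat 1# z 0# 1#
        ≈⟨ M.∙-congʳ (M.sym d) ⟩
      δ *ₘ mat 1# z 0# 1#
        ≈⟨ M.∙-congʳ (M.sym (M.identityˡ δ)) ⟩
      (1ₘ *ₘ δ) *ₘ mat 1# z 0# 1#
        ≈⟨ entries (sym (*-identityˡ _)) (sym (*-identityˡ _)) (sym (*-identityˡ _)) (sym (*-identityˡ _)) ⟩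
      1# • ((1ₘ *ₘ δ) *ₘ mat 1# z 0# 1#) ∎
      where open SetoidReasoning M.setoid

  abstract
    unipotent-diagonal : ∀ x x⁻¹ e i {y} z → y ≈ (x ^ i) * z →
      GL₂.matrix (unipotent y ∙ (diagonal x x⁻¹ e ^ᴳ i))
      ≈ₘ 1# • (GL₂.matrix (unipotent 0# ∙ (diagonal x x⁻¹ e ^ᴳ i)) *ₘ mat 1# z 0# 1#)
    unipotent-diagonal x x⁻¹ e i z = unipotent-diagonal₀ (diagonal-^ x x⁻¹ e i)

module PGL₂Cosets {c ℓ c′ ℓ′ : Level} (Z : CommutativeRing c ℓ) (Q : CommutativeRing c′ ℓ′)
  (ι : CommutativeRing.Carrier Z → CommutativeRing.Carrier Q)
  (ι-hom : RingMorphisms.IsRingHomomorphism (CommutativeRing.rawRing Z) (CommutativeRing.rawRing Q) ι)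
  (ϖ : CommutativeRing.Carrier Z) (ϖ⁻¹ : CommutativeRing.Carrier Q)
  (ϖ⁻¹*ϖ≈1 : CommutativeRing._≈_ Q (CommutativeRing._*_ Q ϖ⁻¹ (ι ϖ)) (CommutativeRing.1# Q))
  where

  private
    module Z = CommutativeRing Z
    module K = Matrices Z
    module M = Monoid (Matrices.M₂-monoid Q)
  open CommutativeRing Q
  open Matrices Q
  open Exp Z.semiring using () renaming (_^_ to _^ᶻ_)
  open Exp semiring using (_^_)
  open RingMorphisms.IsRingHomomorphism ι-hom
  open RingSolver commutativeSemiring

  mapι : K.M₂ → M₂
  mapι (K.mat x y z w) = mat (ι x) (ι y) (ι z) (ι w)

  -- Equality in GL₂(Q) / Qˣ GL₂(Z) = PGL₂(Q) / PGL₂(Z).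
  infix 4 _∼_

  record _∼_ (g h : GL₂) : Set (c ⊔ ℓ ⊔ c′ ⊔ ℓ′) where
    field
      scalar   : Carrier
      unit     : AlgDefs.Invertible _≈_ 1# _*_ scalar
      k        : K.GL₂
      equation : GL₂.matrix g ≈ₘ scalar • (GL₂.matrix h *ₘ mapι (K.GL₂.matrix k))

  φ : GL₂
  φ = diagonal (ι ϖ) ϖ⁻¹ ϖ⁻¹*ϖ≈1

  𝔫 : Z.Carrier → GL₂
  𝔫 z = unipotent (ι z)

  abstract
    1-invertible : AlgDefs.Invertible _≈_ 1# _*_ 1#
    1-invertible = 1# , *-identityˡ 1# , *-identityˡ 1#

    ι-^ : ∀ x i → ι (x ^ᶻ i) ≈ ι x ^ i
    ι-^ x ℕ.zero    = 1#-homo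
    ι-^ x (ℕ.suc i) = trans (*-homo x (x ^ᶻ i)) (*-congˡ (ι-^ x i))

    •-cong : ∀ {u g h} → g ≈ₘ h → u • g ≈ₘ u • h
    •-cong (entries p q r s) = entries (*-congˡ p) (*-congˡ q) (*-congˡ r) (*-congˡ s)

    ∼-refl : ∀ {g} → g ∼ g
    ∼-refl {g} = record
      { scalar = 1# ; unit = 1-invertible ; k = K.1ᴳ
      ; equation = M.trans (1•g1 (GL₂.matrix g)) (•-cong (M.∙-congˡ
          (entries (sym 1#-homo) (sym 0#-homo) (sym 0#-homo) (sym 1#-homo)))) }

    𝔫-cong : ∀ {x y g h} → x Z.≈ y → 𝔫 y ∙ g ∼ h → 𝔫 x ∙ g ∼ h
    𝔫-cong {g = g} x≈y s = record
      { scalar = scalar ; unit = unit ; k = k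
      ; equation = M.trans (M.∙-congʳ {GL₂.matrix g} (entries refl (⟦⟧-cong x≈y) refl refl)) equation }
      where open _∼_ s

    private
      •-*ₘ-comm : ∀ u f h k → f *ₘ (u • (h *ₘ k)) ≈ₘ u • ((f *ₘ h) *ₘ k)
      •-*ₘ-comm u f@(mat a b a′ b′) h k = M.trans (pull-out f (h *ₘ k)) (•-cong (M.sym (M.assoc f h k)))
        where
        move : ∀ a b x y → a * (u * x) + b * (u * y) ≈ u * (a * x + b * y)
        move = solve 5 (λ u a b x y → a :* (u :* x) :+ b :* (u :* y) := u :* (a :* x :+ b :* y)) refl u

        pull-out : ∀ f g → f *ₘ (u • g) ≈ₘ u • (f *ₘ g)
        pull-out (mat a b a′ b′) (mat x y x′ y′) =
          entries (move a b x x′) (move a b y y′) (move a′ b′ x x′) (move a′ b′ y y′)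

      unipotent-+ : ∀ x y h → mat 1# (ι (x Z.+ y)) 0# 1# *ₘ h ≈ₘ mat 1# (ι x) 0# 1# *ₘ (mat 1# (ι y) 0# 1# *ₘ h)
      unipotent-+ x y h = M.trans (M.∙-congʳ (entries
        (solve 1 (λ x → con 1 := con 1 :* con 1 :+ x :* con 0) refl (ι x))
        (trans (+-homo x y) (solve 2 (λ x y → x :+ y := con 1 :* y :+ x :* con 1) refl (ι x) (ι y)))
        (solve 0 (con 0 := con 0 :* con 1 :+ con 1 :* con 0) refl)
        (solve 1 (λ y → con 1 := con 0 :* y :+ con 1 :* con 1) refl (ι y)))) (M.assoc _ _ h)

    𝔫-translate : ∀ z {x y δ} → 𝔫 x ∙ δ ∼ 𝔫 y ∙ δ → 𝔫 (z Z.+ x) ∙ δ ∼ 𝔫 (z Z.+ y) ∙ δ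
    𝔫-translate z {x} {y} {δ} s = record
      { scalar = scalar ; unit = unit ; k = k
      ; equation = M.trans (unipotent-+ z x (GL₂.matrix δ)) (M.trans (M.∙-congˡ equation)
          (M.trans (•-*ₘ-comm scalar _ _ _)
            (•-cong (M.∙-congʳ (M.sym (unipotent-+ z y (GL₂.matrix δ))))))) }
      where open _∼_ s

    stabilises : ∀ i z → 𝔫 ((ϖ ^ᶻ i) Z.* z Z.+ Z.0#) ∙ (φ ^ᴳ i) ∼ 𝔫 Z.0# ∙ (φ ^ᴳ i)
    stabilises i z = record
      { scalar = 1# ; unit = 1-invertible ; k = K.unipotent z
      ; equation = M.trans
          (unipotent-diagonal (ι ϖ) ϖ⁻¹ ϖ⁻¹*ϖ≈1 i (ι z)
            (trans (⟦⟧-cong (Z.+-identityʳ _)) (trans (*-homo (ϖ ^ᶻ i) z) (*-congʳ (ι-^ ϖ i)))))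
          (•-cong (M.∙-cong (M.∙-congʳ (entries refl (sym 0#-homo) refl refl))
            (entries (sym 1#-homo) refl (sym 0#-homo) (sym 1#-homo)))) }

  -- 𝔫(x) 𝔳ᵢ = 𝔫(y) 𝔳ᵢ for 𝔳ᵢ = φⁱ 𝔳₀.
  record SameVertex (i : ℕ) (x y : Z.Carrier) : Set (c ⊔ ℓ ⊔ c′ ⊔ ℓ′) where
    constructor same-coset
    field
      coset : 𝔫 x ∙ (φ ^ᴳ i) ∼ 𝔫 y ∙ (φ ^ᴳ i)

  abstract
    SameVertex-refl : ∀ {i x} → SameVertex i x x
    SameVertex-refl = same-coset ∼-refl

    SameVertex-respˡ : ∀ {i x y z} → x Z.≈ y → SameVertex i y z → SameVertex i x z
    SameVertex-respˡ x≈y (same-coset s) = same-coset (𝔫-cong x≈y s)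

    SameVertex-translate : ∀ z {i x y} → SameVertex i x y → SameVertex i (z Z.+ x) (z Z.+ y)
    SameVertex-translate z (same-coset s) = same-coset (𝔫-translate z s)

    SameVertex-pow : ∀ i z → SameVertex i ((ϖ ^ᶻ i) Z.* z Z.+ Z.0#) Z.0#
    SameVertex-pow i z = same-coset (stabilises i z)

module PAdicNumbers (p : ℕ) where

  ℤ/p^_ : ℕ → CommutativeRing 0ℓ 0ℓ
  ℤ/p^ n = ℤ-properties.+-*-commutativeRing ⧸ (+ (p ℕ.^ n))

  private
    module ℤ/ (n : ℕ) = CommutativeRing (ℤ/p^ n)

  -- The inverse limit of the ℤ/pⁿ, an element being given by integer representatives.
  record PAdicInteger : Set where
    constructor limit
    field
      residue  : ℕ → ℤ
      coherent : ∀ n → ℤ/._≈_ n (residue (ℕ.suc n)) (residue n)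

  open PAdicInteger public

  infix 4 _≈ₚ_

  record _≈ₚ_ (x y : PAdicInteger) : Set where
    constructor levelwise
    field
      at : ∀ n → ℤ/._≈_ n (residue x n) (residue y n)

  open _≈ₚ_ public

  private
    const : ℤ → PAdicInteger
    const z = limit (λ _ → z) (λ n → ℤ/.refl n)

    _+ₚ_ _*ₚ_ : PAdicInteger → PAdicInteger → PAdicInteger
    x +ₚ y = limit (λ n → ℤ/._+_ n (residue x n) (residue y n)) (λ n → ℤ/.+-cong n (coherent x n) (coherent y n))
    x *ₚ y = limit (λ n → ℤ/._*_ n (residue x n) (residue y n)) (λ n → ℤ/.*-cong n (coherent x n) (coherent y n))

    -ₚ_ : PAdicInteger → PAdicInteger
    -ₚ x = limit (λ n → ℤ/.-_ n (residue x n)) (λ n → ℤ/.-‿cong n (coherent x n))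

  abstract
    isCommutativeRing-ℤₚ : IsCommutativeRing _≈ₚ_ _+ₚ_ _*ₚ_ -ₚ_ (const (+ 0)) (const (+ 1))
    isCommutativeRing-ℤₚ = record
      { isRing = record
        { +-isAbelianGroup = record
          { isGroup = record
            { isMonoid = record
              { isSemigroup = record
                { isMagma = record
                  { isEquivalence = record
                    { refl  = levelwise (λ n → ℤ/.refl n)
                    ; sym   = λ e → levelwise (λ n → ℤ/.sym n (at e n))
                    ; trans = λ e f → levelwise (λ n → ℤ/.trans n (at e n) (at f n)) }
                  ; ∙-cong = λ e f → levelwise (λ n → ℤ/.+-cong n (at e n) (at f n)) }
                ; assoc = λ x y z → levelwise (λ n → ℤ/.+-assoc n (residue x n) (residue y n) (residue z n)) }
              ; identity = (λ x → levelwise (λ n → ℤ/.+-identityˡ n (residue x n)))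
                         , (λ x → levelwise (λ n → ℤ/.+-identityʳ n (residue x n))) }
            ; inverse = (λ x → levelwise (λ n → ℤ/.-‿inverseˡ n (residue x n)))
                      , (λ x → levelwise (λ n → ℤ/.-‿inverseʳ n (residue x n)))
            ; ⁻¹-cong = λ e → levelwise (λ n → ℤ/.-‿cong n (at e n)) }
          ; comm = λ x y → levelwise (λ n → ℤ/.+-comm n (residue x n) (residue y n)) }
        ; *-cong = λ e f → levelwise (λ n → ℤ/.*-cong n (at e n) (at f n))
        ; *-assoc = λ x y z → levelwise (λ n → ℤ/.*-assoc n (residue x n) (residue y n) (residue z n))
        ; *-identity = (λ x → levelwise (λ n → ℤ/.*-identityˡ n (residue x n)))
                     , (λ x → levelwise (λ n → ℤ/.*-identityʳ n (residue x n)))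
        ; distrib = (λ x y z → levelwise (λ n → ℤ/.distribˡ n (residue x n) (residue y n) (residue z n)))
                  , (λ x y z → levelwise (λ n → ℤ/.distribʳ n (residue x n) (residue y n) (residue z n))) }
      ; *-comm = λ x y → levelwise (λ n → ℤ/.*-comm n (residue x n) (residue y n)) }

  ℤₚ : CommutativeRing 0ℓ 0ℓ
  ℤₚ = record
    { Carrier = PAdicInteger ; _≈_ = _≈ₚ_ ; _+_ = _+ₚ_ ; _*_ = _*ₚ_ ; -_ = -ₚ_ ; 0# = const (+ 0) ; 1# = const (+ 1)
    ; isCommutativeRing = isCommutativeRing-ℤₚ }

  open CommutativeRing ℤₚ using (_≈_; _*_; semiring; refl; sym; trans; *-cong)
  open Exp semiring using (_^_; ^-homo-*)

  p# : PAdicInteger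
  p# = const (+ p)

  PowerOf-p : Pred PAdicInteger 0ℓ
  PowerOf-p x = ∃[ k ] x ≈ p# ^ k

  abstract
    1∈S : PowerOf-p (CommutativeRing.1# ℤₚ)
    1∈S = 0 , refl

    p∈S : PowerOf-p p#
    p∈S = 1 , sym (CommutativeRing.*-identityʳ ℤₚ p#)

    S-closed : ∀ {x y} → PowerOf-p x → PowerOf-p y → PowerOf-p (x * y)
    S-closed (k , e) (l , f) = k ℕ.+ l , trans (*-cong e f) (sym (^-homo-* p# k l))

  module Fractions = Localisation ℤₚ PowerOf-p 1∈S S-closed

  ℚₚ : CommutativeRing 0ℓ 0ℓ
  ℚₚ = Fractions.localisation

  ι : PAdicInteger → CommutativeRing.Carrier ℚₚ
  ι = Fractions.ι

  1/p : CommutativeRing.Carrier ℚₚ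
  1/p = CommutativeRing.1# ℤₚ Fractions./ p# [ p∈S ]

  1/p*p≈1 : CommutativeRing._≈_ ℚₚ (CommutativeRing._*_ ℚₚ 1/p (ι p#)) (CommutativeRing.1# ℚₚ)
  1/p*p≈1 = Fractions.1/x*x≈1 p# p∈S

module HalfTree (p : ℕ) where
  open PAdicNumbers p
  open CommutativeRing ℤₚ using (_+_; _*_; 0#; 1#) renaming (Carrier to 𝔑₀) public
  open Exp (CommutativeRing.semiring ℤₚ) using (_^_)

  -- The vertices of the Bruhat–Tits tree are the homothety classes of lattices g ℤₚ², that is,
  -- the points g 𝔳₀ of the orbit PGL₂(ℚₚ) / PGL₂(ℤₚ) of 𝔳₀ = [ℤₚ²].
  open PGL₂Cosets ℤₚ ℚₚ ι Fractions.ι-isRingHomomorphism p# 1/p 1/p*p≈1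
    using (SameVertex; SameVertex-refl; SameVertex-respˡ; SameVertex-translate; SameVertex-pow)

  -- n ·𝔳 i is the vertex 𝔫(n) 𝔳ᵢ, n ·𝔢 i the edge 𝔫(n) 𝔢ᵢ.
  infix 5 _·𝔳_ _·𝔢_

  data Vertex : Set where
    _·𝔳_ : 𝔑₀ → ℕ → Vertex

  data Edge : Set where
    _·𝔢_ : 𝔑₀ → ℕ → Edge

  infix 4 _≈ᵛ_ _≈ᵉ_ _≈ˢ_ _∈_

  data _≈ᵛ_ : Vertex → Vertex → Set where
    same : ∀ {n n′ i} → SameVertex i n n′ → n ·𝔳 i ≈ᵛ n′ ·𝔳 i

  -- 𝔢ᵢ₊₁ = {𝔳ᵢ₊₁ , 𝔳ᵢ}, whereas the loose end 𝔢₀ contains 𝔳₀ only.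
  data _∈_ (y : Vertex) : Edge → Set where
    outer : ∀ {n i} → y ≈ᵛ n ·𝔳 i → y ∈ n ·𝔢 i
    inner : ∀ {n i} → y ≈ᵛ n ·𝔳 i → y ∈ n ·𝔢 ℕ.suc i

  data _≈ᵉ_ : Edge → Edge → Set where
    same : ∀ {n n′ i} → (∀ y → y ∈ n ·𝔢 i ⇔ y ∈ n′ ·𝔢 i) → n ·𝔢 i ≈ᵉ n′ ·𝔢 i

  data Simplex : Set where
    vertex : Vertex → Simplex
    edge   : Edge → Simplex

  data _≈ˢ_ : Simplex → Simplex → Set where
    vertex : ∀ {y y′} → y ≈ᵛ y′ → vertex y ≈ˢ vertex y′
    edge   : ∀ {τ τ′} → τ ≈ᵉ τ′ → edge τ ≈ˢ edge τ′

  infixr 6 _·ᵛ_ _·_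

  _·ᵛ_ : 𝔑₀ → Vertex → Vertex
  g ·ᵛ (n ·𝔳 i) = (g + n) ·𝔳 i

  _·_ : 𝔑₀ → Simplex → Simplex
  g · vertex y        = vertex (g ·ᵛ y)
  g · edge (n ·𝔢 i) = edge ((g + n) ·𝔢 i)

  𝔳 : ℕ → Vertex
  𝔳 i = 0# ·𝔳 i

  𝔢 : ℕ → Edge
  𝔢 i = 0# ·𝔢 i

  -- 𝔑₀ is written additively, so its subgroup of pⁱ-th powers consists of these elements.
  pow : ℕ → 𝔑₀ → 𝔑₀
  pow i z = (p# ^ i) * z

  ≈ᵛ-refl : ∀ {y} → y ≈ᵛ y
  ≈ᵛ-refl {n ·𝔳 i} = same SameVertex-refl

  ·ᵛ-cong : ∀ g {y y′} → y ≈ᵛ y′ → g ·ᵛ y ≈ᵛ g ·ᵛ y′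
  ·ᵛ-cong g (same s) = same (SameVertex-translate g s)

  ·ᵛ-congʳ : ∀ {g h y y′} → CommutativeRing._≈_ ℤₚ g h → h ·ᵛ y ≈ᵛ y′ → g · vertex y ≈ˢ vertex y′
  ·ᵛ-congʳ {y = n ·𝔳 i} g≈h (same s) = vertex (same (SameVertex-respˡ (CommutativeRing.+-congʳ ℤₚ g≈h) s))

  0·_ : ∀ {y y′} → y ≈ᵛ y′ → 0# · vertex y ≈ˢ vertex y′
  0·_ {n ·𝔳 i} (same s) = vertex (same (SameVertex-respˡ (CommutativeRing.+-identityˡ ℤₚ n) s))

  pow-fixes-𝔳 : ∀ i z → pow i z · vertex (𝔳 i) ≈ˢ vertex (𝔳 i)
  pow-fixes-𝔳 i z = vertex (same (SameVertex-pow i z))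

  -- Edges of the half tree with 𝔢₀ removed: n ·𝔢⁺ i is 𝔫(n) 𝔢ᵢ₊₁.
  data InnerEdge : Set where
    _·𝔢⁺_ : 𝔑₀ → ℕ → InnerEdge

  toEdge : InnerEdge → Edge
  toEdge (n ·𝔢⁺ i) = n ·𝔢 ℕ.suc i

  infixr 6 _·⁺_

  _·⁺_ : 𝔑₀ → InnerEdge → InnerEdge
  g ·⁺ (n ·𝔢⁺ i) = (g + n) ·𝔢⁺ i

  ·-edge : ∀ g τ → g · edge (toEdge τ) ≈ˢ edge (toEdge (g ·⁺ τ))
  ·-edge g (n ·𝔢⁺ i) = edge (same (λ y → mk⇔ (λ y∈τ → y∈τ) (λ y∈τ → y∈τ)))

  endpoints : (τ : InnerEdge) → List (Σ[ y ∈ Vertex ] y ∈ toEdge τ)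
  endpoints (n ·𝔢⁺ i) = (n ·𝔳 ℕ.suc i , outer ≈ᵛ-refl) ∷ (n ·𝔳 i , inner ≈ᵛ-refl) ∷ []

⟨_⟩ : {R : Ring r ℓr} → LeftModule R a ℓ → Set a
⟨ M ⟩ = LeftModule.Carrierᴹ M

IsLinear : {R : Ring r ℓr} (M : LeftModule R a ℓ) (N : LeftModule R c ℓ₁) → (⟨ M ⟩ → ⟨ N ⟩) → Set _
IsLinear M N = LeftModuleMorphisms.IsLeftModuleHomomorphism (LeftModule.rawLeftModule M) (LeftModule.rawLeftModule N)

IsLinearIsomorphism : {R : Ring r ℓr} (M : LeftModule R a ℓ) (N : LeftModule R c ℓ₁) → (⟨ M ⟩ → ⟨ N ⟩) → Set _
IsLinearIsomorphism M N =
  LeftModuleMorphisms.IsLeftModuleIsomorphism (LeftModule.rawLeftModule M) (LeftModule.rawLeftModule N)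

module _ {R : Ring r ℓr} where

  module _ (M : LeftSemimodule (Ring.semiring R) a ℓ) where
    open Ring R
    open LeftSemimodule M
    open SetoidReasoning ≈ᴹ-setoid

    private
      inverse : ∀ x → (- 1#) *ₗ x +ᴹ x ≈ᴹ 0ᴹ
      inverse x = begin
        (- 1#) *ₗ x +ᴹ x       ≈⟨ +ᴹ-congˡ (≈ᴹ-sym (*ₗ-identityˡ x)) ⟩
        (- 1#) *ₗ x +ᴹ 1# *ₗ x ≈⟨ ≈ᴹ-sym (*ₗ-distribʳ x (- 1#) 1#) ⟩
        (- 1# + 1#) *ₗ x       ≈⟨ *ₗ-cong (-‿inverseˡ 1#) ≈ᴹ-refl ⟩
        0# *ₗ x                ≈⟨ *ₗ-zeroˡ x ⟩
        0ᴹ                     ∎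

    toLeftModule : LeftModule R a ℓ
    toLeftModule = record
      { Carrierᴹ = Carrierᴹ ; _≈ᴹ_ = _≈ᴹ_ ; _+ᴹ_ = _+ᴹ_ ; _*ₗ_ = _*ₗ_ ; 0ᴹ = 0ᴹ ; -ᴹ_ = (- 1#) *ₗ_
      ; isLeftModule = record
        { isLeftSemimodule = isLeftSemimodule
        ; -ᴹ‿cong = *ₗ-cong refl
        ; -ᴹ‿inverse = inverse , λ x → ≈ᴹ-trans (+ᴹ-comm _ _) (inverse x) } }

  module _ (M : LeftModule R a ℓ) (N : LeftModule R c ℓ₁) where
    private
      module M = LeftModule M
      module N = LeftModule N
      module R = Ring R

    linear : {f : ⟨ M ⟩ → ⟨ N ⟩} →
      (∀ {x y} → x M.≈ᴹ y → f x N.≈ᴹ f y) →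
      (∀ x y → f (x M.+ᴹ y) N.≈ᴹ f x N.+ᴹ f y) →
      (∀ a x → f (a M.*ₗ x) N.≈ᴹ a N.*ₗ f x) → IsLinear M N f
    linear {f} f-cong f-+ f-* = record
      { +ᴹ-isGroupHomomorphism = record
        { isMonoidHomomorphism = record
          { isMagmaHomomorphism = record { isRelHomomorphism = record { cong = f-cong } ; homo = f-+ }
          ; ε-homo = f-0 }
        ; ⁻¹-homo = λ x → inverseˡ-uniqueᴹ (f (M.-ᴹ x)) (f x)
            (N.≈ᴹ-trans (N.≈ᴹ-sym (f-+ (M.-ᴹ x) x)) (N.≈ᴹ-trans (f-cong (M.-ᴹ‿inverseˡ x)) f-0)) }
      ; *ₗ-homo = f-* }
      where
      open LeftModuleProperties N using (inverseˡ-uniqueᴹ)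
      f-0 : f M.0ᴹ N.≈ᴹ N.0ᴹ
      f-0 = N.≈ᴹ-trans (f-cong (M.≈ᴹ-sym (M.*ₗ-zeroˡ M.0ᴹ)))
        (N.≈ᴹ-trans (f-* R.0# M.0ᴹ) (N.*ₗ-zeroˡ (f M.0ᴹ)))

  record IsBasis (M : LeftModule R a ℓ) {d} (b : Vector ⟨ M ⟩ d) : Set (r ⊔ ℓr ⊔ a ⊔ ℓ) where
    open LeftModule M
    open Ring R using (Carrier; _≈_; 0#)
    open MonoidSum +ᴹ-monoid using (sum)
    field
      spans       : ∀ x → Σ[ c ∈ Vector Carrier d ] x ≈ᴹ sum (λ i → c i *ₗ b i)
      independent : ∀ (c : Vector Carrier d) → sum (λ i → c i *ₗ b i) ≈ᴹ 0ᴹ → ∀ i → c i ≈ 0#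

  HasDimension : LeftModule R a ℓ → ℕ → Set (r ⊔ ℓr ⊔ a ⊔ ℓ)
  HasDimension M d = Σ[ b ∈ Vector ⟨ M ⟩ d ] IsBasis M b

  record IsSubmodule (M : LeftModule R a ℓ) (P : Pred ⟨ M ⟩ ℓ₁) : Set (r ⊔ a ⊔ ℓ ⊔ ℓ₁) where
    open LeftModule M
    field
      resp-≈    : ∀ {x y} → x ≈ᴹ y → P x → P y
      0-closed  : P 0ᴹ
      +-closed  : ∀ {x y} → P x → P y → P (x +ᴹ y)
      *-closed  : ∀ a {x} → P x → P (a *ₗ x)

  module Submodule (M : LeftModule R a ℓ) {P : Pred ⟨ M ⟩ ℓ₁} (P≤M : IsSubmodule M P) where
    open LeftModule M
    open IsSubmodule P≤M

    infix 4 _≈ₛ_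

    record _≈ₛ_ (x y : Σ ⟨ M ⟩ P) : Set ℓ where
      constructor restrict
      field
        unrestrict : proj₁ x ≈ᴹ proj₁ y

    submodule : LeftModule R (a ⊔ ℓ₁) ℓ
    submodule = toLeftModule (record
      { Carrierᴹ = Σ ⟨ M ⟩ P ; _≈ᴹ_ = _≈ₛ_
      ; _+ᴹ_ = λ (x , x∈P) (y , y∈P) → x +ᴹ y , +-closed x∈P y∈P
      ; _*ₗ_ = λ a (x , x∈P) → a *ₗ x , *-closed a x∈P
      ; 0ᴹ = 0ᴹ , 0-closed
      ; isLeftSemimodule = record
        { +ᴹ-isCommutativeMonoid = record
          { isMonoid = record
            { isSemigroup = record
              { isMagma = record
                { isEquivalence = record
                  { refl  = restrict ≈ᴹ-refl
                  ; sym   = λ (restrict e) → restrict (≈ᴹ-sym e)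
                  ; trans = λ (restrict e) (restrict f) → restrict (≈ᴹ-trans e f) }
                ; ∙-cong = λ (restrict e) (restrict f) → restrict (+ᴹ-cong e f) }
              ; assoc = λ x y z → restrict (+ᴹ-assoc (proj₁ x) (proj₁ y) (proj₁ z)) }
            ; identity = (λ x → restrict (+ᴹ-identityˡ (proj₁ x))) , (λ x → restrict (+ᴹ-identityʳ (proj₁ x))) }
          ; comm = λ x y → restrict (+ᴹ-comm (proj₁ x) (proj₁ y)) }
        ; isPreleftSemimodule = record
          { *ₗ-cong      = λ a≈b (restrict e) → restrict (*ₗ-cong a≈b e)
          ; *ₗ-zeroˡ     = λ x → restrict (*ₗ-zeroˡ (proj₁ x))
          ; *ₗ-distribʳ  = λ x a b → restrict (*ₗ-distribʳ (proj₁ x) a b)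
          ; *ₗ-identityˡ = λ x → restrict (*ₗ-identityˡ (proj₁ x))
          ; *ₗ-assoc     = λ a b x → restrict (*ₗ-assoc a b (proj₁ x))
          ; *ₗ-zeroʳ     = λ a → restrict (*ₗ-zeroʳ a)
          ; *ₗ-distribˡ  = λ a x y → restrict (*ₗ-distribˡ a (proj₁ x) (proj₁ y)) } } })

  module Quotient (M : LeftModule R a ℓ) {P : Pred ⟨ M ⟩ ℓ₁} (P≤M : IsSubmodule M P) where
    open LeftModule M
    open IsSubmodule P≤M
    open Ring R using (1#; -_)
    open SetoidReasoning ≈ᴹ-setoid

    infix 4 _≈ₚ_

    record _≈ₚ_ (x y : ⟨ M ⟩) : Set (a ⊔ ℓ ⊔ ℓ₁) where
      constructor modulo
      field
        {difference} : ⟨ M ⟩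
        difference∈P : P difference
        equation     : x ≈ᴹ y +ᴹ difference

    ≈⇒≈ₚ : ∀ {x y} → x ≈ᴹ y → x ≈ₚ y
    ≈⇒≈ₚ {x} {y} e = modulo 0-closed (≈ᴹ-trans e (≈ᴹ-sym (+ᴹ-identityʳ y)))

    private
      interchange : ∀ x y u v → (x +ᴹ y) +ᴹ (u +ᴹ v) ≈ᴹ (x +ᴹ u) +ᴹ (y +ᴹ v)
      interchange = CommutativeSemigroupProperties.interchange
        (CommutativeMonoid.commutativeSemigroup +ᴹ-commutativeMonoid)

      ≈ₚ-sym : ∀ {x y} → x ≈ₚ y → y ≈ₚ x
      ≈ₚ-sym {x} {y} (modulo {z} z∈P e) = modulo (*-closed (- 1#) z∈P) (begin
        y                          ≈⟨ ≈ᴹ-sym (+ᴹ-identityʳ y) ⟩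
        y +ᴹ 0ᴹ                    ≈⟨ +ᴹ-congˡ (≈ᴹ-sym (LeftModule.-ᴹ‿inverseʳ (toLeftModule leftSemimodule) z)) ⟩
        y +ᴹ (z +ᴹ (- 1#) *ₗ z)    ≈⟨ ≈ᴹ-sym (+ᴹ-assoc y z _) ⟩
        (y +ᴹ z) +ᴹ (- 1#) *ₗ z    ≈⟨ +ᴹ-congʳ (≈ᴹ-sym e) ⟩
        x +ᴹ (- 1#) *ₗ z           ∎)

      ≈ₚ-trans : ∀ {x y z} → x ≈ₚ y → y ≈ₚ z → x ≈ₚ z
      ≈ₚ-trans {x} {y} {z} (modulo {u} u∈P e) (modulo {v} v∈P f) = modulo (+-closed v∈P u∈P) (begin
        x               ≈⟨ e ⟩
        y +ᴹ u          ≈⟨ +ᴹ-congʳ f ⟩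
        (z +ᴹ v) +ᴹ u   ≈⟨ +ᴹ-assoc z v u ⟩
        z +ᴹ (v +ᴹ u)   ∎)

    quotient : LeftModule R a (a ⊔ ℓ ⊔ ℓ₁)
    quotient = toLeftModule (record
      { Carrierᴹ = ⟨ M ⟩ ; _≈ᴹ_ = _≈ₚ_ ; _+ᴹ_ = _+ᴹ_ ; _*ₗ_ = _*ₗ_ ; 0ᴹ = 0ᴹ
      ; isLeftSemimodule = record
        { +ᴹ-isCommutativeMonoid = record
          { isMonoid = record
            { isSemigroup = record
              { isMagma = record
                { isEquivalence = record { refl = ≈⇒≈ₚ ≈ᴹ-refl ; sym = ≈ₚ-sym ; trans = ≈ₚ-trans }
                ; ∙-cong = λ {x} {y} {u} {v} (modulo {z} z∈P e) (modulo {w} w∈P f) →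
                    modulo (+-closed z∈P w∈P) (≈ᴹ-trans (+ᴹ-cong e f) (interchange y z v w)) }
              ; assoc = λ x y z → ≈⇒≈ₚ (+ᴹ-assoc x y z) }
            ; identity = (λ x → ≈⇒≈ₚ (+ᴹ-identityˡ x)) , (λ x → ≈⇒≈ₚ (+ᴹ-identityʳ x)) }
          ; comm = λ x y → ≈⇒≈ₚ (+ᴹ-comm x y) }
        ; isPreleftSemimodule = record
          { *ₗ-cong      = λ {a} {b} {x} {y} a≈b (modulo {z} z∈P e) →
              modulo (*-closed b z∈P) (≈ᴹ-trans (*ₗ-cong a≈b e) (*ₗ-distribˡ b y z))
          ; *ₗ-zeroˡ     = λ x → ≈⇒≈ₚ (*ₗ-zeroˡ x)
          ; *ₗ-distribʳ  = λ x a b → ≈⇒≈ₚ (*ₗ-distribʳ x a b)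
          ; *ₗ-identityˡ = λ x → ≈⇒≈ₚ (*ₗ-identityˡ x)
          ; *ₗ-assoc     = λ a b x → ≈⇒≈ₚ (*ₗ-assoc a b x)
          ; *ₗ-zeroʳ     = λ a → ≈⇒≈ₚ (*ₗ-zeroʳ a)
          ; *ₗ-distribˡ  = λ a x y → ≈⇒≈ₚ (*ₗ-distribˡ a x y) } } })

  -- Q / P for submodules P ⊆ Q of M.
  module _ (M : LeftModule R a ℓ) {P : Pred ⟨ M ⟩ ℓ₁} {Q : Pred ⟨ M ⟩ ℓ₂}
    (P≤M : IsSubmodule M P) (Q≤M : IsSubmodule M Q) where

    open Submodule M Q≤M

    private
      P∩Q≤Q : IsSubmodule submodule (λ x → P (proj₁ x))
      P∩Q≤Q = record
        { resp-≈ = λ (restrict e) → P.resp-≈ e ; 0-closed = P.0-closed ; +-closed = λ p q → P.+-closed p q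
        ; *-closed = λ a p → P.*-closed a p }
        where module P = IsSubmodule P≤M

    module Subquotient = Quotient submodule P∩Q≤Q renaming (quotient to subquotient)

  -- The direct sum of the modules M i over a setoid (I , _∼_) along whose equality the family is
  -- transported by t, presented as formal sums of elements of the M i.
  module DirectSum {I : Set} (_∼_ : I → I → Set) (M : I → LeftModule R a ℓ)
    (t : ∀ {i j} → i ∼ j → ⟨ M i ⟩ → ⟨ M j ⟩) (t-linear : ∀ {i j} (p : i ∼ j) → IsLinear (M i) (M j) (t p)) where

    private
      module M i = LeftModule (M i)
      module R = Ring R

    FormalSum : Set a
    FormalSum = List (Σ[ i ∈ I ] ⟨ M i ⟩)

    infix 4 _≋_

    data _≋_ : FormalSum → FormalSum → Set (a ⊔ ℓ) where
      refl      : ∀ {xs} → xs ≋ xs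
      sym       : ∀ {xs ys} → xs ≋ ys → ys ≋ xs
      trans     : ∀ {xs ys zs} → xs ≋ ys → ys ≋ zs → xs ≋ zs
      ++-cong   : ∀ {xs ys us vs} → xs ≋ ys → us ≋ vs → xs ++ us ≋ ys ++ vs
      ++-comm   : ∀ xs ys → xs ++ ys ≋ ys ++ xs
      cong      : ∀ {i x y} → M._≈ᴹ_ i x y → (i , x) ∷ [] ≋ (i , y) ∷ []
      transport : ∀ {i j} (p : i ∼ j) x → (i , x) ∷ [] ≋ (j , t p x) ∷ []
      add       : ∀ i x y → (i , M._+ᴹ_ i x y) ∷ [] ≋ (i , x) ∷ (i , y) ∷ []
      zero      : ∀ i → (i , M.0ᴹ i) ∷ [] ≋ []

    infixr 7 _⊛_

    onTerms : (∀ i → ⟨ M i ⟩ → ⟨ M i ⟩) → FormalSum → FormalSum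
    onTerms f = map (λ (i , x) → i , f i x)

    _⊛_ : R.Carrier → FormalSum → FormalSum
    b ⊛ xs = onTerms (λ i → M._*ₗ_ i b) xs

    ≡⇒≋ : ∀ {xs ys} → xs ≡ ys → xs ≋ ys
    ≡⇒≋ ≡.refl = refl

    ⊛-++ : ∀ b xs ys → b ⊛ (xs ++ ys) ≋ b ⊛ xs ++ b ⊛ ys
    ⊛-++ b xs ys = ≡⇒≋ (Listₚ.map-++ _ xs ys)

    ⊛-congʳ : ∀ b {xs ys} → xs ≋ ys → b ⊛ xs ≋ b ⊛ ys
    ⊛-congʳ b refl            = refl
    ⊛-congʳ b (sym e)         = sym (⊛-congʳ b e)
    ⊛-congʳ b (trans e f)     = trans (⊛-congʳ b e) (⊛-congʳ b f)
    ⊛-congʳ b (++-cong {xs} {ys} {us} {vs} e f) = trans (⊛-++ b xs us)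
      (trans (++-cong (⊛-congʳ b e) (⊛-congʳ b f)) (sym (⊛-++ b ys vs)))
    ⊛-congʳ b (++-comm xs ys) = trans (⊛-++ b xs ys) (trans (++-comm (b ⊛ xs) (b ⊛ ys)) (sym (⊛-++ b ys xs)))
    ⊛-congʳ b (cong {i} e)    = cong (M.*ₗ-cong i R.refl e)
    ⊛-congʳ b (transport {i} {j} p x) = trans (transport p _)
      (cong (LeftModuleMorphisms.IsLeftModuleHomomorphism.*ₗ-homo (t-linear p) b x))
    ⊛-congʳ b (add i x y)     = trans (cong (M.*ₗ-distribˡ i b x y)) (add i _ _)
    ⊛-congʳ b (zero i)        = trans (cong (M.*ₗ-zeroʳ i b)) (zero i)

    pointwise : ∀ (f g : ∀ i → ⟨ M i ⟩ → ⟨ M i ⟩) → (∀ i x → M._≈ᴹ_ i (f i x) (g i x)) →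
      ∀ xs → onTerms f xs ≋ onTerms g xs
    pointwise f g e []             = refl
    pointwise f g e ((i , x) ∷ xs) = ++-cong (cong (e i x)) (pointwise f g e xs)

    swap-middle : ∀ xs ys zs → xs ++ (ys ++ zs) ≋ ys ++ (xs ++ zs)
    swap-middle xs ys zs = trans (≡⇒≋ (≡.sym (Listₚ.++-assoc xs ys zs)))
      (trans (++-cong (++-comm xs ys) refl) (≡⇒≋ (Listₚ.++-assoc ys xs zs)))

    ⊛-distribʳ : ∀ xs b b′ → (b R.+ b′) ⊛ xs ≋ b ⊛ xs ++ b′ ⊛ xs
    ⊛-distribʳ []             b b′ = refl
    ⊛-distribʳ ((i , x) ∷ xs) b b′ = trans
      (++-cong (trans (cong (M.*ₗ-distribʳ i x b b′)) (add i _ _)) (⊛-distribʳ xs b b′))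
      (++-cong {(i , M._*ₗ_ i b x) ∷ []} refl (swap-middle ((i , M._*ₗ_ i b′ x) ∷ []) (b ⊛ xs) (b′ ⊛ xs)))

    ⊛-zeroˡ : ∀ xs → R.0# ⊛ xs ≋ []
    ⊛-zeroˡ []             = refl
    ⊛-zeroˡ ((i , x) ∷ xs) = ++-cong (trans (cong (M.*ₗ-zeroˡ i x)) (zero i)) (⊛-zeroˡ xs)

    directSum : LeftModule R a (a ⊔ ℓ)
    directSum = toLeftModule (record
      { Carrierᴹ = FormalSum ; _≈ᴹ_ = _≋_ ; _+ᴹ_ = _++_ ; _*ₗ_ = _⊛_ ; 0ᴹ = []
      ; isLeftSemimodule = record
        { +ᴹ-isCommutativeMonoid = record
          { isMonoid = record
            { isSemigroup = record
              { isMagma = record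
                { isEquivalence = record { refl = refl ; sym = sym ; trans = trans } ; ∙-cong = ++-cong }
              ; assoc = λ xs ys zs → ≡⇒≋ (Listₚ.++-assoc xs ys zs) }
            ; identity = (λ xs → refl) , (λ xs → ≡⇒≋ (Listₚ.++-identityʳ xs)) }
          ; comm = ++-comm }
        ; isPreleftSemimodule = record
          { *ₗ-cong      = λ {b} {b′} {xs} b≈b′ e → trans
              (pointwise (λ i → M._*ₗ_ i b) (λ i → M._*ₗ_ i b′) (λ i x → M.*ₗ-cong i b≈b′ (M.≈ᴹ-refl i)) xs) (⊛-congʳ b′ e)
          ; *ₗ-zeroˡ     = ⊛-zeroˡ
          ; *ₗ-distribʳ  = ⊛-distribʳ
          ; *ₗ-identityˡ = λ xs → trans (pointwise (λ i → M._*ₗ_ i R.1#) (λ i x → x) (λ i → M.*ₗ-identityˡ i) xs)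
              (≡⇒≋ (Listₚ.map-id xs))
          ; *ₗ-assoc     = λ b b′ xs → trans
              (pointwise (λ i → M._*ₗ_ i (b R.* b′)) (λ i x → M._*ₗ_ i b (M._*ₗ_ i b′ x)) (λ i → M.*ₗ-assoc i b b′) xs)
              (≡⇒≋ {ys = b ⊛ b′ ⊛ xs} (Listₚ.map-∘ xs))
          ; *ₗ-zeroʳ     = λ b → refl
          ; *ₗ-distribˡ  = ⊛-++ } } })

module _ (R : CommutativeRing r ℓr) (S : CommutativeRing s ℓs)
  {f : CommutativeRing.Carrier R → CommutativeRing.Carrier S}
  (f-hom : RingMorphisms.IsRingHomomorphism (CommutativeRing.rawRing R) (CommutativeRing.rawRing S) f) where

  open CommutativeRing S
  open RingMorphisms.IsRingHomomorphism f-hom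

  asModule : LeftModule (CommutativeRing.ring R) s ℓs
  asModule = record
    { Carrierᴹ = Carrier ; _≈ᴹ_ = _≈_ ; _+ᴹ_ = _+_ ; _*ₗ_ = λ b x → f b * x ; 0ᴹ = 0# ; -ᴹ_ = -_
    ; isLeftModule = record
      { isLeftSemimodule = record
        { +ᴹ-isCommutativeMonoid = +-isCommutativeMonoid
        ; isPreleftSemimodule = record
          { *ₗ-cong      = λ a≈b x≈y → *-cong (⟦⟧-cong a≈b) x≈y
          ; *ₗ-zeroˡ     = λ x → trans (*-congʳ 0#-homo) (zeroˡ x)
          ; *ₗ-distribʳ  = λ x a b → trans (*-congʳ (+-homo a b)) (distribʳ x (f a) (f b))
          ; *ₗ-identityˡ = λ x → trans (*-congʳ 1#-homo) (*-identityˡ x)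
          ; *ₗ-assoc     = λ a b x → trans (*-congʳ (*-homo a b)) (*-assoc (f a) (f b) x)
          ; *ₗ-zeroʳ     = λ a → zeroʳ (f a)
          ; *ₗ-distribˡ  = λ a x y → distribˡ (f a) x y } }
      ; -ᴹ‿cong = -‿cong
      ; -ᴹ‿inverse = -‿inverse } }

-- An R/t-module killed by s is an R/s-module.
module _ (R : CommutativeRing r ℓr) (s t : CommutativeRing.Carrier R)
  (M : LeftModule (CommutativeRing.ring (R ⧸ t)) a ℓ)
  (killed : ∀ x → LeftModule._≈ᴹ_ M (LeftModule._*ₗ_ M s x) (LeftModule.0ᴹ M)) where

  private
    module R = CommutativeRing R
  open QuotientRing R s using () renaming (_≡ₛ_ to _≡s_; congruent to congruent-s)
  open QuotientRing R t using (≈⇒≡ₛ)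
  open Divisibility R.semiring using (_,_)
  open LeftModule M
  open SetoidReasoning ≈ᴹ-setoid

  private
    *ₗ-congˢ : ∀ {b b′ x y} → b ≡s b′ → x ≈ᴹ y → b *ₗ x ≈ᴹ b′ *ₗ y
    *ₗ-congˢ {b} {b′} {x} {y} (congruent-s (q , e)) x≈y = begin
      b *ₗ x                                ≈⟨ *ₗ-cong (≈⇒≡ₛ (R.sym b≈)) x≈y ⟩
      ((q R.* s) R.+ b′) *ₗ y               ≈⟨ *ₗ-distribʳ y (q R.* s) b′ ⟩
      (q R.* s) *ₗ y +ᴹ b′ *ₗ y             ≈⟨ +ᴹ-congʳ (*ₗ-assoc q s y) ⟩
      q *ₗ (s *ₗ y) +ᴹ b′ *ₗ y              ≈⟨ +ᴹ-congʳ (≈ᴹ-trans (*ₗ-cong (≈⇒≡ₛ R.refl) (killed y)) (*ₗ-zeroʳ q)) ⟩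
      0ᴹ +ᴹ b′ *ₗ y                         ≈⟨ +ᴹ-identityˡ _ ⟩
      b′ *ₗ y                               ∎
      where
      b≈ : (q R.* s) R.+ b′ R.≈ b
      b≈ = R.trans (R.+-congʳ e) (R.trans (R.+-assoc b (R.- b′) b′)
             (R.trans (R.+-congˡ (R.-‿inverseˡ b′)) (R.+-identityʳ b)))

  reduction : LeftModule (CommutativeRing.ring (R ⧸ s)) a ℓ
  reduction = record
    { Carrierᴹ = Carrierᴹ ; _≈ᴹ_ = _≈ᴹ_ ; _+ᴹ_ = _+ᴹ_ ; _*ₗ_ = _*ₗ_ ; 0ᴹ = 0ᴹ ; -ᴹ_ = -ᴹ_
    ; isLeftModule = record
      { isLeftSemimodule = record
        { +ᴹ-isCommutativeMonoid = +ᴹ-isCommutativeMonoid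
        ; isPreleftSemimodule = record
          { *ₗ-cong = *ₗ-congˢ ; *ₗ-zeroˡ = *ₗ-zeroˡ ; *ₗ-distribʳ = *ₗ-distribʳ ; *ₗ-identityˡ = *ₗ-identityˡ
          ; *ₗ-assoc = *ₗ-assoc ; *ₗ-zeroʳ = *ₗ-zeroʳ ; *ₗ-distribˡ = *ₗ-distribˡ } }
      ; -ᴹ‿cong = -ᴹ‿cong
      ; -ᴹ‿inverse = -ᴹ‿inverse } }

module _ (p : ℕ) where
  open PAdicNumbers p

  record FiniteExtension c ℓ₁ ℓ₂ : Set (suc (c ⊔ ℓ₁ ⊔ ℓ₂)) where
    field
      field-K : HeytingField c ℓ₁ ℓ₂

    K : CommutativeRing c ℓ₁
    K = HeytingCommutativeRing.commutativeRing (HeytingField.heytingCommutativeRing field-K)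

    open CommutativeRing K public

    field
      embed                : CommutativeRing.Carrier ℚₚ → Carrier
      embed-isHomomorphism : RingMorphisms.IsRingHomomorphism (CommutativeRing.rawRing ℚₚ) rawRing embed
      degree               : ℕ
      finite               : HasDimension (asModule ℚₚ K embed-isHomomorphism) degree

    open MonoidSum +-monoid using (sum)
    open Exp semiring using (_^_)

    Integral : Pred Carrier ℓ₁
    Integral x = ∃[ n ] Σ[ a ∈ Vector PAdicInteger n ] x ^ n + sum (λ i → embed (ι (a i)) * x ^ Fin.toℕ i) ≈ 0#

  module _ (K : FiniteExtension c ℓ₁ ℓ₂) where
    private
      module K = FiniteExtension K

    -- The ring of integers of K, up to isomorphism.
    record RingOfIntegers r ℓr : Set (c ⊔ ℓ₁ ⊔ suc (r ⊔ ℓr)) where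
      field
        𝔬 : CommutativeRing r ℓr

      open CommutativeRing 𝔬 public

      field
        inclusion      : Carrier → K.Carrier
        isMonomorphism : RingMorphisms.IsRingMonomorphism rawRing K.rawRing inclusion
        image          : ∀ x → K.Integral x ⇔ (∃[ y ] inclusion y K.≈ x)

      Unit : Pred Carrier (r ⊔ ℓr)
      Unit = AlgDefs.Invertible _≈_ 1# _*_

      open Divisibility semiring using (_∣_)

      -- π generates the maximal ideal of 𝔬, whose elements are the non-units.  Classically
      -- unit-or-∣ says that every non-unit is a multiple of π; as stated it also makes the residue
      -- field 𝔬 ⧸ π discrete.
      record IsUniformizer (π : Carrier) : Set (r ⊔ ℓr) where
        field
          non-unit  : ¬ Unit π
          unit-or-∣ : ∀ x → Unit x ⊎ π ∣ x

module _ (p : ℕ) where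
  open HalfTree p
  open CommutativeRing (PAdicNumbers.ℤₚ p) using (_≈_)

  -- An 𝔑₀-equivariant coefficient system.  Simplices of the tree form a setoid, so g_σ is given
  -- as a family of maps 𝒱(σ) → 𝒱(τ) for all τ ≈ g σ; act 0# is the transport along σ ≈ τ.
  record CoefficientSystem (A : CommutativeRing r ℓr) ℓ : Set (r ⊔ ℓr ⊔ suc ℓ) where
    field
      𝒱          : Simplex → LeftModule (CommutativeRing.ring A) ℓ ℓ
      res        : ∀ {y τ} → y ∈ τ → ⟨ 𝒱 (edge τ) ⟩ → ⟨ 𝒱 (vertex y) ⟩
      res-linear : ∀ {y τ} (y∈τ : y ∈ τ) → IsLinear (𝒱 (edge τ)) (𝒱 (vertex y)) (res y∈τ)
      act        : ∀ g {σ τ} → g · σ ≈ˢ τ → ⟨ 𝒱 σ ⟩ → ⟨ 𝒱 τ ⟩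
      act-linear : ∀ g {σ τ} (q : g · σ ≈ˢ τ) → IsLinear (𝒱 σ) (𝒱 τ) (act g q)

    infix 4 _≈ᴹ_

    _≈ᴹ_ : ∀ {σ} → ⟨ 𝒱 σ ⟩ → ⟨ 𝒱 σ ⟩ → Set ℓ
    _≈ᴹ_ {σ} = LeftModule._≈ᴹ_ (𝒱 σ)

    field
      act-cong : ∀ {g h σ τ} → g ≈ h → (q : g · σ ≈ˢ τ) (q′ : h · σ ≈ˢ τ) → ∀ x → act g q x ≈ᴹ act h q′ x
      act-id   : ∀ {σ} (q : 0# · σ ≈ˢ σ) → ∀ x → act 0# q x ≈ᴹ x
      act-∘    : ∀ {g h σ τ υ} (q : h · σ ≈ˢ τ) (q′ : g · τ ≈ˢ υ) (q″ : (g + h) · σ ≈ˢ υ) →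
                 ∀ x → act g q′ (act h q x) ≈ᴹ act (g + h) q″ x
      act-res  : ∀ g {y y′ τ τ′} (y∈τ : y ∈ τ) (y′∈τ′ : y′ ∈ τ′)
                 (q : g · vertex y ≈ˢ vertex y′) (q′ : g · edge τ ≈ˢ edge τ′) →
                 ∀ x → act g q (res y∈τ x) ≈ᴹ res y′∈τ′ (act g q′ x)

  module _ {A : CommutativeRing r ℓr} where
    open CoefficientSystem using (𝒱; res; act)

    record Subsystem (V : CoefficientSystem A ℓ) : Set (r ⊔ suc ℓ) where
      field
        pred       : ∀ σ → Pred ⟨ 𝒱 V σ ⟩ ℓ
        submodule  : ∀ σ → IsSubmodule (𝒱 V σ) (pred σ)
        res-closed : ∀ {y τ} (y∈τ : y ∈ τ) {x} → pred (edge τ) x → pred (vertex y) (res V y∈τ x)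
        act-closed : ∀ g {σ τ} (q : g · σ ≈ˢ τ) {x} → pred σ x → pred τ (act V g q x)

    -- W / U for U ⊆ W.
    subquotient : (V : CoefficientSystem A ℓ) (U W : Subsystem V) → CoefficientSystem A ℓ
    subquotient V U W = record
      { 𝒱          = W/U
      ; res        = λ y∈τ (x , x∈W) → V.res y∈τ x , W.res-closed y∈τ x∈W
      ; res-linear = λ y∈τ → induced (V.res-linear y∈τ) (W.res-closed y∈τ) (U.res-closed y∈τ)
      ; act        = λ g q (x , x∈W) → V.act g q x , W.act-closed g q x∈W
      ; act-linear = λ g q → induced (V.act-linear g q) (W.act-closed g q) (U.act-closed g q)
      ; act-cong   = λ g≈h q q′ (x , _) → ≈⇒≈/ (V.act-cong g≈h q q′ x)
      ; act-id     = λ q (x , _) → ≈⇒≈/ (V.act-id q x)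
      ; act-∘      = λ q q′ q″ (x , _) → ≈⇒≈/ (V.act-∘ q q′ q″ x)
      ; act-res    = λ g y∈τ y′∈τ′ q q′ (x , _) → ≈⇒≈/ (V.act-res g y∈τ y′∈τ′ q q′ x)
      }
      where
      module V = CoefficientSystem V
      module U = Subsystem U
      module W = Subsystem W
      module S σ = Subquotient (V.𝒱 σ) (U.submodule σ) (W.submodule σ)

      W/U : Simplex → LeftModule (CommutativeRing.ring A) _ _
      W/U σ = S.subquotient σ

      ≈⇒≈/ : ∀ {σ} {x y : ⟨ W/U σ ⟩} → proj₁ x V.≈ᴹ proj₁ y → LeftModule._≈ᴹ_ (W/U σ) x y
      ≈⇒≈/ {σ} e = S.≈⇒≈ₚ σ (Submodule.restrict e)

      induced : ∀ {σ τ} {f : ⟨ V.𝒱 σ ⟩ → ⟨ V.𝒱 τ ⟩} → IsLinear (V.𝒱 σ) (V.𝒱 τ) f →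
        (f-W : ∀ {x} → W.pred σ x → W.pred τ (f x)) → (∀ {x} → U.pred σ x → U.pred τ (f x)) →
        IsLinear (W/U σ) (W/U τ) (λ (x , x∈W) → f x , f-W x∈W)
      induced {σ} {τ} {f} f-linear f-W f-U = linear (W/U σ) (W/U τ)
        (λ { (Quotient.modulo {z , z∈W} z∈U (Submodule.restrict e)) →
             Quotient.modulo {difference = f z , f-W z∈W} (f-U z∈U)
               (Submodule.restrict (LeftModule.≈ᴹ-trans (V.𝒱 τ) (F.⟦⟧-cong e) (F.+ᴹ-homo _ z))) })
        (λ (x , _) (y , _) → ≈⇒≈/ (F.+ᴹ-homo x y))
        (λ b (x , _) → ≈⇒≈/ (F.*ₗ-homo b x))
        where module F = LeftModuleMorphisms.IsLeftModuleHomomorphism f-linear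

    record Filtration (V : CoefficientSystem A ℓ) (n : ℕ) : Set (r ⊔ suc ℓ) where
      open CoefficientSystem V using (_≈ᴹ_)
      open Subsystem
      field
        part   : Fin (ℕ.suc n) → Subsystem V
        bottom : ∀ {σ x} → pred (part Fin.zero) σ x → x ≈ᴹ LeftModule.0ᴹ (𝒱 V σ)
        step   : ∀ j {σ x} → pred (part (inject₁ j)) σ x → pred (part (Fin.suc j)) σ x
        top    : ∀ {σ} x → pred (part (fromℕ n)) σ x

      graded : Fin n → CoefficientSystem A ℓ
      graded j = subquotient V (part (inject₁ j)) (part (Fin.suc j))

  -- H₀ of the half tree with the edge 𝔢₀ removed.
  module _ {A : CommutativeRing r ℓr} (V : CoefficientSystem A ℓ) where
    open CoefficientSystem V

    private
      module ⊕ = DirectSum _≈ᵛ_ (λ y → 𝒱 (vertex y)) (λ q → act 0# (0· q)) (λ q → act-linear 0# (0· q))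
      open ⊕ using (FormalSum; _≋_; _⊛_; ≡⇒≋; refl; sym; trans; ++-cong; ++-comm; add; cong; transport; zero)
      module Z = CommutativeRing (PAdicNumbers.ℤₚ p)
      module ≈ᴹ {σ} = Setoid (LeftModule.≈ᴹ-setoid (𝒱 σ))
      module res {y τ} (y∈τ : y ∈ τ) = LeftModuleMorphisms.IsLeftModuleHomomorphism (res-linear y∈τ)
      module act g {σ τ} (q : g · σ ≈ˢ τ) = LeftModuleMorphisms.IsLeftModuleHomomorphism (act-linear g q)

    Chain₀ : LeftModule (CommutativeRing.ring A) ℓ ℓ
    Chain₀ = ⊕.directSum

    -- Representatives of the elements of the direct sum over the edges.
    Chain₁ : Set ℓ
    Chain₁ = List (Σ[ τ ∈ InnerEdge ] ⟨ 𝒱 (edge (toEdge τ)) ⟩)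

    ∂ₑ : (τ : InnerEdge) → ⟨ 𝒱 (edge (toEdge τ)) ⟩ → ⟨ Chain₀ ⟩
    ∂ₑ τ x = map (λ (y , y∈τ) → y , res y∈τ x) (endpoints τ)

    ∂ : Chain₁ → ⟨ Chain₀ ⟩
    ∂ []            = []
    ∂ ((τ , x) ∷ c) = ∂ₑ τ x ++ ∂ c

    _•_ : 𝔑₀ → ⟨ Chain₀ ⟩ → ⟨ Chain₀ ⟩
    g • []             = []
    g • ((y , x) ∷ xs) = (g ·ᵛ y , act g (vertex ≈ᵛ-refl) x) ∷ g • xs

    ∂-++ : ∀ c d → ∂ c ++ ∂ d ≋ ∂ (c ++ d)
    ∂-++ []                     d = refl
    ∂-++ ((n ·𝔢⁺ i , x) ∷ c) d = ++-cong {∂ₑ (n ·𝔢⁺ i) x} refl (∂-++ c d)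

    _⊛₁_ : CommutativeRing.Carrier A → Chain₁ → Chain₁
    b ⊛₁ c = map (λ (τ , x) → τ , LeftModule._*ₗ_ (𝒱 (edge (toEdge τ))) b x) c

    ∂-⊛ : ∀ b c → b ⊛ ∂ c ≋ ∂ (b ⊛₁ c)
    ∂-⊛ b []                     = refl
    ∂-⊛ b ((n ·𝔢⁺ i , x) ∷ c) =
      ++-cong (cong (≈ᴹ.sym (res.*ₗ-homo (outer ≈ᵛ-refl) b x)))
        (++-cong (cong (≈ᴹ.sym (res.*ₗ-homo (inner ≈ᵛ-refl) b x))) (∂-⊛ b c))

    •-++ : ∀ g xs ys → g • (xs ++ ys) ≡ g • xs ++ g • ys
    •-++ g []       ys = ≡.refl
    •-++ g (x ∷ xs) ys = ≡.cong (_ ∷_) (•-++ g xs ys)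

    act-transport : ∀ g {y y′} (q : y ≈ᵛ y′) x →
      act 0# (0· (·ᵛ-cong g q)) (act g (vertex ≈ᵛ-refl) x) ≈ᴹ act g (vertex ≈ᵛ-refl) (act 0# (0· q) x)
    act-transport g {y} {y′} q x = ≈ᴹ.trans
      (act-∘ {0#} {g} {vertex y} {vertex (g ·ᵛ y)} {vertex (g ·ᵛ y′)} (vertex ≈ᵛ-refl) (0· (·ᵛ-cong g q)) 0+g x)
      (≈ᴹ.trans
        (act-cong {0# + g} {g + 0#} {vertex y} {vertex (g ·ᵛ y′)}
          (Z.trans (Z.+-identityˡ g) (Z.sym (Z.+-identityʳ g))) 0+g g+0 x)
        (≈ᴹ.sym (act-∘ {g} {0#} {vertex y} {vertex y′} {vertex (g ·ᵛ y′)} (0· q) (vertex ≈ᵛ-refl) g+0 x)))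
      where
      0+g : (0# + g) · vertex y ≈ˢ vertex (g ·ᵛ y′)
      0+g = ·ᵛ-congʳ {0# + g} {g} (Z.+-identityˡ g) (·ᵛ-cong g q)

      g+0 : (g + 0#) · vertex y ≈ˢ vertex (g ·ᵛ y′)
      g+0 = ·ᵛ-congʳ {g + 0#} {g} (Z.+-identityʳ g) (·ᵛ-cong g q)

    •-cong : ∀ g {xs ys} → xs ≋ ys → g • xs ≋ g • ys
    •-cong g refl = refl
    •-cong g (sym e) = sym (•-cong g e)
    •-cong g (trans e f) = trans (•-cong g e) (•-cong g f)
    •-cong g (++-cong {xs} {ys} {us} {vs} e f)
      rewrite •-++ g xs us | •-++ g ys vs = ++-cong (•-cong g e) (•-cong g f)
    •-cong g (++-comm xs ys) rewrite •-++ g xs ys | •-++ g ys xs = ++-comm (g • xs) (g • ys)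
    •-cong g (cong e) = cong (act.⟦⟧-cong g (vertex ≈ᵛ-refl) e)
    •-cong g (transport {y} {y′} q x) =
      trans (transport (·ᵛ-cong g q) (act g (vertex ≈ᵛ-refl) x)) (cong (act-transport g q x))
    •-cong g (add y x x′) = trans (cong (act.+ᴹ-homo g (vertex ≈ᵛ-refl) x x′)) (add (g ·ᵛ y) _ _)
    •-cong g (zero y) = trans (cong (act.0ᴹ-homo g (vertex ≈ᵛ-refl))) (zero (g ·ᵛ y))

    •-⊛ : ∀ g b xs → g • (b ⊛ xs) ≋ b ⊛ (g • xs)
    •-⊛ g b []             = refl
    •-⊛ g b ((y , x) ∷ xs) = ++-cong (cong (act.*ₗ-homo g (vertex ≈ᵛ-refl) b x)) (•-⊛ g b xs)

    _•₁_ : 𝔑₀ → Chain₁ → Chain₁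
    g •₁ c = map (λ (τ , x) → g ·⁺ τ , act g (·-edge g τ) x) c

    act-∂ₑ : ∀ g τ x → g • ∂ₑ τ x ≋ ∂ₑ (g ·⁺ τ) (act g (·-edge g τ) x)
    act-∂ₑ g (n ·𝔢⁺ i) x = ++-cong (cong (end (outer ≈ᵛ-refl) (outer ≈ᵛ-refl)))
                                     (cong (end (inner ≈ᵛ-refl) (inner ≈ᵛ-refl)))
      where
      end : ∀ {j} (y∈τ : n ·𝔳 j ∈ n ·𝔢 ℕ.suc i) (gy∈gτ : (g + n) ·𝔳 j ∈ (g + n) ·𝔢 ℕ.suc i) →
        act g (vertex ≈ᵛ-refl) (res y∈τ x) ≈ᴹ res gy∈gτ (act g (·-edge g (n ·𝔢⁺ i)) x)
      end {j} y∈τ gy∈gτ = act-res g {n ·𝔳 j} {(g + n) ·𝔳 j} {n ·𝔢 ℕ.suc i} {(g + n) ·𝔢 ℕ.suc i}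
        y∈τ gy∈gτ (vertex ≈ᵛ-refl) (·-edge g (n ·𝔢⁺ i)) x

    •-∂ : ∀ g c → g • ∂ c ≋ ∂ (g •₁ c)
    •-∂ g []            = refl
    •-∂ g ((τ , x) ∷ c) = trans (≡⇒≋ (•-++ g (∂ₑ τ x) (∂ c))) (++-cong (act-∂ₑ g τ x) (•-∂ g c))

    IsBoundary : Pred ⟨ Chain₀ ⟩ ℓ
    IsBoundary xs = ∃[ c ] xs ≋ ∂ c

    boundaries : IsSubmodule Chain₀ IsBoundary
    boundaries = record
      { resp-≈   = λ e (c , f) → c , trans (sym e) f
      ; 0-closed = [] , refl
      ; +-closed = λ (c , e) (d , f) → c ++ d , trans (++-cong e f) (∂-++ c d)
      ; *-closed = λ b (c , e) → b ⊛₁ c , trans (⊕.⊛-congʳ b e) (∂-⊛ b c)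
      }

    private
      module H₀ = Quotient Chain₀ boundaries

    H₀ : LeftModule (CommutativeRing.ring A) ℓ ℓ
    H₀ = H₀.quotient

    private
      module ≈ᴴ = LeftModule H₀

    •-congᴴ : ∀ g {x y} → x ≈ᴴ.≈ᴹ y → g • x ≈ᴴ.≈ᴹ g • y
    •-congᴴ g {x} {y} (Quotient.modulo {z} (c , e) f) = Quotient.modulo {difference = g • z}
      (g •₁ c , trans (•-cong g e) (•-∂ g c))
      (trans (•-cong g f) (≡⇒≋ (•-++ g y z)))

    IsInvariant : Pred ⟨ H₀ ⟩ ℓ
    IsInvariant x = ∀ g → g • x ≈ᴴ.≈ᴹ x

    invariants : IsSubmodule H₀ IsInvariant
    invariants = record
      { resp-≈   = λ x≈y p g → ≈ᴴ.≈ᴹ-trans (•-congᴴ g (≈ᴴ.≈ᴹ-sym x≈y)) (≈ᴴ.≈ᴹ-trans (p g) x≈y)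
      ; 0-closed = λ g → ≈ᴴ.≈ᴹ-refl
      ; +-closed = λ {x} {y} p q g → ≈ᴴ.≈ᴹ-trans (H₀.≈⇒≈ₚ (≡⇒≋ (•-++ g x y))) (≈ᴴ.+ᴹ-cong (p g) (q g))
      ; *-closed = λ b {x} p g → ≈ᴴ.≈ᴹ-trans (H₀.≈⇒≈ₚ (•-⊛ g b x)) (≈ᴴ.*ₗ-cong (CommutativeRing.refl A) (p g))
      }

    H₀^𝔑₀ : LeftModule (CommutativeRing.ring A) ℓ ℓ
    H₀^𝔑₀ = Submodule.submodule H₀ invariants

    toH₀ : ⟨ 𝒱 (edge (𝔢 0)) ⟩ → ⟨ H₀ ⟩
    toH₀ x = (𝔳 0 , res (outer ≈ᵛ-refl) x) ∷ []

    -- Invariance of the image is an assumption: it is automatic if V is strictly of level 1 over k,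
    -- since then 𝔑₀ fixes 𝒱(𝔢₀), but it is not inherited by extensions.  For instance 𝔑₀ can act
    -- unipotently and non-trivially on a constant system with fibre k².
    toH₀^𝔑₀ : (∀ x → IsInvariant (toH₀ x)) → ⟨ 𝒱 (edge (𝔢 0)) ⟩ → ⟨ H₀^𝔑₀ ⟩
    toH₀^𝔑₀ inv x = toH₀ x , inv x

module _ (p : ℕ) (𝔬 : CommutativeRing r ℓr) (π : CommutativeRing.Carrier 𝔬) (m : ℕ) where
  open HalfTree p
  open Exp (CommutativeRing.semiring 𝔬) using (_^_)

  module _ (V : CoefficientSystem p (𝔬 ⧸ (π ^ m)) ℓ) where
    open CoefficientSystem V

    record StrictlyOfLevel1Over-k : Set (r ⊔ ℓr ⊔ ℓ) where
      field
        killed    : ∀ {σ} x → LeftModule._*ₗ_ (𝒱 σ) π x ≈ᴹ LeftModule.0ᴹ (𝒱 σ)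
        injective : ∀ {y τ} (y∈τ : y ∈ τ) → Injective _≈ᴹ_ _≈ᴹ_ (res y∈τ)
        -- 𝒱(𝔢ᵢ₊₁) being a submodule, it suffices to take sums of translates.
        generated : ∀ i (y : ⟨ 𝒱 (vertex (𝔳 i)) ⟩) →
          ∃[ n ] Σ[ z ∈ Vector 𝔑₀ n ] Σ[ x ∈ Vector ⟨ 𝒱 (edge (𝔢 (ℕ.suc i))) ⟩ n ]
            y ≈ᴹ MonoidSum.sum (LeftModule.+ᴹ-monoid (𝒱 (vertex (𝔳 i))))
              (λ j → act (pow i (z j)) (pow-fixes-𝔳 i (z j)) (res (inner ≈ᵛ-refl) (x j)))
        fixed     : ∀ i (y : ⟨ 𝒱 (vertex (𝔳 i)) ⟩) →
          (∃[ x ] res {τ = 𝔢 i} (outer ≈ᵛ-refl) x ≈ᴹ y) ⇔ (∀ z → act (pow i z) (pow-fixes-𝔳 i z) y ≈ᴹ y)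
        dimension : ∃[ d ] ∀ i → HasDimension (reduction 𝔬 π (π ^ m) (𝒱 (edge (𝔢 i))) killed) d

  StrictlyOfLevel1 : CoefficientSystem p (𝔬 ⧸ (π ^ m)) ℓ → Set (r ⊔ ℓr ⊔ suc ℓ)
  StrictlyOfLevel1 V = ∃[ n ] Σ[ F ∈ Filtration p V n ] ∀ j → StrictlyOfLevel1Over-k (Filtration.graded F j)

module Submission where

-- By dévissage along the filtration, working with the components of chains at all vertices and edges,
-- everything reduces to one graded piece.  Transition maps being injective, a chain with zero boundary
-- at all levels ≥ j vanishes at these levels; this gives injectivity.
--
-- For surjectivity over k let t = g - 1 for a generator g of 𝔑₀^(pⁱ), which is nilpotent on 𝒱(𝔳ᵢ) because
-- p = 0 in k.  The space 𝒱(𝔢ᵢ₊₁) generates 𝒱(𝔳ᵢ) over k[t] and has the dimension of 𝒱(𝔢ᵢ) = ker t, so it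
-- meets t 𝒱(𝔳ᵢ) trivially.  If h is invariant and h - 1•h = ∂d, summing over the vertices of level i
-- gives out(Bᵢ) + inn(Bᵢ₊₁) ∈ t 𝒱(𝔳ᵢ) for the total Bᵢ of d over the edges of level i.  As there are no
-- edges of level 0, all Bᵢ vanish by induction.  At the top level of h this says that its components are
-- fixed, hence lie in the 𝒱(n 𝔢ᵢ), so h is homologous to a chain of lower level, and finally to an
-- element of 𝒱(𝔢₀).

open import Defs
open import Algebra.Apartness.Bundles using (HeytingField)
open import Algebra.Bundles using (CommutativeRing; CommutativeMonoid; Monoid; Ring)
open import Algebra.Module.Bundles using (LeftModule)
open import Algebra.Module.Morphism.Structures using (module LeftModuleMorphisms)
open import Algebra.Morphism.Construct.Composition using (isRingHomomorphism)
open import Algebra.Morphism.Structures using (module RingMorphisms)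
import Algebra.Properties.AbelianGroup as AbelianGroupProperties
import Algebra.Properties.CommutativeMonoid.Sum as CommutativeMonoidSum
import Algebra.Properties.CommutativeSemigroup as CommutativeSemigroupProperties
import Algebra.Properties.Monoid.Mult as MonoidMult
import Algebra.Properties.Monoid.Sum as MonoidSum
import Algebra.Properties.Ring as RingProperties
import Algebra.Properties.Semiring.Divisibility as Divisibility
import Algebra.Properties.Semiring.Exp as Exp
import Algebra.Solver.CommutativeMonoid as CommutativeMonoidSolver
import Algebra.Solver.Ring.NaturalCoefficients.Default as RingSolver
open import Data.Empty using (⊥; ⊥-elim)
open import Data.Fin.Base as Fin using (Fin; punchIn; punchOut)
open import Data.Fin.Induction using (<-weakInduction; >-weakInduction)
import Data.Fin.Properties as Finₚ
import Data.Integer.Base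
open import Data.Integer.Base as ℤ using (ℤ; +_)
import Data.Integer.DivMod as ℤ-divmod
import Data.Integer.Divisibility.Signed as ℤ-divisibility
import Data.Integer.Properties as ℤ-properties
import Data.Integer.Tactic.RingSolver as ℤ-solver
open import Data.List.Base using ([]; _∷_; _++_; length)
open import Data.Nat.Base as ℕ using (ℕ; zero; suc; _≤_)
import Data.Nat.Properties as ℕₚ
open import Data.Nat.Combinatorics using (_C_; nCn≡1; nCk+nC[k+1]≡[n+1]C[k+1]; k>n⇒nCk≡0)
open import Data.Nat.Divisibility using (divides; ∣⇒≤; m∣m*n) renaming (_∣_ to _∣ₙ_)
open import Data.Nat.Primality using (Prime; euclidsLemma; ¬prime[0]; prime⇒nonZero)
open import Data.Product.Base using (Σ-syntax; ∃-syntax; _×_; _,_; proj₁; proj₂)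
open import Data.Sum.Base using (_⊎_; inj₁; inj₂)
open import Data.Vec.Base using (Vec; []; _∷_; tabulate)
open import Data.Vec.Functional using (Vector; insertAt)
import Data.Vec.Functional.Properties as Vectorₚ
open import Function.Bundles using (mk⇔; Equivalence)
open import Level using (Level; _⊔_)
import Relation.Binary.Reasoning.Setoid as SetoidReasoning
open import Relation.Binary.Definitions using (tri<; tri≈; tri>)
open import Relation.Binary.PropositionalEquality as ≡ using (_≡_)
open import Relation.Nullary using (¬_; Dec; yes; no)
open import Relation.Unary using (Pred)

-- Taking invariants is not exact, and 𝔑₀ is only known to fix 𝒱(𝔢₀) in the graded pieces, so no
-- long exact sequences are used. Chains, homology and invariance always refer to the whole system
-- `V`; what varies is the part of the filtration in which the components lie. A graded piece enters
-- through components modulo the next smaller part, and there only invariance under the single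
-- element `1#` is used. Nilpotency of t needs more than p = 0: by condition (b) 𝔑₀^(pⁱ⁺¹) is
-- trivial on 𝒱(𝔢ᵢ₊₁), and as 𝔑₀ is commutative also on 𝒱(𝔳ᵢ), which 𝒱(𝔢ᵢ₊₁) generates. So gᵖ = 1
-- and tᵖ = gᵖ - 1 = 0. The count behind the trivial intersection is that n generators over k[t]
-- leave room for at most n independent vectors in ker t. It is proved by elimination, since a
-- dimension is given only for the 𝒱(𝔢ᵢ). That p vanishes in k is itself to be shown: otherwise 1/p
-- would be integral over ℤₚ.

private
  variable
    a c ℓ ℓ₁ ℓ₂ r ℓr : Level

-- Linear maps, submodules and finite sums.

module LinearMap {R : Ring r ℓr} {M : LeftModule R a ℓ} {N : LeftModule R c ℓ₁} {f : ⟨ M ⟩ → ⟨ N ⟩}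
  (f-linear : IsLinear M N f) where

  open LeftModuleMorphisms.IsLeftModuleHomomorphism f-linear public

  private
    module M = LeftModule M
    module N = LeftModule N

  sum-homo : ∀ {n} (v : Vector ⟨ M ⟩ n) →
    f (MonoidSum.sum M.+ᴹ-monoid v) N.≈ᴹ MonoidSum.sum N.+ᴹ-monoid (λ i → f (v i))
  sum-homo {zero}  v = 0ᴹ-homo
  sum-homo {suc n} v = N.≈ᴹ-trans (+ᴹ-homo (v Fin.zero) _) (N.+ᴹ-congˡ (sum-homo (λ i → v (Fin.suc i))))

submodule-sum : {R : Ring r ℓr} (M : LeftModule R a ℓ) {P : Pred ⟨ M ⟩ ℓ₁} → IsSubmodule M P →
  ∀ {n} (v : Vector ⟨ M ⟩ n) → (∀ i → P (v i)) → P (MonoidSum.sum (LeftModule.+ᴹ-monoid M) v)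
submodule-sum M P≤M {zero}  v v∈P = IsSubmodule.0-closed P≤M
submodule-sum M P≤M {suc n} v v∈P =
  IsSubmodule.+-closed P≤M (v∈P Fin.zero) (submodule-sum M P≤M (λ i → v (Fin.suc i)) (λ i → v∈P (Fin.suc i)))

corestriction-isomorphism : {R : Ring r ℓr} (M : LeftModule R a ℓ) (N : LeftModule R c ℓ₁) {P : Pred ⟨ N ⟩ ℓ₂} (P≤N : IsSubmodule N P)
  {f : ⟨ M ⟩ → ⟨ N ⟩} → IsLinear M N f → (f∈P : ∀ x → P (f x)) →
  (∀ {x y} → LeftModule._≈ᴹ_ N (f x) (f y) → LeftModule._≈ᴹ_ M x y) →
  (∀ y → P y → ∃[ x ] LeftModule._≈ᴹ_ N y (f x)) →
  IsLinearIsomorphism M (Submodule.submodule N P≤N) (λ x → f x , f∈P x)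
corestriction-isomorphism M N P≤N f-linear f∈P injective surjective = record
  { isLeftModuleMonomorphism = record
    { isLeftModuleHomomorphism = linear M (Submodule.submodule N P≤N)
        (λ e → Submodule.restrict (f.⟦⟧-cong e))
        (λ x y → Submodule.restrict (f.+ᴹ-homo x y))
        (λ b x → Submodule.restrict (f.*ₗ-homo b x))
    ; injective = λ { (Submodule.restrict e) → injective e } }
  ; surjective = λ (y , y∈P) → let x , e = surjective y y∈P in
      x , λ z≈x → Submodule.restrict (N.≈ᴹ-trans (f.⟦⟧-cong z≈x) (N.≈ᴹ-sym e))
  }
  where
  module N = LeftModule N
  module f = LinearMap {M = M} {N = N} f-linear

module ModuleProperties {R : CommutativeRing r ℓr} (M : LeftModule (CommutativeRing.ring R) a ℓ) where
  open CommutativeRing R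
  open LeftModule M
  open SetoidReasoning ≈ᴹ-setoid
  open CommutativeMonoidSum +ᴹ-commutativeMonoid public using (sum; sum-cong-≋; sum-remove; sum-replicate-zero; ∑-distrib-+; ∑-comm)

  -- Indexing by ℕ keeps index arithmetic such as `n + k * N` outside `Fin`. Vertices and edges of
  -- level j will be numbered by n < pʲ.
  ∑< : ℕ → (ℕ → ⟨ M ⟩) → ⟨ M ⟩
  ∑< n f = sum {n} (λ i → f (Fin.toℕ i))

  ∑<-last : ∀ n f → ∑< (suc n) f ≈ᴹ ∑< n f +ᴹ f n
  ∑<-last zero    f = ≈ᴹ-trans (+ᴹ-identityʳ _) (≈ᴹ-sym (+ᴹ-identityˡ _))
  ∑<-last (suc n) f = ≈ᴹ-trans (+ᴹ-congˡ (∑<-last n (λ k → f (suc k)))) (≈ᴹ-sym (+ᴹ-assoc _ _ _))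

  ∑<-cong : ∀ n {f g} → (∀ k → f k ≈ᴹ g k) → ∑< n f ≈ᴹ ∑< n g
  ∑<-cong n e = sum-cong-≋ {n} (λ i → e (Fin.toℕ i))

  ∑<-zero : ∀ n {f} → (∀ k → f k ≈ᴹ 0ᴹ) → ∑< n f ≈ᴹ 0ᴹ
  ∑<-zero n e = ≈ᴹ-trans (∑<-cong n e) (sum-replicate-zero n)

  ∑<-+ : ∀ m n f → ∑< (m ℕ.+ n) f ≈ᴹ ∑< m f +ᴹ ∑< n (λ k → f (m ℕ.+ k))
  ∑<-+ zero    n f = ≈ᴹ-sym (+ᴹ-identityˡ _)
  ∑<-+ (suc m) n f = ≈ᴹ-trans (+ᴹ-congˡ (∑<-+ m n (λ k → f (suc k)))) (≈ᴹ-sym (+ᴹ-assoc _ _ _))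

  -- For N = pʲ and q = p this groups the edges of level j + 1 by their index modulo pʲ, that is, by
  -- their inner vertex.
  ∑<-blocks : ∀ q N f → ∑< (q ℕ.* N) f ≈ᴹ ∑< q (λ k → ∑< N (λ n → f (n ℕ.+ k ℕ.* N)))
  ∑<-blocks zero    N f = ≈ᴹ-refl
  ∑<-blocks (suc q) N f = ≈ᴹ-trans (∑<-+ N (q ℕ.* N) f) (+ᴹ-cong
    (∑<-cong N (λ n → ≈ᴹ-reflexive (≡.cong f (≡.sym (ℕₚ.+-identityʳ n)))))
    (≈ᴹ-trans (∑<-blocks q N (λ m → f (N ℕ.+ m)))
      (∑<-cong q (λ k → ∑<-cong N (λ n → ≈ᴹ-reflexive (≡.cong f (swap N n (k ℕ.* N))))))))
    where
    swap : ∀ x y z → x ℕ.+ (y ℕ.+ z) ≡ y ℕ.+ (x ℕ.+ z)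
    swap x y z = ≡.trans (≡.sym (ℕₚ.+-assoc x y z)) (≡.trans (≡.cong (ℕ._+ z) (ℕₚ.+-comm x y)) (ℕₚ.+-assoc y x z))

  ∑<-single : ∀ n k f → k ℕ.< n → (∀ l → l ℕ.< n → ¬ l ≡ k → f l ≈ᴹ 0ᴹ) → ∑< n f ≈ᴹ f k
  ∑<-single (suc n) zero    f _          e = ≈ᴹ-trans (+ᴹ-congˡ (≈ᴹ-trans
    (sum-cong-≋ {n} (λ i → e (suc (Fin.toℕ i)) (ℕ.s≤s (Finₚ.toℕ<n i)) (λ ()))) (sum-replicate-zero n))) (+ᴹ-identityʳ _)
  ∑<-single (suc n) (suc k) f (ℕ.s≤s k<) e = ≈ᴹ-trans (+ᴹ-congʳ (e 0 (ℕ.s≤s ℕ.z≤n) (λ ()))) (≈ᴹ-trans (+ᴹ-identityˡ _)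
    (∑<-single n k (λ l → f (suc l)) k< (λ l l< l≢k → e (suc l) (ℕ.s≤s l<) (λ eq → l≢k (ℕₚ.suc-injective eq)))))

  ∑<-comm : ∀ m n (f : ℕ → ℕ → ⟨ M ⟩) → ∑< m (λ i → ∑< n (f i)) ≈ᴹ ∑< n (λ j → ∑< m (λ i → f i j))
  ∑<-comm m n f = ∑-comm {m} {n} (λ i j → f (Fin.toℕ i) (Fin.toℕ j))

  telescope : ∀ N (a d : ℕ → ⟨ M ⟩) → (∀ n → a n ≈ᴹ a (suc n) +ᴹ d n) → a 0 ≈ᴹ a N +ᴹ ∑< N d
  telescope zero    a d e = ≈ᴹ-sym (+ᴹ-identityʳ (a 0))
  telescope (suc N) a d e = ≈ᴹ-trans (telescope N a d e) (≈ᴹ-trans (+ᴹ-congʳ (e N))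
    (≈ᴹ-trans (+ᴹ-assoc _ _ _) (+ᴹ-congˡ (≈ᴹ-trans (+ᴹ-comm _ _) (≈ᴹ-sym (∑<-last N d))))))

  +-interchange : ∀ x y u v → (x +ᴹ y) +ᴹ (u +ᴹ v) ≈ᴹ (x +ᴹ u) +ᴹ (y +ᴹ v)
  +-interchange = CommutativeSemigroupProperties.interchange
    (CommutativeMonoid.commutativeSemigroup +ᴹ-commutativeMonoid)

  *-swap : ∀ b b′ x → b *ₗ b′ *ₗ x ≈ᴹ b′ *ₗ b *ₗ x
  *-swap b b′ x = begin
    b *ₗ b′ *ₗ x   ≈⟨ *ₗ-assoc b b′ x ⟨
    (b * b′) *ₗ x  ≈⟨ *ₗ-cong (*-comm b b′) ≈ᴹ-refl ⟩
    (b′ * b) *ₗ x  ≈⟨ *ₗ-assoc b′ b x ⟩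
    b′ *ₗ b *ₗ x   ∎

  *-annihilates : ∀ {b} x → b ≈ 0# → b *ₗ x ≈ᴹ 0ᴹ
  *-annihilates x b≈0 = ≈ᴹ-trans (*ₗ-cong b≈0 ≈ᴹ-refl) (*ₗ-zeroˡ x)

  -- Subtraction is written as multiplication by -1, because `IsSubmodule` provides closure under
  -- scalars and linear maps commute with them.
  -1* : ∀ x → x +ᴹ (- 1#) *ₗ x ≈ᴹ 0ᴹ
  -1* x = begin
    x +ᴹ (- 1#) *ₗ x         ≈⟨ +ᴹ-congʳ (*ₗ-identityˡ x) ⟨
    1# *ₗ x +ᴹ (- 1#) *ₗ x   ≈⟨ *ₗ-distribʳ x 1# (- 1#) ⟨
    (1# - 1#) *ₗ x           ≈⟨ *-annihilates x (-‿inverseʳ 1#) ⟩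
    0ᴹ                       ∎

  subtract : ∀ {x y z} → x ≈ᴹ y +ᴹ z → y ≈ᴹ x +ᴹ (- 1#) *ₗ z
  subtract {x} {y} {z} e = begin
    y                          ≈⟨ +ᴹ-identityʳ y ⟨
    y +ᴹ 0ᴹ                    ≈⟨ +ᴹ-congˡ (-1* z) ⟨
    y +ᴹ (z +ᴹ (- 1#) *ₗ z)    ≈⟨ +ᴹ-assoc y z _ ⟨
    (y +ᴹ z) +ᴹ (- 1#) *ₗ z    ≈⟨ +ᴹ-congʳ e ⟨
    x +ᴹ (- 1#) *ₗ z           ∎

  +ᴹ-cancelˡ : ∀ x {y z} → x +ᴹ y ≈ᴹ x +ᴹ z → y ≈ᴹ z
  +ᴹ-cancelˡ x {y} {z} e = begin
    y                                  ≈⟨ shift y ⟩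
    (x +ᴹ y) +ᴹ (- 1#) *ₗ x            ≈⟨ +ᴹ-congʳ e ⟩
    (x +ᴹ z) +ᴹ (- 1#) *ₗ x            ≈⟨ shift z ⟨
    z                                  ∎
    where
    shift : ∀ y → y ≈ᴹ (x +ᴹ y) +ᴹ (- 1#) *ₗ x
    shift y = subtract (+ᴹ-comm x y)

  subtract-≈ : ∀ x y → x ≈ᴹ y +ᴹ (x +ᴹ (- 1#) *ₗ y)
  subtract-≈ x y = begin
    x                              ≈⟨ +ᴹ-identityʳ x ⟨
    x +ᴹ 0ᴹ                        ≈⟨ +ᴹ-congˡ (-1* y) ⟨
    x +ᴹ (y +ᴹ (- 1#) *ₗ y)        ≈⟨ +ᴹ-assoc x y _ ⟨
    (x +ᴹ y) +ᴹ (- 1#) *ₗ y        ≈⟨ +ᴹ-congʳ (+ᴹ-comm x y) ⟩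
    (y +ᴹ x) +ᴹ (- 1#) *ₗ y        ≈⟨ +ᴹ-assoc y x _ ⟩
    y +ᴹ (x +ᴹ (- 1#) *ₗ y)        ∎

  solve-for : ∀ {b b′ x y} → b′ * b ≈ 1# → y +ᴹ b *ₗ x ≈ᴹ 0ᴹ → x ≈ᴹ (b′ * - 1#) *ₗ y
  solve-for {b} {b′} {x} {y} b′b≈1 e = begin
    x                          ≈⟨ *ₗ-identityˡ x ⟨
    1# *ₗ x                    ≈⟨ *ₗ-cong b′b≈1 ≈ᴹ-refl ⟨
    (b′ * b) *ₗ x              ≈⟨ *ₗ-assoc b′ b x ⟩
    b′ *ₗ b *ₗ x               ≈⟨ *ₗ-cong refl (subtract (≈ᴹ-trans (≈ᴹ-sym e) (+ᴹ-comm y _))) ⟩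
    b′ *ₗ (0ᴹ +ᴹ (- 1#) *ₗ y)  ≈⟨ *ₗ-cong refl (+ᴹ-identityˡ _) ⟩
    b′ *ₗ (- 1#) *ₗ y          ≈⟨ *ₗ-assoc b′ (- 1#) y ⟨
    (b′ * - 1#) *ₗ y           ∎

-- A field in the form that elimination needs: a coefficient either vanishes or can serve as a
-- pivot. That 1 differs from 0 is assumed separately.
Discrete : CommutativeRing r ℓr → Set (r ⊔ ℓr)
Discrete K = ∀ b → (∃[ b′ ] b′ * b ≈ 1#) ⊎ b ≈ 0#
  where open CommutativeRing K

find-unit : (K : CommutativeRing r ℓr) → Discrete K → ∀ {n} (b : Vector (CommutativeRing.Carrier K) n) →
  let open CommutativeRing K in (∃[ i ] ∃[ b′ ] b′ * b i ≈ 1#) ⊎ (∀ i → b i ≈ 0#)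
find-unit K discrete {zero}  b = inj₂ (λ ())
find-unit K discrete {suc n} b with discrete (b Fin.zero)
... | inj₁ unit = inj₁ (Fin.zero , unit)
... | inj₂ b₀≈0 with find-unit K discrete (λ i → b (Fin.suc i))
...   | inj₁ (i , unit) = inj₁ (Fin.suc i , unit)
...   | inj₂ bᵢ≈0       = inj₂ (λ { Fin.zero → b₀≈0 ; (Fin.suc i) → bᵢ≈0 i })

-- Modules over K[t] on which t is nilpotent.

module NilpotentOperator {K : CommutativeRing r ℓr} (M : LeftModule (CommutativeRing.ring K) a ℓ)
  {t : ⟨ M ⟩ → ⟨ M ⟩} (t-linear : IsLinear M M t) where

  open CommutativeRing K
  open LeftModule M
  open ModuleProperties {R = K} M
  open SetoidReasoning ≈ᴹ-setoid
  open CommutativeMonoidSolver +ᴹ-commutativeMonoid using (solve; _⊕_; _⊜_)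
  private module t = LinearMap {M = M} {N = M} t-linear

  t^ : ℕ → ⟨ M ⟩ → ⟨ M ⟩
  t^ zero    x = x
  t^ (suc n) x = t (t^ n x)

  t^-linear : ∀ n → IsLinear M M (t^ n)
  t^-linear zero    = linear M M (λ e → e) (λ x y → ≈ᴹ-refl) (λ b x → ≈ᴹ-refl)
  t^-linear (suc n) = linear M M (λ e → t.⟦⟧-cong (tⁿ.⟦⟧-cong e))
    (λ x y → ≈ᴹ-trans (t.⟦⟧-cong (tⁿ.+ᴹ-homo x y)) (t.+ᴹ-homo _ _))
    (λ b x → ≈ᴹ-trans (t.⟦⟧-cong (tⁿ.*ₗ-homo b x)) (t.*ₗ-homo b _))
    where module tⁿ = LinearMap {M = M} {N = M} (t^-linear n)

  module t^ n = LinearMap {M = M} {N = M} (t^-linear n)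

  t^-t : ∀ n x → t^ n (t x) ≈ᴹ t (t^ n x)
  t^-t zero    x = ≈ᴹ-refl
  t^-t (suc n) x = t.⟦⟧-cong (t^-t n x)

  -- These are the K[t]-submodules.
  record IsStable (P : Pred ⟨ M ⟩ ℓ₁) : Set (r ⊔ a ⊔ ℓ ⊔ ℓ₁) where
    field
      isSubmodule : IsSubmodule M P
      t-closed    : ∀ {x} → P x → P (t x)
    open IsSubmodule isSubmodule public

    t^-closed : ∀ n {x} → P x → P (t^ n x)
    t^-closed zero    x∈P = x∈P
    t^-closed (suc n) x∈P = t-closed (t^-closed n x∈P)

  -- The cyclic K[t]-module generated by w, with Horner's scheme as representation of polynomials.
  data Cyclic (w x : ⟨ M ⟩) : Set (r ⊔ a ⊔ ℓ) where
    null : x ≈ᴹ 0ᴹ → Cyclic w x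
    cons : ∀ b {z} → Cyclic w z → x ≈ᴹ b *ₗ w +ᴹ t z → Cyclic w x

  cyclic-generator : ∀ {w} → Cyclic w w
  cyclic-generator {w} = cons 1# (null ≈ᴹ-refl)
    (≈ᴹ-sym (≈ᴹ-trans (+ᴹ-cong (*ₗ-identityˡ w) t.0ᴹ-homo) (+ᴹ-identityʳ w)))

  -- Zero is read as 0 w + t 0, so that every element has a lowest coefficient to test.
  uncons : ∀ {w x} → Cyclic w x → ∃[ b ] ∃[ z ] Cyclic w z × x ≈ᴹ b *ₗ w +ᴹ t z
  uncons {w} (null x≈0) = 0# , 0ᴹ , null ≈ᴹ-refl ,
    ≈ᴹ-trans x≈0 (≈ᴹ-sym (≈ᴹ-trans (+ᴹ-cong (*ₗ-zeroˡ w) t.0ᴹ-homo) (+ᴹ-identityʳ 0ᴹ)))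
  uncons (cons b {z} z∈ e) = b , z , z∈ , e

  cyclic-resp : ∀ {w x y} → x ≈ᴹ y → Cyclic w x → Cyclic w y
  cyclic-resp x≈y (null e)      = null (≈ᴹ-trans (≈ᴹ-sym x≈y) e)
  cyclic-resp x≈y (cons b z∈ e) = cons b z∈ (≈ᴹ-trans (≈ᴹ-sym x≈y) e)

  cyclic-+ : ∀ {w x y} → Cyclic w x → Cyclic w y → Cyclic w (x +ᴹ y)
  cyclic-+ (null e) y∈ = cyclic-resp (≈ᴹ-sym (≈ᴹ-trans (+ᴹ-congʳ e) (+ᴹ-identityˡ _))) y∈
  cyclic-+ x∈@(cons _ _ _) (null e) = cyclic-resp (≈ᴹ-sym (≈ᴹ-trans (+ᴹ-congˡ e) (+ᴹ-identityʳ _))) x∈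
  cyclic-+ {w} (cons b {z} z∈ e) (cons b′ {z′} z′∈ e′) = cons (b + b′) (cyclic-+ z∈ z′∈) (≈ᴹ-trans (+ᴹ-cong e e′)
    (≈ᴹ-trans (+-interchange _ _ _ _)
      (+ᴹ-cong (≈ᴹ-sym (*ₗ-distribʳ w b b′)) (≈ᴹ-sym (t.+ᴹ-homo z z′)))))

  cyclic-* : ∀ {w x} b → Cyclic w x → Cyclic w (b *ₗ x)
  cyclic-* b (null e) = null (≈ᴹ-trans (*ₗ-cong refl e) (*ₗ-zeroʳ b))
  cyclic-* {w} b (cons b′ {z} z∈ e) = cons (b * b′) (cyclic-* b z∈) (≈ᴹ-trans (*ₗ-cong refl e)
    (≈ᴹ-trans (*ₗ-distribˡ b _ _) (+ᴹ-cong (≈ᴹ-sym (*ₗ-assoc b b′ w)) (≈ᴹ-sym (t.*ₗ-homo b z)))))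

  cyclic-t : ∀ {w x} → Cyclic w x → Cyclic w (t x)
  cyclic-t {w} x∈ = cons 0# x∈ (≈ᴹ-sym (≈ᴹ-trans (+ᴹ-congʳ (*ₗ-zeroˡ w)) (+ᴹ-identityˡ _)))

  cyclic-t^ : ∀ n {w x} → Cyclic w x → Cyclic (t^ n w) (t^ n x)
  cyclic-t^ n (null e) = null (≈ᴹ-trans (t^.⟦⟧-cong n e) (t^.0ᴹ-homo n))
  cyclic-t^ n {w} (cons b {z} z∈ e) = cons b (cyclic-t^ n z∈) (≈ᴹ-trans (t^.⟦⟧-cong n e)
    (≈ᴹ-trans (t^.+ᴹ-homo n _ _) (+ᴹ-cong (t^.*ₗ-homo n b w) (t^-t n z))))

  cyclic⊆ : ∀ {P : Pred ⟨ M ⟩ ℓ₁} → IsStable P → ∀ {w x} → P w → Cyclic w x → P x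
  cyclic⊆ P≤M w∈P (null e)      = IsStable.resp-≈ P≤M (≈ᴹ-sym e) (IsStable.0-closed P≤M)
  cyclic⊆ P≤M w∈P (cons b z∈ e) = P.resp-≈ (≈ᴹ-sym e) (P.+-closed (P.*-closed b w∈P) (P.t-closed (cyclic⊆ P≤M w∈P z∈)))
    where module P = IsStable P≤M

  -- Adding one cyclic module at a time lets an induction on the number of generators split off a
  -- single one.
  data Generated : ∀ {n} → Vec ⟨ M ⟩ n → Pred ⟨ M ⟩ (r ⊔ a ⊔ ℓ) where
    []  : ∀ {x} → x ≈ᴹ 0ᴹ → Generated [] x
    _∷_ : ∀ {n w} {ws : Vec ⟨ M ⟩ n} {x y z} → Generated ws y × x ≈ᴹ y +ᴹ z → Cyclic w z → Generated (w ∷ ws) x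

  generated-stable : ∀ {n} (ws : Vec ⟨ M ⟩ n) → IsStable (Generated ws)
  generated-stable [] = record
    { isSubmodule = record
      { resp-≈   = λ { e ([] f) → [] (≈ᴹ-trans (≈ᴹ-sym e) f) }
      ; 0-closed = [] ≈ᴹ-refl
      ; +-closed = λ { ([] e) ([] f) → [] (≈ᴹ-trans (+ᴹ-cong e f) (+ᴹ-identityˡ 0ᴹ)) }
      ; *-closed = λ { b ([] e) → [] (≈ᴹ-trans (*ₗ-cong refl e) (*ₗ-zeroʳ b)) } }
    ; t-closed = λ { ([] e) → [] (≈ᴹ-trans (t.⟦⟧-cong e) t.0ᴹ-homo) } }
  generated-stable (w ∷ ws) = record
    { isSubmodule = record
      { resp-≈   = λ { e ((y∈ , f) ∷ z∈) → (y∈ , ≈ᴹ-trans (≈ᴹ-sym e) f) ∷ z∈ }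
      ; 0-closed = (P.0-closed , ≈ᴹ-sym (+ᴹ-identityˡ 0ᴹ)) ∷ null ≈ᴹ-refl
      ; +-closed = λ { ((y∈ , e) ∷ z∈) ((y′∈ , f) ∷ z′∈) →
          (P.+-closed y∈ y′∈ , ≈ᴹ-trans (+ᴹ-cong e f) (+-interchange _ _ _ _)) ∷ cyclic-+ z∈ z′∈ }
      ; *-closed = λ { b ((y∈ , e) ∷ z∈) →
          (P.*-closed b y∈ , ≈ᴹ-trans (*ₗ-cong refl e) (*ₗ-distribˡ b _ _)) ∷ cyclic-* b z∈ } }
    ; t-closed = λ { ((y∈ , e) ∷ z∈) →
          (P.t-closed y∈ , ≈ᴹ-trans (t.⟦⟧-cong e) (t.+ᴹ-homo _ _)) ∷ cyclic-t z∈ } }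
    where module P = IsStable (generated-stable ws)

  generators : ∀ {n} (w : Vector ⟨ M ⟩ n) i → Generated (tabulate w) (w i)
  generators w Fin.zero    = (IsStable.0-closed (generated-stable _) , ≈ᴹ-sym (+ᴹ-identityˡ _)) ∷ cyclic-generator
  generators w (Fin.suc i) = (generators (λ j → w (Fin.suc j)) i , ≈ᴹ-sym (+ᴹ-identityʳ _)) ∷ null ≈ᴹ-refl

  Independent : ∀ {n} → Vector ⟨ M ⟩ n → Set (r ⊔ ℓr ⊔ ℓ)
  Independent {n} u = ∀ (b : Vector Carrier n) → sum (λ i → b i *ₗ u i) ≈ᴹ 0ᴹ → ∀ i → b i ≈ 0#

  independent-tail : ∀ {n} {u : Vector ⟨ M ⟩ (suc n)} → Independent u → Independent (λ i → u (Fin.suc i))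
  independent-tail {u = u} ind b e i = ind (λ { Fin.zero → 0# ; (Fin.suc j) → b j })
    (≈ᴹ-trans (+ᴹ-congʳ (*ₗ-zeroˡ (u Fin.zero))) (≈ᴹ-trans (+ᴹ-identityˡ _) e)) (Fin.suc i)

  -- A relation b among the new vectors is a relation among the old ones, with coefficient Σ bₗ sₗ
  -- at the eliminated vector `u i`.
  independent-eliminate : ∀ {n} {u : Vector ⟨ M ⟩ (suc n)} → Independent u → ∀ i (s : Vector Carrier n) →
    Independent (λ l → u (punchIn i l) +ᴹ s l *ₗ u i)
  independent-eliminate {n} {u} ind i s b e l =
    trans (reflexive (≡.sym (Vectorₚ.insertAt-punchIn b i bᵢ l))) (ind b′ b′u≈0 (punchIn i l))
    where
    module ΣK = CommutativeMonoidSum +-commutativeMonoid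
    bᵢ = ΣK.sum (λ l → b l * s l)
    b′ = insertAt b i bᵢ

    pull-out : ∀ {m} (v : Vector Carrier m) x → sum (λ l → v l *ₗ x) ≈ᴹ ΣK.sum v *ₗ x
    pull-out {zero}  v x = ≈ᴹ-sym (*ₗ-zeroˡ x)
    pull-out {suc m} v x = ≈ᴹ-trans (+ᴹ-congˡ (pull-out (λ l → v (Fin.suc l)) x)) (≈ᴹ-sym (*ₗ-distribʳ x _ _))

    b′u≈0 : sum (λ j → b′ j *ₗ u j) ≈ᴹ 0ᴹ
    b′u≈0 = begin
      sum (λ j → b′ j *ₗ u j)
        ≈⟨ sum-remove {i = i} (λ j → b′ j *ₗ u j) ⟩
      b′ i *ₗ u i +ᴹ sum (λ l → b′ (punchIn i l) *ₗ u (punchIn i l))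
        ≈⟨ +ᴹ-cong (*ₗ-cong (reflexive (Vectorₚ.insertAt-lookup b i bᵢ)) ≈ᴹ-refl)
                   (sum-cong-≋ (λ l → *ₗ-cong (reflexive (Vectorₚ.insertAt-punchIn b i bᵢ l)) ≈ᴹ-refl)) ⟩
      bᵢ *ₗ u i +ᴹ sum (λ l → b l *ₗ u (punchIn i l))
        ≈⟨ +ᴹ-comm _ _ ⟩
      sum (λ l → b l *ₗ u (punchIn i l)) +ᴹ bᵢ *ₗ u i
        ≈⟨ +ᴹ-congˡ (pull-out (λ l → b l * s l) (u i)) ⟨
      sum (λ l → b l *ₗ u (punchIn i l)) +ᴹ sum (λ l → (b l * s l) *ₗ u i)
        ≈⟨ ∑-distrib-+ (λ l → b l *ₗ u (punchIn i l)) (λ l → (b l * s l) *ₗ u i) ⟨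
      sum (λ l → b l *ₗ u (punchIn i l) +ᴹ (b l * s l) *ₗ u i)
        ≈⟨ sum-cong-≋ (λ l → ≈ᴹ-trans (+ᴹ-congˡ (*ₗ-assoc (b l) (s l) (u i))) (≈ᴹ-sym (*ₗ-distribˡ (b l) _ _))) ⟩
      sum (λ l → b l *ₗ (u (punchIn i l) +ᴹ s l *ₗ u i))
        ≈⟨ e ⟩
      0ᴹ ∎

  module _ {N : ℕ} (nilpotent : ∀ x → t^ N x ≈ᴹ 0ᴹ) where

    module _ {P : Pred ⟨ M ⟩ ℓ₁} (P≤M : IsStable P) where
      private module P = IsStable P≤M

      -- Iterating M = P + t M gives M = P + tᴺ M = P. The loop shows tˡ M ⊆ P, descending from l =
      -- N, with m = N - l as fuel.
      nakayama : (∀ x → ∃[ y ] ∃[ z ] P y × x ≈ᴹ y +ᴹ t z) → ∀ x → P x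
      nakayama split x = go N 0 (ℕₚ.+-identityʳ N) x
        where
        go : ∀ m l → m ℕ.+ l ≡ N → ∀ x → P (t^ l x)
        go zero    l ≡.refl x = P.resp-≈ (≈ᴹ-sym (nilpotent x)) P.0-closed
        go (suc m) l e x with split x
        ... | y , z , y∈P , x≈ = P.resp-≈
          (≈ᴹ-sym (≈ᴹ-trans (t^.⟦⟧-cong l x≈) (≈ᴹ-trans (t^.+ᴹ-homo l y (t z)) (+ᴹ-congˡ (t^-t l z)))))
          (P.+-closed (P.t^-closed l y∈P) (go m (suc l) (≡.trans (ℕₚ.+-suc m l) e) z))

      -- Nakayama's lemma for the image of K[t] v modulo P: replacing v by y + t z in b v + t z′
      -- leaves b y, which is in P, and t times another element of K[t] v.
      nakayama-cyclic : ∀ {v y z} → P y → Cyclic v z → v ≈ᴹ y +ᴹ t z → P v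
      nakayama-cyclic {v} {y} {z} y∈P z∈ v≈ = go N 0 (ℕₚ.+-identityʳ N) cyclic-generator
        where
        go : ∀ m l → m ℕ.+ l ≡ N → ∀ {x} → Cyclic v x → P (t^ l x)
        go m       l e (null x≈0) = P.resp-≈ (≈ᴹ-sym (≈ᴹ-trans (t^.⟦⟧-cong l x≈0) (t^.0ᴹ-homo l))) P.0-closed
        go zero    l ≡.refl {x} _ = P.resp-≈ (≈ᴹ-sym (nilpotent x)) P.0-closed
        go (suc m) l e (cons b {z′} z′∈ x≈) = P.resp-≈ (≈ᴹ-sym (≈ᴹ-trans (t^.⟦⟧-cong l x≈′)
            (≈ᴹ-trans (t^.+ᴹ-homo l _ _) (+ᴹ-congˡ (t^-t l _)))))
          (P.+-closed (P.t^-closed l (P.*-closed b y∈P))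
            (go m (suc l) (≡.trans (ℕₚ.+-suc m l) e) (cyclic-+ (cyclic-* b z∈) z′∈)))
          where
          x≈′ = begin
            _                                   ≈⟨ x≈ ⟩
            b *ₗ v +ᴹ t z′                      ≈⟨ +ᴹ-congʳ (*ₗ-cong refl v≈) ⟩
            b *ₗ (y +ᴹ t z) +ᴹ t z′             ≈⟨ +ᴹ-congʳ (*ₗ-distribˡ b y (t z)) ⟩
            (b *ₗ y +ᴹ b *ₗ t z) +ᴹ t z′        ≈⟨ +ᴹ-assoc _ _ _ ⟩
            b *ₗ y +ᴹ (b *ₗ t z +ᴹ t z′)        ≈⟨ +ᴹ-congˡ (+ᴹ-congʳ (t.*ₗ-homo b z)) ⟨
            b *ₗ y +ᴹ (t (b *ₗ z) +ᴹ t z′)      ≈⟨ +ᴹ-congˡ (t.+ᴹ-homo (b *ₗ z) z′) ⟨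
            b *ₗ y +ᴹ t (b *ₗ z +ᴹ z′)          ∎

    module _ (discrete : Discrete K) (1≉0 : ¬ 1# ≈ 0#) where

      -- The image of the kernel of t in P + K[t] w modulo P is at most one-dimensional.  A vector of
      -- lowest order tᵐ w in it can be eliminated from the others and forces tᵐ⁺¹ w into P.
      kernel-independent : ∀ {n} (ws : Vec ⟨ M ⟩ n) (u : Vector ⟨ M ⟩ (suc n)) → Independent u →
        (∀ i → t (u i) ≈ᴹ 0ᴹ) → (∀ i → Generated ws (u i)) → ⊥
      kernel-independent [] u ind tu≈0 u∈ with u∈ Fin.zero
      ... | [] u₀≈0 = 1≉0 (ind (λ _ → 1#)
        (≈ᴹ-trans (+ᴹ-identityʳ _) (≈ᴹ-trans (*ₗ-identityˡ (u Fin.zero)) u₀≈0)) Fin.zero)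
      kernel-independent {suc n} (w ∷ ws) u ind tu≈0 u∈ = go N 0 (ℕₚ.+-identityʳ N) u ind tu≈0 (λ i → order0 (u∈ i))
        where
        module P = IsStable (generated-stable ws)

        OfOrder : ℕ → Pred ⟨ M ⟩ _
        OfOrder m x = ∃[ y ] ∃[ z ] Generated ws y × Cyclic w z × x ≈ᴹ y +ᴹ t^ m z

        order0 : ∀ {x} → Generated (w ∷ ws) x → OfOrder 0 x
        order0 ((y∈ , e) ∷ z∈) = _ , _ , y∈ , z∈ , e

        -- The common order m is raised until some vector has a non-zero coefficient at tᵐ w, or
        -- until m = N.
        go : ∀ l m → l ℕ.+ m ≡ N → ∀ (u : Vector ⟨ M ⟩ (suc (suc n))) → Independent u →
          (∀ i → t (u i) ≈ᴹ 0ᴹ) → (∀ i → OfOrder m (u i)) → ⊥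
        -- tᴺ = 0 puts every vector into P. One of them is dropped, because the induction hypothesis
        -- for `ws` takes one vector fewer.
        go zero m ≡.refl u ind tu≈0 u∈ = kernel-independent ws (λ i → u (Fin.suc i))
          (independent-tail {u = u} ind) (λ i → tu≈0 (Fin.suc i)) (λ i → in-P (u∈ (Fin.suc i)))
          where
          in-P : ∀ {x} → OfOrder N x → Generated ws x
          in-P (y , z , y∈ , _ , e) =
            P.resp-≈ (≈ᴹ-sym (≈ᴹ-trans e (≈ᴹ-trans (+ᴹ-congˡ (nilpotent z)) (+ᴹ-identityʳ y)))) y∈
        go (suc l) m l+m≡N u ind tu≈0 u∈ = case-unit (find-unit K discrete b)
          where
          y : Vector ⟨ M ⟩ (suc (suc n))
          y i = proj₁ (u∈ i)

          y∈ : ∀ i → Generated ws (y i)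
          y∈ i = proj₁ (proj₂ (proj₂ (u∈ i)))

          decomposition : ∀ i → ∃[ b ] ∃[ z ] Cyclic w z × _
          decomposition i = uncons (proj₁ (proj₂ (proj₂ (proj₂ (u∈ i)))))

          b : Vector Carrier (suc (suc n))
          b i = proj₁ (decomposition i)

          z : Vector ⟨ M ⟩ (suc (suc n))
          z i = proj₁ (proj₂ (decomposition i))

          z∈ : ∀ i → Cyclic w (z i)
          z∈ i = proj₁ (proj₂ (proj₂ (decomposition i)))

          u≈ : ∀ i → u i ≈ᴹ y i +ᴹ (b i *ₗ t^ m w +ᴹ t (t^ m (z i)))
          u≈ i = ≈ᴹ-trans (proj₂ (proj₂ (proj₂ (proj₂ (u∈ i))))) (+ᴹ-congˡ
            (≈ᴹ-trans (t^.⟦⟧-cong m (proj₂ (proj₂ (proj₂ (decomposition i)))))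
              (≈ᴹ-trans (t^.+ᴹ-homo m _ _) (+ᴹ-cong (t^.*ₗ-homo m (b i) w) (t^-t m (z i))))))

          case-unit : (∃[ i ] ∃[ b′ ] b′ * b i ≈ 1#) ⊎ (∀ i → b i ≈ 0#) → ⊥
          case-unit (inj₂ b≈0) = go l (suc m) (≡.trans (ℕₚ.+-suc l m) l+m≡N) u ind tu≈0
            (λ i → y i , z i , y∈ i , z∈ i , ≈ᴹ-trans (u≈ i)
              (+ᴹ-congˡ (≈ᴹ-trans (+ᴹ-congʳ (*-annihilates (t^ m w) (b≈0 i))) (+ᴹ-identityˡ _))))
          case-unit (inj₁ (i , b′ , b′b≈1)) = kernel-independent ws u′ (independent-eliminate {u = u} ind i s) tu′≈0 u′∈
            where
            -- Since `u i` is in ker t, applying t to its decomposition expresses bᵢ v as an element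
            -- of P + t K[t] v. So v lies in P by Nakayama.
            v = t^ (suc m) w

            y+bv≈0 : (t (y i) +ᴹ t (t (t^ m (z i)))) +ᴹ b i *ₗ v ≈ᴹ 0ᴹ
            y+bv≈0 = begin
              (t (y i) +ᴹ t (t (t^ m (z i)))) +ᴹ b i *ₗ v
                ≈⟨ solve 3 (λ x y z → (x ⊕ y) ⊕ z ⊜ x ⊕ (z ⊕ y)) ≈ᴹ-refl _ _ _ ⟩
              t (y i) +ᴹ (b i *ₗ v +ᴹ t (t (t^ m (z i))))
                ≈⟨ +ᴹ-congˡ (+ᴹ-congʳ (t.*ₗ-homo (b i) (t^ m w))) ⟨
              t (y i) +ᴹ (t (b i *ₗ t^ m w) +ᴹ t (t (t^ m (z i))))
                ≈⟨ +ᴹ-congˡ (t.+ᴹ-homo _ _) ⟨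
              t (y i) +ᴹ t (b i *ₗ t^ m w +ᴹ t (t^ m (z i)))
                ≈⟨ t.+ᴹ-homo _ _ ⟨
              t (y i +ᴹ (b i *ₗ t^ m w +ᴹ t (t^ m (z i))))
                ≈⟨ t.⟦⟧-cong (u≈ i) ⟨
              t (u i)
                ≈⟨ tu≈0 i ⟩
              0ᴹ ∎

            e = b′ * - 1#

            v∈ : Generated ws v
            v∈ = nakayama-cyclic (generated-stable ws) (P.*-closed e (P.t-closed (y∈ i)))
              (cyclic-* e (cyclic-t^ (suc m) (z∈ i)))
              (≈ᴹ-trans (solve-for b′b≈1 y+bv≈0) (≈ᴹ-trans (*ₗ-distribˡ e _ _) (+ᴹ-congˡ (≈ᴹ-sym (t.*ₗ-homo e _)))))

            -- Chosen to cancel the coefficient of tᵐ w; all that remains of `u′ l` lies in P,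
            -- because tᵐ⁺¹ w does.
            s : Vector Carrier (suc n)
            s l = - b (punchIn i l) * b′

            u′ : Vector ⟨ M ⟩ (suc n)
            u′ l = u (punchIn i l) +ᴹ s l *ₗ u i

            tu′≈0 : ∀ l → t (u′ l) ≈ᴹ 0ᴹ
            tu′≈0 l = begin
              t (u′ l)                                 ≈⟨ t.+ᴹ-homo _ _ ⟩
              t (u (punchIn i l)) +ᴹ t (s l *ₗ u i)    ≈⟨ +ᴹ-cong (tu≈0 _) (t.*ₗ-homo (s l) (u i)) ⟩
              0ᴹ +ᴹ s l *ₗ t (u i)                     ≈⟨ +ᴹ-identityˡ _ ⟩
              s l *ₗ t (u i)                           ≈⟨ *ₗ-cong refl (tu≈0 i) ⟩
              s l *ₗ 0ᴹ                                ≈⟨ *ₗ-zeroʳ (s l) ⟩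
              0ᴹ                                       ∎

            tail∈ : ∀ j → Generated ws (t (t^ m (z j)))
            tail∈ j = cyclic⊆ (generated-stable ws) v∈ (cyclic-t^ (suc m) (z∈ j))

            b-cancel : ∀ l → b (punchIn i l) + s l * b i ≈ 0#
            b-cancel l = trans (+-congˡ (trans (*-assoc _ b′ (b i)) (trans (*-congˡ b′b≈1) (*-identityʳ _)))) (-‿inverseʳ _)

            u′∈ : ∀ l → Generated ws (u′ l)
            u′∈ l = P.resp-≈ (≈ᴹ-sym u′≈)
              (P.+-closed (P.+-closed (y∈ j) (P.*-closed (s l) (y∈ i)))
                          (P.+-closed (tail∈ j) (P.*-closed (s l) (tail∈ i))))
              where
              j = punchIn i l
              u′≈ : u′ l ≈ᴹ (y j +ᴹ s l *ₗ y i) +ᴹ (t (t^ m (z j)) +ᴹ s l *ₗ t (t^ m (z i)))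
              u′≈ = begin
                u j +ᴹ s l *ₗ u i
                  ≈⟨ +ᴹ-cong (u≈ j) (*ₗ-cong refl (u≈ i)) ⟩
                (y j +ᴹ (b j *ₗ t^ m w +ᴹ t (t^ m (z j))))
                  +ᴹ s l *ₗ (y i +ᴹ (b i *ₗ t^ m w +ᴹ t (t^ m (z i))))
                  ≈⟨ +ᴹ-congˡ (≈ᴹ-trans (*ₗ-distribˡ (s l) _ _) (+ᴹ-congˡ (*ₗ-distribˡ (s l) _ _))) ⟩
                (y j +ᴹ (b j *ₗ t^ m w +ᴹ t (t^ m (z j))))
                  +ᴹ (s l *ₗ y i +ᴹ (s l *ₗ b i *ₗ t^ m w +ᴹ s l *ₗ t (t^ m (z i))))
                  ≈⟨ solve 6 (λ y₁ b₁ z₁ y₂ b₂ z₂ → (y₁ ⊕ (b₁ ⊕ z₁)) ⊕ (y₂ ⊕ (b₂ ⊕ z₂)) ⊜ (b₁ ⊕ b₂) ⊕ ((y₁ ⊕ y₂) ⊕ (z₁ ⊕ z₂)))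
                       ≈ᴹ-refl _ _ _ _ _ _ ⟩
                (b j *ₗ t^ m w +ᴹ s l *ₗ b i *ₗ t^ m w)
                  +ᴹ ((y j +ᴹ s l *ₗ y i) +ᴹ (t (t^ m (z j)) +ᴹ s l *ₗ t (t^ m (z i))))
                  ≈⟨ +ᴹ-congʳ (+ᴹ-congˡ (*ₗ-assoc (s l) (b i) (t^ m w))) ⟨
                (b j *ₗ t^ m w +ᴹ (s l * b i) *ₗ t^ m w) +ᴹ _
                  ≈⟨ +ᴹ-congʳ (*ₗ-distribʳ (t^ m w) (b j) (s l * b i)) ⟨
                (b j + s l * b i) *ₗ t^ m w +ᴹ _
                  ≈⟨ +ᴹ-congʳ (*-annihilates (t^ m w) (b-cancel l)) ⟩
                0ᴹ +ᴹ _
                  ≈⟨ +ᴹ-identityˡ _ ⟩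
                (y j +ᴹ s l *ₗ y i) +ᴹ (t (t^ m (z j)) +ᴹ s l *ₗ t (t^ m (z i))) ∎

-- If M is generated over K[t] by a space E whose dimension is that of a subspace of the kernel of t,
-- then E meets t M trivially: a non-zero element of E in t M would, by Nakayama's lemma, be a
-- superfluous generator.
module _ {K : CommutativeRing r ℓr} (discrete : Discrete K)
  (1≉0 : ¬ CommutativeRing._≈_ K (CommutativeRing.1# K) (CommutativeRing.0# K))
  (M : LeftModule (CommutativeRing.ring K) a ℓ)
  (E : LeftModule (CommutativeRing.ring K) c ℓ₁) (E₀ : LeftModule (CommutativeRing.ring K) c ℓ₁)
  {t : ⟨ M ⟩ → ⟨ M ⟩} (t-linear : IsLinear M M t)
  {ι : ⟨ E ⟩ → ⟨ M ⟩} (ι-linear : IsLinear E M ι)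
  {κ : ⟨ E₀ ⟩ → ⟨ M ⟩} (κ-linear : IsLinear E₀ M κ)
  where

  open CommutativeRing K
  open LeftModule M
  private
    module E = LeftModule E
    module E₀ = LeftModule E₀
    module t = LinearMap {M = M} {N = M} t-linear
    module ι = LinearMap {M = E} {N = M} ι-linear
    module κ = LinearMap {M = E₀} {N = M} κ-linear
  open NilpotentOperator {K = K} M t-linear
  open ModuleProperties {R = K} M

  generators-meet-image : ∀ {N} → (∀ x → t^ N x ≈ᴹ 0ᴹ) →
    (∀ {x} → κ x ≈ᴹ 0ᴹ → x E₀.≈ᴹ E₀.0ᴹ) → (∀ x → t (κ x) ≈ᴹ 0ᴹ) →
    (∀ x → ∃[ y ] ∃[ z ] x ≈ᴹ ι y +ᴹ t z) →
    ∀ {d} → HasDimension E d → HasDimension E₀ d →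
    ∀ e z → ι e ≈ᴹ t z → e E.≈ᴹ E.0ᴹ
  generators-meet-image {N} nilpotent κ-injective tκ≈0 split {d} (β , β-basis) (β₀ , β₀-basis) e z ιe≈tz =
    -- The data of the bases are passed on separately so that d can be matched with `suc n`, which
    -- makes room for removing a basis vector.
    case-unit d β (IsBasis.spans β-basis) β₀ (IsBasis.independent β₀-basis) (IsBasis.spans β-basis e)
    where
    module ΣE = CommutativeMonoidSum E.+ᴹ-commutativeMonoid

    case-unit : ∀ d (β : Vector ⟨ E ⟩ d) → (∀ x → Σ[ b ∈ Vector Carrier d ] x E.≈ᴹ ΣE.sum (λ i → b i E.*ₗ β i)) →
      (β₀ : Vector ⟨ E₀ ⟩ d) →
      (∀ (b : Vector Carrier d) → MonoidSum.sum E₀.+ᴹ-monoid (λ i → b i E₀.*ₗ β₀ i) E₀.≈ᴹ E₀.0ᴹ → ∀ i → b i ≈ 0#) →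
      Σ[ b ∈ Vector Carrier d ] e E.≈ᴹ ΣE.sum (λ i → b i E.*ₗ β i) → e E.≈ᴹ E.0ᴹ
    case-unit d β spans β₀ ind (b , e≈) with find-unit K discrete b
    ... | inj₂ b≈0 = E.≈ᴹ-trans e≈ (E.≈ᴹ-trans
      (ΣE.sum-cong-≋ (λ i → E.≈ᴹ-trans (E.*ₗ-cong (b≈0 i) E.≈ᴹ-refl) (E.*ₗ-zeroˡ (β i)))) (ΣE.sum-replicate-zero d))
    case-unit (suc n) β spans β₀ ind (b , e≈) | inj₁ (i , b′ , b′b≈1) =
      -- The n = d - 1 basis vectors other than `β i` generate M, but ker t contains the d
      -- independent vectors `κ (β₀ j)`.
      ⊥-elim (kernel-independent {N} nilpotent discrete 1≉0 ws (λ j → κ (β₀ j)) κβ₀-independent (λ j → tκ≈0 (β₀ j))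
        (λ j → all∈ (κ (β₀ j))))
      where
      ws = tabulate (λ l → ι (β (punchIn i l)))
      module P = IsStable (generated-stable ws)

      κβ₀-independent : Independent (λ j → κ (β₀ j))
      κβ₀-independent b e = ind b (κ-injective (≈ᴹ-trans (κ.sum-homo (λ j → b j E₀.*ₗ β₀ j))
        (≈ᴹ-trans (sum-cong-≋ (λ j → κ.*ₗ-homo (b j) (β₀ j))) e)))

      Q : Pred ⟨ M ⟩ _
      Q x = ∃[ y ] ∃[ z ] Generated ws y × x ≈ᴹ y +ᴹ t z

      Q≤M : IsSubmodule M Q
      Q≤M = record
        { resp-≈   = λ { x≈x′ (y , z , y∈ , e) → y , z , y∈ , ≈ᴹ-trans (≈ᴹ-sym x≈x′) e }
        ; 0-closed = 0ᴹ , 0ᴹ , P.0-closed , ≈ᴹ-sym (≈ᴹ-trans (+ᴹ-identityˡ _) t.0ᴹ-homo)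
        ; +-closed = λ { (y , z , y∈ , e) (y′ , z′ , y′∈ , e′) → y +ᴹ y′ , z +ᴹ z′ , P.+-closed y∈ y′∈ ,
            ≈ᴹ-trans (+ᴹ-cong e e′) (≈ᴹ-trans (+-interchange _ _ _ _) (+ᴹ-congˡ (≈ᴹ-sym (t.+ᴹ-homo z z′)))) }
        ; *-closed = λ { b (y , z , y∈ , e) → b *ₗ y , b *ₗ z , P.*-closed b y∈ ,
            ≈ᴹ-trans (*ₗ-cong refl e) (≈ᴹ-trans (*ₗ-distribˡ b _ _) (+ᴹ-congˡ (≈ᴹ-sym (t.*ₗ-homo b z)))) } }
      module Q = IsSubmodule Q≤M

      ⊆Q : ∀ {y} → Generated ws y → Q y
      ⊆Q {y} y∈ = y , 0ᴹ , y∈ , ≈ᴹ-sym (≈ᴹ-trans (+ᴹ-congˡ t.0ᴹ-homo) (+ᴹ-identityʳ y))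

      t⊆Q : ∀ z → Q (t z)
      t⊆Q z = 0ᴹ , z , P.0-closed , ≈ᴹ-sym (+ᴹ-identityˡ (t z))

      others : Vector ⟨ M ⟩ n
      others l = b (punchIn i l) *ₗ ι (β (punchIn i l))

      ιe≈ : ι e ≈ᴹ sum others +ᴹ b i *ₗ ι (β i)
      ιe≈ = ≈ᴹ-trans (ι.⟦⟧-cong e≈) (≈ᴹ-trans (ι.sum-homo (λ j → b j E.*ₗ β j))
        (≈ᴹ-trans (sum-cong-≋ (λ j → ι.*ₗ-homo (b j) (β j)))
          (≈ᴹ-trans (sum-remove {i = i} (λ j → b j *ₗ ι (β j))) (+ᴹ-comm _ _))))

      -- The expansion of e is solved for the term with unit coefficient: modulo t M, where `ι e`
      -- vanishes, `ι (β i)` is a combination of the others.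
      pivot∈ : Q (ι (β i))
      pivot∈ = Q.resp-≈ (≈ᴹ-sym (solve-for b′b≈1 (begin
        (sum others +ᴹ (- 1#) *ₗ t z) +ᴹ b i *ₗ ι (β i)   ≈⟨ +ᴹ-congˡ (subtract (≈ᴹ-trans ιe≈ (+ᴹ-comm _ _))) ⟩
        (sum others +ᴹ (- 1#) *ₗ t z) +ᴹ (ι e +ᴹ (- 1#) *ₗ sum others)
          ≈⟨ solve 4 (λ x y z w → (x ⊕ y) ⊕ (z ⊕ w) ⊜ (x ⊕ w) ⊕ (z ⊕ y)) ≈ᴹ-refl _ _ _ _ ⟩
        (sum others +ᴹ (- 1#) *ₗ sum others) +ᴹ (ι e +ᴹ (- 1#) *ₗ t z)
          ≈⟨ +ᴹ-cong (-1* (sum others)) (≈ᴹ-trans (+ᴹ-congʳ ιe≈tz) (-1* (t z))) ⟩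
        0ᴹ +ᴹ 0ᴹ                                          ≈⟨ +ᴹ-identityˡ 0ᴹ ⟩
        0ᴹ                                                ∎)))
        (Q.*-closed _ (Q.+-closed
          (submodule-sum M Q≤M others (λ l → Q.*-closed (b (punchIn i l)) (⊆Q (generators (λ l → ι (β (punchIn i l))) l))))
          (Q.*-closed (- 1#) (t⊆Q z))))
        where
        open SetoidReasoning ≈ᴹ-setoid
        open CommutativeMonoidSolver +ᴹ-commutativeMonoid using (solve; _⊕_; _⊜_)

      β∈ : ∀ j → Q (ι (β j))
      β∈ j with i Finₚ.≟ j
      ... | yes ≡.refl = pivot∈
      ... | no i≢j = ≡.subst (λ j → Q (ι (β j))) (Finₚ.punchIn-punchOut i≢j)
                       (⊆Q (generators (λ l → ι (β (punchIn i l))) (punchOut i≢j)))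

      ι∈ : ∀ x → Q (ι x)
      ι∈ x with spans x
      ... | b , x≈ = Q.resp-≈ (≈ᴹ-sym (≈ᴹ-trans (ι.⟦⟧-cong x≈) (ι.sum-homo (λ j → b j E.*ₗ β j))))
        (submodule-sum M Q≤M (λ j → ι (b j E.*ₗ β j))
          (λ j → Q.resp-≈ (≈ᴹ-sym (ι.*ₗ-homo (b j) (β j))) (Q.*-closed (b j) (β∈ j))))

      split∈ : ∀ x → ∃[ y ] ∃[ z ] Generated ws y × x ≈ᴹ y +ᴹ t z
      split∈ x with split x
      ... | y , z , x≈ = Q.resp-≈ (≈ᴹ-sym x≈) (Q.+-closed (ι∈ y) (t⊆Q z))

      all∈ : ∀ x → Generated ws x
      all∈ = nakayama {N} nilpotent (generated-stable ws) split∈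

-- Unipotent operators in characteristic p.

absorption : ∀ n k → suc k ℕ.* (suc n C suc k) ≡ suc n ℕ.* (n C k)
absorption zero    zero    = ≡.refl
absorption zero    (suc k) = ≡.trans (≡.cong (suc (suc k) ℕ.*_) (k>n⇒nCk≡0 {1} {suc (suc k)} (ℕ.s≤s (ℕ.s≤s ℕ.z≤n)))) (ℕₚ.*-zeroʳ (suc (suc k)))
absorption (suc n) zero    = ≡.trans (≡.cong (1 ℕ.*_) (≡.sym (nCk+nC[k+1]≡[n+1]C[k+1] (suc n) 0)))
  (≡.trans (ℕₚ.*-identityˡ _) (≡.cong (1 ℕ.+_) (≡.trans (≡.sym (ℕₚ.*-identityˡ _)) (absorption n zero))))
absorption (suc n) (suc k) = begin
  suc (suc k) ℕ.* (suc (suc n) C suc (suc k))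
    ≡⟨ ≡.cong (suc (suc k) ℕ.*_) (nCk+nC[k+1]≡[n+1]C[k+1] (suc n) (suc k)) ⟨
  suc (suc k) ℕ.* (u ℕ.+ (suc n C suc (suc k)))
    ≡⟨ ℕₚ.*-distribˡ-+ (suc (suc k)) u _ ⟩
  suc (suc k) ℕ.* u ℕ.+ suc (suc k) ℕ.* (suc n C suc (suc k))
    ≡⟨ ≡.cong₂ (λ x y → u ℕ.+ x ℕ.+ y) (absorption n k) (absorption n (suc k)) ⟩
  u ℕ.+ suc n ℕ.* (n C k) ℕ.+ suc n ℕ.* (n C suc k)
    ≡⟨ ℕₚ.+-assoc u _ _ ⟩
  u ℕ.+ (suc n ℕ.* (n C k) ℕ.+ suc n ℕ.* (n C suc k))
    ≡⟨ ≡.cong (u ℕ.+_) (ℕₚ.*-distribˡ-+ (suc n) (n C k) (n C suc k)) ⟨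
  u ℕ.+ suc n ℕ.* ((n C k) ℕ.+ (n C suc k))
    ≡⟨ ≡.cong (λ x → u ℕ.+ suc n ℕ.* x) (nCk+nC[k+1]≡[n+1]C[k+1] n k) ⟩
  suc (suc n) ℕ.* u ∎
  where
  open ≡.≡-Reasoning
  u = suc n C suc k

-- By `absorption`, p divides (k + 1) C(p, k + 1), and it is too large to divide k + 1.
prime∣C : ∀ {p k} → Prime p → suc k ℕ.< p → p ∣ₙ p C suc k
prime∣C {suc n} {k} p-prime k<p
  with euclidsLemma (suc k) (suc n C suc k) p-prime (≡.subst (suc n ∣ₙ_) (≡.sym (absorption n k)) (m∣m*n (n C k)))
... | inj₁ p∣k = ⊥-elim (ℕₚ.<⇒≱ k<p (∣⇒≤ p∣k))
... | inj₂ p∣C = p∣C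

module UnipotentOperator {K : CommutativeRing r ℓr} (M : LeftModule (CommutativeRing.ring K) a ℓ)
  {g : ⟨ M ⟩ → ⟨ M ⟩} (g-linear : IsLinear M M g) where

  open CommutativeRing K using (-_; 1#; refl)
  open LeftModule M
  open ModuleProperties {R = K} M
  open SetoidReasoning ≈ᴹ-setoid
  open MonoidMult +ᴹ-monoid using (×-congʳ; ×-congˡ; ×-assocˡ; ×-homo-+; ×-homo-1) renaming (_×_ to _·_)
  open NilpotentOperator {K = K} M g-linear using () renaming (t^ to g^)
  private module g = LinearMap {M = M} {N = M} g-linear

  t : ⟨ M ⟩ → ⟨ M ⟩
  t x = g x +ᴹ (- 1#) *ₗ x

  t-linear : IsLinear M M t
  t-linear = linear M M (λ e → +ᴹ-cong (g.⟦⟧-cong e) (*ₗ-cong refl e))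
    (λ x y → ≈ᴹ-trans (+ᴹ-cong (g.+ᴹ-homo x y) (*ₗ-distribˡ _ x y)) (+-interchange _ _ _ _))
    (λ b x → ≈ᴹ-trans (+ᴹ-cong (g.*ₗ-homo b x) (*-swap _ b x)) (≈ᴹ-sym (*ₗ-distribˡ b _ _)))

  open NilpotentOperator {K = K} M t-linear
  private module t = LinearMap {M = M} {N = M} t-linear

  g≈1+t : ∀ x → g x ≈ᴹ x +ᴹ t x
  g≈1+t x = begin
    g x                              ≈⟨ +ᴹ-identityʳ _ ⟨
    g x +ᴹ 0ᴹ                        ≈⟨ +ᴹ-congˡ (-1* x) ⟨
    g x +ᴹ (x +ᴹ (- 1#) *ₗ x)        ≈⟨ +ᴹ-assoc _ _ _ ⟨
    (g x +ᴹ x) +ᴹ (- 1#) *ₗ x        ≈⟨ +ᴹ-congʳ (+ᴹ-comm _ _) ⟩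
    (x +ᴹ g x) +ᴹ (- 1#) *ₗ x        ≈⟨ +ᴹ-assoc _ _ _ ⟩
    x +ᴹ t x                         ∎

  -- gⁿ - 1 is divisible by g - 1. Modulo the image of t all powers of g thus act trivially.
  g^≈1+t : ∀ n x → ∃[ z ] g^ n x ≈ᴹ x +ᴹ t z
  g^≈1+t zero    x = 0ᴹ , ≈ᴹ-sym (≈ᴹ-trans (+ᴹ-congˡ t.0ᴹ-homo) (+ᴹ-identityʳ x))
  g^≈1+t (suc n) x with g^≈1+t n x
  ... | z , e = z +ᴹ g^ n x , (begin
    g (g^ n x)                   ≈⟨ g≈1+t _ ⟩
    g^ n x +ᴹ t (g^ n x)         ≈⟨ +ᴹ-congʳ e ⟩
    (x +ᴹ t z) +ᴹ t (g^ n x)     ≈⟨ +ᴹ-assoc _ _ _ ⟩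
    x +ᴹ (t z +ᴹ t (g^ n x))     ≈⟨ +ᴹ-congˡ (t.+ᴹ-homo _ _) ⟨
    x +ᴹ t (z +ᴹ g^ n x)         ∎)

  t-fixed : ∀ {x} → g x ≈ᴹ x → t x ≈ᴹ 0ᴹ
  t-fixed {x} e = ≈ᴹ-trans (+ᴹ-congʳ e) (-1* x)

  private
    g-×  : ∀ n x → g (n · x) ≈ᴹ n · g x
    g-× zero    x = g.0ᴹ-homo
    g-× (suc n) x = ≈ᴹ-trans (g.+ᴹ-homo x _) (+ᴹ-congˡ (g-× n x))

    ×-distrib-+ : ∀ n x y → n · (x +ᴹ y) ≈ᴹ n · x +ᴹ n · y
    ×-distrib-+ zero    x y = ≈ᴹ-sym (+ᴹ-identityˡ 0ᴹ)
    ×-distrib-+ (suc n) x y = ≈ᴹ-trans (+ᴹ-congˡ (×-distrib-+ n x y)) (+-interchange _ _ _ _)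

  binomial : ∀ n x → g^ n x ≈ᴹ ∑< (suc n) (λ k → (n C k) · t^ k x)
  binomial zero    x = ≈ᴹ-sym (≈ᴹ-trans (+ᴹ-identityʳ _) (×-homo-1 x))
  binomial (suc n) x = begin
    g (g^ n x)
      ≈⟨ g.⟦⟧-cong (binomial n x) ⟩
    g (∑< (suc n) (λ k → (n C k) · t^ k x))
      ≈⟨ g.sum-homo {n = suc n} (λ i → (n C Fin.toℕ i) · t^ (Fin.toℕ i) x) ⟩
    ∑< (suc n) (λ k → g ((n C k) · t^ k x))
      ≈⟨ sum-cong-≋ {suc n} (λ i → ≈ᴹ-trans (g-× (n C Fin.toℕ i) (t^ (Fin.toℕ i) x))
           (≈ᴹ-trans (×-congʳ (n C Fin.toℕ i) (g≈1+t (t^ (Fin.toℕ i) x))) (×-distrib-+ (n C Fin.toℕ i) (t^ (Fin.toℕ i) x) _))) ⟩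
    ∑< (suc n) (λ k → (n C k) · t^ k x +ᴹ (n C k) · t^ (suc k) x)
      ≈⟨ ∑-distrib-+ {suc n} (λ i → (n C Fin.toℕ i) · t^ (Fin.toℕ i) x) (λ i → (n C Fin.toℕ i) · t^ (suc (Fin.toℕ i)) x) ⟩
    ∑< (suc n) (λ k → (n C k) · t^ k x) +ᴹ ∑< (suc n) (λ k → (n C k) · t^ (suc k) x)
      -- Adding C(n, n + 1) tⁿ⁺¹ x = 0 makes the first sum, without its term for k = 0, as long as
      -- the second.
      ≈⟨ +ᴹ-congʳ (+ᴹ-identityʳ _) ⟨
    (∑< (suc n) (λ k → (n C k) · t^ k x) +ᴹ 0ᴹ) +ᴹ ∑< (suc n) (λ k → (n C k) · t^ (suc k) x)
      ≈⟨ +ᴹ-congʳ (+ᴹ-congˡ (×-congˡ (k>n⇒nCk≡0 (ℕₚ.n<1+n n)))) ⟨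
    (∑< (suc n) (λ k → (n C k) · t^ k x) +ᴹ (n C suc n) · t^ (suc n) x) +ᴹ ∑< (suc n) (λ k → (n C k) · t^ (suc k) x)
      ≈⟨ +ᴹ-congʳ (∑<-last (suc n) (λ k → (n C k) · t^ k x)) ⟨
    (1 · x +ᴹ ∑< (suc n) (λ k → (n C suc k) · t^ (suc k) x)) +ᴹ ∑< (suc n) (λ k → (n C k) · t^ (suc k) x)
      ≈⟨ +ᴹ-assoc _ _ _ ⟩
    1 · x +ᴹ (∑< (suc n) (λ k → (n C suc k) · t^ (suc k) x) +ᴹ ∑< (suc n) (λ k → (n C k) · t^ (suc k) x))
      ≈⟨ +ᴹ-congˡ (+ᴹ-comm _ _) ⟩
    1 · x +ᴹ (∑< (suc n) (λ k → (n C k) · t^ (suc k) x) +ᴹ ∑< (suc n) (λ k → (n C suc k) · t^ (suc k) x))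
      ≈⟨ +ᴹ-congˡ (∑-distrib-+ {suc n} (λ i → (n C Fin.toℕ i) · t^ (suc (Fin.toℕ i)) x)
                                       (λ i → (n C suc (Fin.toℕ i)) · t^ (suc (Fin.toℕ i)) x)) ⟨
    1 · x +ᴹ ∑< (suc n) (λ k → (n C k) · t^ (suc k) x +ᴹ (n C suc k) · t^ (suc k) x)
      ≈⟨ +ᴹ-congˡ (sum-cong-≋ {suc n} (λ i → ≈ᴹ-trans (≈ᴹ-sym (×-homo-+ (t^ (suc (Fin.toℕ i)) x) (n C Fin.toℕ i) _))
           (×-congˡ (nCk+nC[k+1]≡[n+1]C[k+1] n (Fin.toℕ i))))) ⟩
    ∑< (suc (suc n)) (λ k → (suc n C k) · t^ k x) ∎

  module _ {p} (p-prime : Prime p) (p×≈0 : ∀ x → p · x ≈ᴹ 0ᴹ) where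
    private
      ×-divisible : ∀ {n} → p ∣ₙ n → ∀ x → n · x ≈ᴹ 0ᴹ
      ×-divisible (divides q ≡.refl) x = ≈ᴹ-trans (≈ᴹ-sym (×-assocˡ x q p)) (≈ᴹ-trans (×-congʳ q (p×≈0 x)) (×-0 q))
        where
        ×-0 : ∀ q → q · 0ᴹ ≈ᴹ 0ᴹ
        ×-0 zero    = ≈ᴹ-refl
        ×-0 (suc q) = ≈ᴹ-trans (+ᴹ-identityˡ _) (×-0 q)

    -- Freshman's dream: tᵖ = (g - 1)ᵖ = gᵖ - 1.
    t^p≈0 : ∀ x → g^ p x ≈ᴹ x → t^ p x ≈ᴹ 0ᴹ
    t^p≈0 x g^p≈1 = go p ≡.refl
      where
      go : ∀ q → q ≡ p → t^ q x ≈ᴹ 0ᴹ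
      go zero    ≡.refl = ⊥-elim (¬prime[0] p-prime)
      go (suc n) ≡.refl = begin
        t^ p x                                    ≈⟨ +ᴹ-identityˡ _ ⟨
        0ᴹ +ᴹ t^ p x                              ≈⟨ +ᴹ-congʳ (≈ᴹ-trans (+ᴹ-comm _ _) (-1* x)) ⟨
        ((- 1#) *ₗ x +ᴹ x) +ᴹ t^ p x              ≈⟨ +ᴹ-assoc _ _ _ ⟩
        (- 1#) *ₗ x +ᴹ (x +ᴹ t^ p x)              ≈⟨ +ᴹ-congˡ x+t^px≈x ⟩
        (- 1#) *ₗ x +ᴹ x                          ≈⟨ ≈ᴹ-trans (+ᴹ-comm _ _) (-1* x) ⟩
        0ᴹ                                        ∎
        where
        f : ℕ → ⟨ M ⟩
        f k = (p C k) · t^ k x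

        -- The binomial coefficients C(p, k) with 0 < k < p are multiples of p, so gᵖ x = x + tᵖ x.
        middle : ∑< n (λ k → f (suc k)) ≈ᴹ 0ᴹ
        middle = ≈ᴹ-trans (sum-cong-≋ {n} (λ i → ×-divisible (prime∣C p-prime (ℕ.s≤s (Finₚ.toℕ<n i))) _))
          (sum-replicate-zero n)

        x+t^px≈x : x +ᴹ t^ p x ≈ᴹ x
        x+t^px≈x = begin
          x +ᴹ t^ p x                                           ≈⟨ +ᴹ-cong (×-homo-1 x) (×-homo-1 _) ⟨
          1 · x +ᴹ 1 · t^ p x                                   ≈⟨ +ᴹ-congˡ (×-congˡ (nCn≡1 p)) ⟨
          1 · x +ᴹ f p                                          ≈⟨ +ᴹ-congˡ (+ᴹ-identityˡ _) ⟨
          1 · x +ᴹ (0ᴹ +ᴹ f p)                                  ≈⟨ +ᴹ-congˡ (+ᴹ-congʳ middle) ⟨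
          1 · x +ᴹ (∑< n (λ k → f (suc k)) +ᴹ f p)              ≈⟨ +ᴹ-congˡ (∑<-last n (λ k → f (suc k))) ⟨
          ∑< (suc p) f                                          ≈⟨ binomial p x ⟨
          g^ p x                                                ≈⟨ g^p≈1 ⟩
          x                                                     ∎

-- Congruences in ℤ and ℤₚ

module ℤMod (s : ℤ) where
  open QuotientRing ℤ-properties.+-*-commutativeRing s public
  open Divisibility (CommutativeRing.semiring ℤ-properties.+-*-commutativeRing) using (_,_)
  open Data.Integer.Base using (_+_; _-_; _*_)

  abstract
    ≡+*⇒≡ₛ : ∀ {x y} q → x ≡ y + q * s → x ≡ₛ y
    ≡+*⇒≡ₛ {x} {y} q e = congruent {x} {y} (q , ≡.sym (≡.trans (≡.cong (_- y) e) (cancel y (q * s))))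
      where
      cancel : ∀ y z → y + z - y ≡ z
      cancel = ℤ-solver.solve-∀

    ≡ₛ⇒≡+* : ∀ {x y} → x ≡ₛ y → ∃[ q ] x ≡ y + q * s
    ≡ₛ⇒≡+* {x} {y} (congruent (q , e)) = q , ≡.trans (split x y) (≡.cong (λ z → y + z) (≡.sym e))
      where
      split : ∀ x y → x ≡ y + (x - y)
      split = ℤ-solver.solve-∀

    _≡ₛ?_ : ∀ x y → Dec (x ≡ₛ y)
    x ≡ₛ? y with s ℤ-divisibility.∣? (x - y)
    ... | yes (ℤ-divisibility.divides q e) = yes (congruent {x} {y} (q , ≡.sym e))
    ... | no s∤x-y = no λ { (congruent (q , e)) → s∤x-y (ℤ-divisibility.divides q (≡.sym e)) }

-- Stated for an abstract ring, as unfolding the operations of ℤₚ is expensive.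
module RingIdentities (R : CommutativeRing r ℓr) where
  open CommutativeRing R
  open RingSolver commutativeSemiring

  cancel-fraction : ∀ u v x y → u ≈ v → u * (1# * x) ≈ u * (1# * y) → v * x ≈ v * y
  cancel-fraction u v x y u≈v e =
    trans (*-cong (sym u≈v) (sym (*-identityˡ x))) (trans e (*-cong u≈v (*-identityˡ y)))

  digit-identity : ∀ p p^j z k y → p^j * ((p * 1#) * z + k) + y ≈ (p * p^j) * z + (y + p^j * k)
  digit-identity = solve 5 (λ p p^j z k y →
    p^j :* ((p :* con 1) :* z :+ k) :+ y := (p :* p^j) :* z :+ (y :+ p^j :* k)) refl

  shift-digit : ∀ p p^j x z z′ k y → x ≈ p^j * z + y → z ≈ (p * 1#) * z′ + k → x ≈ (p * p^j) * z′ + (y + p^j * k)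
  shift-digit p p^j x z z′ k y e f = trans e (trans (+-congʳ (*-congˡ f)) (digit-identity p p^j z′ k y))

  split-digit : ∀ p p^j z z′ k → z ≈ (p * 1#) * z′ + k → p^j * z ≈ p^j * k + (p * p^j) * z′
  split-digit p p^j z z′ k e = trans (*-congˡ e) (solve 4 (λ p p^j z k →
    p^j :* ((p :* con 1) :* z :+ k) := p^j :* k :+ (p :* p^j) :* z) refl p p^j z′ k)

  shift-power : ∀ p p^j → p^j * p ≈ (p * p^j) * 1#
  shift-power = solve 2 (λ p p^j → p^j :* p := (p :* p^j) :* con 1) refl

  -g+g+m≈m : ∀ g m → - g + (g + m) ≈ m
  -g+g+m≈m g m = trans (sym (+-assoc (- g) g m)) (trans (+-congʳ (-‿inverseˡ g)) (+-identityˡ m))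

  -n′+g≈-n : ∀ n n′ g → n′ ≈ g + n → - n′ + g ≈ - n
  -n′+g≈-n n n′ g e = begin
    - n′ + g              ≈⟨ +-congʳ (-‿cong (trans e (+-comm g n))) ⟩
    - (n + g) + g         ≈⟨ +-congʳ (AbelianGroupProperties.⁻¹-∙-comm +-abelianGroup n g) ⟨
    (- n + - g) + g       ≈⟨ +-assoc _ _ _ ⟩
    - n + (- g + g)       ≈⟨ +-congˡ (-‿inverseˡ g) ⟩
    - n + 0#              ≈⟨ +-identityʳ _ ⟩
    - n                   ∎
    where open SetoidReasoning setoid

  d-ν≈-n : ∀ n ν d → ν ≈ n + d → d - ν ≈ - n
  d-ν≈-n n ν d e = trans (+-comm d (- ν)) (-n′+g≈-n n ν d (trans e (+-comm n d)))

  x-y≈-z : ∀ x y z → x ≈ y → z ≈ 0# → x - y ≈ - z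
  x-y≈-z x y z e f = trans (+-congʳ e) (trans (-‿inverseʳ y)
    (sym (trans (-‿cong f) (RingProperties.-0#≈0# ring))))

  g+-g+n≈n : ∀ g n → g + (- g + n) ≈ n
  g+-g+n≈n g n = trans (sym (+-assoc g (- g) n)) (trans (+-congʳ (-‿inverseʳ g)) (+-identityˡ n))

  n-n′-n≈-n′ : ∀ n n′ → (n - n′) - n ≈ - n′
  n-n′-n≈-n′ n n′ = trans (+-comm (n - n′) (- n)) (-g+g+m≈m n (- n′))

  cancel-digit : ∀ p p^j z k l y → y + p^j * k ≈ (p * p^j) * z + (y + p^j * l) → p^j * k ≈ p^j * ((p * 1#) * z + l)
  cancel-digit p p^j z k l y e = RingProperties.+-cancelˡ ring y _ _
    (trans e (trans (sym (digit-identity p p^j z l y)) (+-comm _ y)))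

module PAdicProperties (p : ℕ) where
  open PAdicNumbers p
  open CommutativeRing ℤₚ hiding (zero)
  open Exp semiring using (_^_)
  open RingIdentities ℤₚ

  private
    module ℤ/ (n : ℕ) = ℤMod (+ (p ℕ.^ n))

    pos-^-suc : ∀ n → + (p ℕ.^ suc n) ≡ + p ℤ.* + (p ℕ.^ n)
    pos-^-suc n = ℤ-properties.pos-* p (p ℕ.^ n)

    pos-^-+ : ∀ n m → + (p ℕ.^ (n ℕ.+ m)) ≡ + (p ℕ.^ n) ℤ.* + (p ℕ.^ m)
    pos-^-+ n m = ≡.trans (≡.cong +_ (ℕₚ.^-distribˡ-+-* p n m)) (ℤ-properties.pos-* (p ℕ.^ n) (p ℕ.^ m))

  nat : ℕ → PAdicInteger
  nat n = limit (λ _ → + n) (λ j → ℤ/.≈⇒≡ₛ j ≡.refl)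

  abstract
    nat-+ : ∀ m n → nat (m ℕ.+ n) ≈ nat m + nat n
    nat-+ m n = levelwise (λ j → ℤ/.≈⇒≡ₛ j ≡.refl)

    nat-0 : nat 0 ≈ 0#
    nat-0 = levelwise (λ j → ℤ/.≈⇒≡ₛ j ≡.refl)

    nat-suc : ∀ n → nat (suc n) ≈ 1# + nat n
    nat-suc n = levelwise (λ j → ℤ/.≈⇒≡ₛ j ≡.refl)

    p#≈nat-p : p# ≈ nat p
    p#≈nat-p = levelwise (λ j → ℤ/.≈⇒≡ₛ j ≡.refl)

    residue-p^ : ∀ j n → residue (p# ^ j) n ≡ + (p ℕ.^ j)
    residue-p^ zero    n = ≡.refl
    residue-p^ (suc j) n = ≡.trans (≡.cong (+ p ℤ.*_) (residue-p^ j n)) (≡.sym (pos-^-suc j))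

    nat-*p^ : ∀ k j → nat (k ℕ.* p ℕ.^ j) ≈ (p# ^ j) * nat k
    nat-*p^ k j = levelwise (λ n → ℤ/.≈⇒≡ₛ n (≡.trans (≡.cong +_ (ℕₚ.*-comm k (p ℕ.^ j)))
      (≡.trans (ℤ-properties.pos-* (p ℕ.^ j) k) (≡.cong (ℤ._* + k) (≡.sym (residue-p^ j n))))))

    nat-p^ : ∀ j → nat (p ℕ.^ j) ≈ p# ^ j
    nat-p^ j = levelwise (λ n → ℤ/.≈⇒≡ₛ n (≡.sym (residue-p^ j n)))

    residue-+ : ∀ x m n → ℤ/._≡ₛ_ n (residue x (m ℕ.+ n)) (residue x n)
    residue-+ x zero    n = ℤ/.≈⇒≡ₛ n ≡.refl
    residue-+ x (suc m) n with ℤ/.≡ₛ⇒≡+* (m ℕ.+ n) (coherent x (m ℕ.+ n))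
    ... | q , e = ℤ/.≡ₛ-trans n (ℤ/.≡+*⇒≡ₛ n (q ℤ.* + (p ℕ.^ m)) (≡.trans e (≡.cong (λ u → residue x (m ℕ.+ n) ℤ.+ u)
        (≡.trans (≡.cong (q ℤ.*_) (pos-^-+ m n)) (≡.sym (ℤ-properties.*-assoc q (+ (p ℕ.^ m)) (+ (p ℕ.^ n))))))))
      (residue-+ x m n)

  infix 4 _≡_[mod-p^_]

  -- Only the residues at level j are compared, which makes the relation decidable. For p ≠ 0 it is
  -- congruence modulo pʲ ℤₚ, by `p^*+⇒≡[mod]` and `≡[mod]⇒p^*+`.
  record _≡_[mod-p^_] (x y : PAdicInteger) (j : ℕ) : Set where
    constructor same-residue
    field
      residues : ℤ/._≡ₛ_ j (residue x j) (residue y j)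

  abstract
    ≡[mod]-refl : ∀ {j x y} → x ≈ y → x ≡ y [mod-p^ j ]
    ≡[mod]-refl {j} x≈y = same-residue (at x≈y j)

    ≡[mod]-sym : ∀ {j x y} → x ≡ y [mod-p^ j ] → y ≡ x [mod-p^ j ]
    ≡[mod]-sym {j} (same-residue e) = same-residue (ℤ/.≡ₛ-sym j e)

    ≡[mod]-trans : ∀ {j x y z} → x ≡ y [mod-p^ j ] → y ≡ z [mod-p^ j ] → x ≡ z [mod-p^ j ]
    ≡[mod]-trans {j} (same-residue e) (same-residue f) = same-residue (ℤ/.≡ₛ-trans j e f)

    ≡[mod]-+ : ∀ {j x y u v} → x ≡ y [mod-p^ j ] → u ≡ v [mod-p^ j ] → x + u ≡ y + v [mod-p^ j ]
    ≡[mod]-+ {j} (same-residue e) (same-residue f) = same-residue (ℤ/.≡ₛ-+-cong j e f)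

    ≡[mod]? : ∀ x y j → Dec (x ≡ y [mod-p^ j ])
    ≡[mod]? x y j with ℤ/._≡ₛ?_ j (residue x j) (residue y j)
    ... | yes e = yes (same-residue e)
    ... | no ¬e = no λ { (same-residue e) → ¬e e }

    ≡[mod-p^0] : ∀ x y → x ≡ y [mod-p^ 0 ]
    ≡[mod-p^0] x y = same-residue (ℤ/.≡+*⇒≡ₛ 0 (residue x 0 ℤ.- residue y 0) (split (residue x 0) (residue y 0)))
      where
      split : ∀ x y → x ≡ y ℤ.+ (x ℤ.- y) ℤ.* ℤ.1ℤ
      split = ℤ-solver.solve-∀

    p^*+⇒≡[mod] : ∀ {x y} j z → x ≈ (p# ^ j) * z + y → x ≡ y [mod-p^ j ]
    p^*+⇒≡[mod] {x} {y} j z e = same-residue (ℤ/.≡ₛ-trans j (at e j) (ℤ/.≡+*⇒≡ₛ j (residue z j)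
      (≡.trans (≡.cong (λ u → u ℤ.* residue z j ℤ.+ residue y j) (residue-p^ j j)) (swap (+ (p ℕ.^ j)) (residue z j) (residue y j)))))
      where
      swap : ∀ u z y → u ℤ.* z ℤ.+ y ≡ y ℤ.+ z ℤ.* u
      swap = ℤ-solver.solve-∀

    ≡[mod-p^suc]⇒≡[mod-p^] : ∀ {j x y} → x ≡ y [mod-p^ suc j ] → x ≡ y [mod-p^ j ]
    ≡[mod-p^suc]⇒≡[mod-p^] {j} {x} {y} (same-residue e) with ℤ/.≡ₛ⇒≡+* (suc j) e
    ... | q , f = same-residue (ℤ/.≡ₛ-trans j (ℤ/.≡ₛ-sym j (coherent x j)) (ℤ/.≡ₛ-trans j
      (ℤ/.≡+*⇒≡ₛ j (q ℤ.* + p) (≡.trans f (≡.cong (λ u → residue y (suc j) ℤ.+ u)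
        (≡.trans (≡.cong (q ℤ.*_) (pos-^-suc j)) (≡.sym (ℤ-properties.*-assoc q (+ p) (+ (p ℕ.^ j))))))))
      (coherent y j)))

  module _ .{{_ : ℕ.NonZero p}} where
    private
      p^≢0 : ∀ n → ℕ.NonZero (p ℕ.^ n)
      p^≢0 n = ℕₚ.m^n≢0 p n

      divide : ∀ m n x y z → x ℤ.* + (p ℕ.^ m) ≡ y ℤ.* + (p ℕ.^ m) ℤ.+ z ℤ.* + (p ℕ.^ (m ℕ.+ n)) →
        x ≡ y ℤ.+ z ℤ.* + (p ℕ.^ n)
      divide m n x y z e = ℤ-properties.*-cancelʳ-≡ x (y ℤ.+ z ℤ.* + (p ℕ.^ n)) (+ (p ℕ.^ m)) {{p^≢0 m}} (≡.trans e
        (≡.trans (≡.cong (λ u → y ℤ.* + (p ℕ.^ m) ℤ.+ z ℤ.* u) (pos-^-+ m n)) (regroup y z (+ (p ℕ.^ m)) (+ (p ℕ.^ n)))))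
        where
        regroup : ∀ y z u v → y ℤ.* u ℤ.+ z ℤ.* (u ℤ.* v) ≡ (y ℤ.+ z ℤ.* v) ℤ.* u
        regroup = ℤ-solver.solve-∀

    abstract
      -- The n-th residue of z is the integer (x - y) / pʲ computed at level n + j: dividing by pʲ
      -- costs j digits of precision.
      ≡[mod]⇒p^*+ : ∀ {j x y} → x ≡ y [mod-p^ j ] → ∃[ z ] x ≈ (p# ^ j) * z + y
      ≡[mod]⇒p^*+ {j} {x} {y} (same-residue e) = z , levelwise x≈
        where
        difference : ∀ n → ∃[ q ] residue x (n ℕ.+ j) ≡ residue y (n ℕ.+ j) ℤ.+ q ℤ.* + (p ℕ.^ j)
        difference n = ℤ/.≡ₛ⇒≡+* j (ℤ/.≡ₛ-trans j (residue-+ x n j) (ℤ/.≡ₛ-trans j e (ℤ/.≡ₛ-sym j (residue-+ y n j))))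

        q : ℕ → ℤ
        q n = proj₁ (difference n)

        q-coherent : ∀ n → ℤ/._≡ₛ_ n (q (suc n)) (q n)
        q-coherent n = let u , x≡ = ℤ/.≡ₛ⇒≡+* (n ℕ.+ j) (coherent x (n ℕ.+ j)) ; v , y≡ = ℤ/.≡ₛ⇒≡+* (n ℕ.+ j) (coherent y (n ℕ.+ j)) in
          ℤ/.≡+*⇒≡ₛ n (u ℤ.- v) (divide j n (q (suc n)) (q n) (u ℤ.- v) (begin
          q (suc n) ℤ.* P
            ≡⟨ isolate (proj₂ (difference (suc n))) ⟩
          residue x (suc n ℕ.+ j) ℤ.- residue y (suc n ℕ.+ j)
            ≡⟨ ≡.cong₂ ℤ._-_ x≡ y≡ ⟩
          (residue x (n ℕ.+ j) ℤ.+ u ℤ.* + (p ℕ.^ (n ℕ.+ j))) ℤ.- (residue y (n ℕ.+ j) ℤ.+ v ℤ.* + (p ℕ.^ (n ℕ.+ j)))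
            ≡⟨ regroup (residue x (n ℕ.+ j)) (residue y (n ℕ.+ j)) u v (+ (p ℕ.^ (n ℕ.+ j))) ⟩
          (residue x (n ℕ.+ j) ℤ.- residue y (n ℕ.+ j)) ℤ.+ (u ℤ.- v) ℤ.* + (p ℕ.^ (n ℕ.+ j))
            ≡⟨ ≡.cong₂ (λ d m → d ℤ.+ (u ℤ.- v) ℤ.* + (p ℕ.^ m)) (≡.sym (isolate (proj₂ (difference n)))) (ℕₚ.+-comm n j) ⟩
          q n ℤ.* P ℤ.+ (u ℤ.- v) ℤ.* + (p ℕ.^ (j ℕ.+ n)) ∎))
          where
          open ≡.≡-Reasoning
          P : ℤ
          P = + (p ℕ.^ j)
          isolate : ∀ {x y z} → x ≡ y ℤ.+ z → z ≡ x ℤ.- y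
          isolate {x} {y} {z} e = ≡.trans (cancel y z) (≡.cong (ℤ._- y) (≡.sym e))
            where
            cancel : ∀ y z → z ≡ y ℤ.+ z ℤ.- y
            cancel = ℤ-solver.solve-∀
          regroup : ∀ x y u v w → (x ℤ.+ u ℤ.* w) ℤ.- (y ℤ.+ v ℤ.* w) ≡ (x ℤ.- y) ℤ.+ (u ℤ.- v) ℤ.* w
          regroup = ℤ-solver.solve-∀

        z : PAdicInteger
        z = limit q q-coherent

        x≈ : ∀ n → ℤ/._≡ₛ_ n (residue x n) (residue ((p# ^ j) * z + y) n)
        x≈ n = ℤ/.≡ₛ-trans n (ℤ/.≡ₛ-sym n (≡.subst (λ m → ℤ/._≡ₛ_ n (residue x m) (residue x n)) (ℕₚ.+-comm j n) (residue-+ x j n)))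
          (ℤ/.≡ₛ-trans n (ℤ/.≈⇒≡ₛ n (≡.trans (proj₂ (difference n))
            (≡.trans (swap (residue y (n ℕ.+ j)) (q n) (+ (p ℕ.^ j)))
              (≡.cong (λ u → u ℤ.* q n ℤ.+ residue y (n ℕ.+ j)) (≡.sym (residue-p^ j n))))))
            (ℤ/.≡ₛ-+-cong n (ℤ/.≈⇒≡ₛ n {residue (p# ^ j) n ℤ.* q n} ≡.refl) (≡.subst (λ m → ℤ/._≡ₛ_ n (residue y m) (residue y n)) (ℕₚ.+-comm j n) (residue-+ y j n))))
          where
          swap : ∀ y z u → y ℤ.+ z ℤ.* u ≡ u ℤ.* z ℤ.+ y
          swap = ℤ-solver.solve-∀

      -- ℤₚ has no p-torsion: cancelling pʲ at level j + n leaves a congruence modulo pⁿ.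
      ^-cancel : ∀ j {x y} → (p# ^ j) * x ≈ (p# ^ j) * y → x ≈ y
      ^-cancel j {x} {y} e = levelwise (λ n → ℤ/.≡ₛ-trans n (ℤ/.≡ₛ-sym n (residue-+ x j n))
        (ℤ/.≡ₛ-trans n (level n) (residue-+ y j n)))
        where
        level : ∀ n → ℤ/._≡ₛ_ n (residue x (j ℕ.+ n)) (residue y (j ℕ.+ n))
        level n with ℤ/.≡ₛ⇒≡+* (j ℕ.+ n) (at e (j ℕ.+ n))
        ... | q , f = ℤ/.≡+*⇒≡ₛ n q (divide j n (residue x (j ℕ.+ n)) (residue y (j ℕ.+ n)) q (≡.trans (ℤ-properties.*-comm _ (+ (p ℕ.^ j)))
          (≡.trans (≡.cong (ℤ._* residue x (j ℕ.+ n)) (≡.sym (residue-p^ j (j ℕ.+ n))))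
            (≡.trans f (≡.cong (ℤ._+ q ℤ.* + (p ℕ.^ (j ℕ.+ n)))
              (≡.trans (≡.cong (ℤ._* residue y (j ℕ.+ n)) (residue-p^ j (j ℕ.+ n))) (ℤ-properties.*-comm (+ (p ℕ.^ j)) _)))))))

      representative : ∀ x j → ∃[ n ] n ℕ.< p ℕ.^ j × x ≡ nat n [mod-p^ j ]
      representative x j = residue x j ℤ-divmod.%ℕ P , ℤ-divmod.n%ℕd<d (residue x j) P ,
        same-residue (ℤ/.≡+*⇒≡ₛ j (residue x j ℤ-divmod./ℕ P) (ℤ-divmod.a≡a%ℕn+[a/ℕn]*n (residue x j) P))
        where
        P : ℕ
        P = p ℕ.^ j
        instance
          P≢0 : ℕ.NonZero P
          P≢0 = p^≢0 j

      private
        -- Otherwise n - m would be a positive multiple of pʲ below pʲ.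
        no-multiple : ∀ j {m n} → m ℕ.< n → n ℕ.< p ℕ.^ j → ℤ/._≡ₛ_ j (+ n) (+ m) → ⊥
        no-multiple j {m} {n} m<n n< n≡m = let q , e = ℤ/.≡ₛ⇒≡+* j n≡m in
          ℕₚ.<⇒≱ (ℕₚ.≤-<-trans (ℕₚ.m∸n≤m n m) n<) (∣⇒≤ {{ℕ.>-nonZero (ℕₚ.m<n⇒0<n∸m m<n)}} (ℤ-divisibility.∣⇒∣ᵤ
            {+ (p ℕ.^ j)} {+ (n ℕ.∸ m)} (ℤ-divisibility.divides q (begin
              + (n ℕ.∸ m)                            ≡⟨ ℤ-properties.⊖-≥ (ℕₚ.<⇒≤ m<n) ⟨
              n ℤ.⊖ m                                ≡⟨ ℤ-properties.m-n≡m⊖n n m ⟨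
              + n ℤ.- + m                            ≡⟨ ≡.cong (ℤ._- + m) e ⟩
              + m ℤ.+ q ℤ.* + (p ℕ.^ j) ℤ.- + m      ≡⟨ cancel (+ m) _ ⟩
              q ℤ.* + (p ℕ.^ j)                      ∎))))
          where
          open ≡.≡-Reasoning
          cancel : ∀ y z → y ℤ.+ z ℤ.- y ≡ z
          cancel = ℤ-solver.solve-∀

      representative-unique : ∀ j {m n} → m ℕ.< p ℕ.^ j → n ℕ.< p ℕ.^ j → nat m ≡ nat n [mod-p^ j ] → m ≡ n
      representative-unique j {m} {n} m< n< (same-residue e) with ℕₚ.<-cmp m n
      ... | tri≈ _ m≡n _ = m≡n
      ... | tri< m<n _ _ = ⊥-elim (no-multiple j m<n n< (ℤ/.≡ₛ-sym j e))
      ... | tri> _ _ n<m = ⊥-elim (no-multiple j n<m m< e)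

      -- If x = y + pʲ z, then k is z modulo p. In the tree, k selects among the p edges from y 𝔳ⱼ
      -- to level j + 1 the one that ends in x 𝔳ⱼ₊₁.
      digit : ∀ {j x y} → x ≡ y [mod-p^ j ] → ∃[ k ] k ℕ.< p × x ≡ y + (p# ^ j) * nat k [mod-p^ suc j ]
      digit {j} {x} {y} x≡y =
        let z , x≈ = ≡[mod]⇒p^*+ x≡y
            k , k<p , z≡k = representative z 1
            z′ , z≈ = ≡[mod]⇒p^*+ z≡k
        in k , ≡.subst (k ℕ.<_) (ℕₚ.*-identityʳ p) k<p ,
           p^*+⇒≡[mod] (suc j) z′ (shift-digit p# (p# ^ j) x z z′ (nat k) y x≈ z≈)

      digit-unique : ∀ {j k l y} → k ℕ.< p → l ℕ.< p →
        y + (p# ^ j) * nat k ≡ y + (p# ^ j) * nat l [mod-p^ suc j ] → k ≡ l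
      digit-unique {j} {k} {l} {y} k< l< e =
        let z , f = ≡[mod]⇒p^*+ e in
        representative-unique 1
          (≡.subst (k ℕ.<_) (≡.sym (ℕₚ.*-identityʳ p)) k<) (≡.subst (l ℕ.<_) (≡.sym (ℕₚ.*-identityʳ p)) l<)
          (p^*+⇒≡[mod] 1 z (^-cancel j (cancel-digit p# (p# ^ j) z (nat k) (nat l) y f)))

-- The residue field has characteristic p.

module IntegralInverse {c ℓ c′ ℓ′ : Level} (Z : CommutativeRing c ℓ) (C : CommutativeRing c′ ℓ′)
  (f : CommutativeRing.Carrier Z → CommutativeRing.Carrier C)
  (f-hom : RingMorphisms.IsRingHomomorphism (CommutativeRing.rawRing Z) (CommutativeRing.rawRing C) f)
  (ϖ : CommutativeRing.Carrier Z) where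

  private module Z = CommutativeRing Z
  open CommutativeRing C
  open RingMorphisms.IsRingHomomorphism f-hom
  open Exp semiring using (_^_)
  open CommutativeMonoidSum +-commutativeMonoid using (sum; sum-cong-≋)
  open RingSolver commutativeSemiring
  open SetoidReasoning setoid

  abstract
    sum-*ˡ : ∀ {n} x (v : Vector Carrier n) → sum (λ i → x * v i) ≈ x * sum v
    sum-*ˡ {zero}  x v = sym (zeroʳ x)
    sum-*ˡ {suc n} x v = trans (+-congˡ (sum-*ˡ x (λ i → v (Fin.suc i)))) (sym (distribˡ x _ _))

    -- With y = 1/ϖ, multiplication by ϖⁿ turns aᵢ yⁱ into aᵢ ϖⁿ⁻ⁱ, and i < n leaves at least one
    -- factor ϖ.
    clear-denominators : ∀ {y} → f ϖ * y ≈ 1# → ∀ n (a : Vector Z.Carrier n) →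
      ∃[ b ] (f ϖ ^ n) * sum (λ i → f (a i) * y ^ Fin.toℕ i) ≈ f ϖ * f b
    clear-denominators {y} Py≈1 zero    a = Z.0# , trans (zeroʳ _) (sym (trans (*-congˡ 0#-homo) (zeroʳ _)))
    clear-denominators {y} Py≈1 (suc n) a =
      let b , e = clear-denominators Py≈1 n (λ i → a (Fin.suc i))
          d , g = power n (a Fin.zero)
      in d Z.+ b , (begin
        (P * P ^ n) * (f (a Fin.zero) * 1# + sum (λ i → f (a (Fin.suc i)) * (y * y ^ Fin.toℕ i)))
          ≈⟨ *-congˡ (+-congˡ (trans (sum-cong-≋ {n} (λ i → swap (f (a (Fin.suc i))) y (y ^ Fin.toℕ i))) (sum-*ˡ {n} y (λ i → f (a (Fin.suc i)) * y ^ Fin.toℕ i)))) ⟩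
        (P * P ^ n) * (f (a Fin.zero) * 1# + y * S)
          ≈⟨ solve 5 (λ p q a y s → (p :* q) :* (a :* con 1 :+ y :* s) := p :* (q :* a) :+ (p :* y) :* (q :* s)) refl P (P ^ n) (f (a Fin.zero)) y (S) ⟩
        P * (P ^ n * f (a Fin.zero)) + (P * y) * (P ^ n * S)
          ≈⟨ +-cong (*-congˡ g) (trans (*-cong Py≈1 e) (*-identityˡ _)) ⟩
        P * f d + P * f b
          ≈⟨ distribˡ P _ _ ⟨
        P * (f d + f b)
          ≈⟨ *-congˡ (+-homo d b) ⟨
        P * f (d Z.+ b) ∎)
      where
      P : Carrier
      P = f ϖ
      S : Carrier
      S = sum (λ (i : Fin n) → f (a (Fin.suc i)) * y ^ Fin.toℕ i)
      swap : ∀ x y z → x * (y * z) ≈ y * (x * z)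
      swap = solve 3 (λ x y z → x :* (y :* z) := y :* (x :* z)) refl
      power : ∀ n x → ∃[ d ] (P ^ n) * f x ≈ f d
      power zero    x = x , *-identityˡ (f x)
      power (suc n) x = let d , e = power n x in ϖ Z.* d ,
        trans (*-assoc P (P ^ n) (f x)) (trans (*-congˡ e) (sym (*-homo ϖ d)))

    y^n*P^n≈1 : ∀ {y} → f ϖ * y ≈ 1# → ∀ n → (f ϖ ^ n) * y ^ n ≈ 1#
    y^n*P^n≈1 Py≈1 zero    = *-identityˡ 1#
    y^n*P^n≈1 {y} Py≈1 (suc n) = trans
      (solve 4 (λ p q x z → (p :* q) :* (x :* z) := (p :* x) :* (q :* z)) refl (f ϖ) (f ϖ ^ n) y (y ^ n))
      (trans (*-cong Py≈1 (y^n*P^n≈1 Py≈1 n)) (*-identityˡ 1#))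

    -- Multiplied by ϖⁿ, the monic equation for y = 1/ϖ becomes 1 + ϖ b = 0.
    integral-inverse : ∀ {y} → f ϖ * y ≈ 1# → ∀ n (a : Vector Z.Carrier n) →
      y ^ n + sum (λ i → f (a i) * y ^ Fin.toℕ i) ≈ 0# → ∃[ b ] f (Z.1# Z.+ ϖ Z.* b) ≈ 0#
    integral-inverse {y} Py≈1 n a e = let b , g = clear-denominators Py≈1 n a in b , (begin
      f (Z.1# Z.+ ϖ Z.* b)                       ≈⟨ trans (+-homo _ _) (+-cong 1#-homo (*-homo ϖ b)) ⟩
      1# + f ϖ * f b                             ≈⟨ +-cong (y^n*P^n≈1 Py≈1 n) g ⟨
      (f ϖ ^ n) * y ^ n + (f ϖ ^ n) * sum (λ i → f (a i) * y ^ Fin.toℕ i) ≈⟨ distribˡ _ _ _ ⟨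
      (f ϖ ^ n) * (y ^ n + sum (λ i → f (a i) * y ^ Fin.toℕ i)) ≈⟨ *-congˡ e ⟩
      (f ϖ ^ n) * 0#                             ≈⟨ zeroʳ _ ⟩
      0#                                         ∎)

    -- The unit 1 + ϖ b cannot become 0 in C, where 1 differs from 0.
    no-integral-inverse : ¬ 1# ≈ 0# → (∀ b → ∃[ v ] (Z.1# Z.+ ϖ Z.* b) Z.* v Z.≈ Z.1#) →
      ∀ {y} → f ϖ * y ≈ 1# → ∀ n (a : Vector Z.Carrier n) → ¬ y ^ n + sum (λ i → f (a i) * y ^ Fin.toℕ i) ≈ 0#
    no-integral-inverse 1≉0 inv Py≈1 n a e =
      let b , fu≈0 = integral-inverse Py≈1 n a e
          v , uv≈1 = inv b
      in 1≉0 (trans (sym 1#-homo) (trans (⟦⟧-cong (Z.sym uv≈1))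
           (trans (*-homo _ v) (trans (*-congʳ fu≈0) (zeroˡ _)))))

module _ (p : ℕ) where
  open PAdicNumbers p
  private
    module ℤₚ = CommutativeRing ℤₚ
    module ℤ/ (n : ℕ) = ℤMod (+ (p ℕ.^ n))

    -- (1 + p a)⁻¹ = 1 - p a (1 - p a (1 - …)).
    inverse-residue : PAdicInteger → ℕ → ℤ
    inverse-residue a zero    = ℤ.0ℤ
    inverse-residue a (suc n) = ℤ.1ℤ ℤ.- + p ℤ.* residue a (suc n) ℤ.* inverse-residue a n

  abstract
    -- With u = 1 + p a and v′ = 1 - p a v one has u v′ - 1 = - p a (u v - 1), so each step gains a
    -- factor p. Modulo p⁰ there is no condition, hence the start with 0.
    1+p-invertible : ∀ a → ∃[ v ] (ℤₚ.1# ℤₚ.+ p# ℤₚ.* a) ℤₚ.* v ℤₚ.≈ ℤₚ.1#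
    1+p-invertible a = limit v v-coherent , levelwise inverts
      where
      v : ℕ → ℤ
      v = inverse-residue a

      u : ℕ → ℤ
      u n = ℤ.1ℤ ℤ.+ + p ℤ.* residue a n

      inverts : ∀ n → ℤ/._≡ₛ_ n (u n ℤ.* v n) ℤ.1ℤ

      -- `v n` also inverts the next residue of u, as consecutive residues agree modulo pⁿ.
      inverts′ : ∀ n → ∃[ q ] u (suc n) ℤ.* v n ≡ ℤ.1ℤ ℤ.+ q ℤ.* + (p ℕ.^ n)
      inverts′ n = ℤ/.≡ₛ⇒≡+* n (ℤ/.≡ₛ-trans n
        (ℤ/.≡ₛ-*-cong n (ℤ/.≡ₛ-+-cong n (ℤ/.≈⇒≡ₛ n {ℤ.1ℤ} ≡.refl) (ℤ/.≡ₛ-*-cong n (ℤ/.≈⇒≡ₛ n {+ p} ≡.refl) (coherent a n)))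
          (ℤ/.≈⇒≡ₛ n {v n} ≡.refl))
        (inverts n))

      v-coherent : ∀ n → ℤ/._≡ₛ_ n (v (suc n)) (v n)
      v-coherent n = let q , e = inverts′ n in ℤ/.≡+*⇒≡ₛ n (ℤ.- q)
        (≡.trans (split (+ p) (residue a (suc n)) (v n)) (≡.trans (≡.cong (λ x → v n ℤ.+ (ℤ.1ℤ ℤ.- x)) e) (negate (v n) q (+ (p ℕ.^ n)))))
        where
        split : ∀ p a v → ℤ.1ℤ ℤ.- p ℤ.* a ℤ.* v ≡ v ℤ.+ (ℤ.1ℤ ℤ.- (ℤ.1ℤ ℤ.+ p ℤ.* a) ℤ.* v)
        split = ℤ-solver.solve-∀
        negate : ∀ v q s → v ℤ.+ (ℤ.1ℤ ℤ.- (ℤ.1ℤ ℤ.+ q ℤ.* s)) ≡ v ℤ.+ (ℤ.- q) ℤ.* s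
        negate = ℤ-solver.solve-∀

      inverts zero = ℤ/.≡+*⇒≡ₛ 0 (u 0 ℤ.* v 0 ℤ.- ℤ.1ℤ) (trivial (u 0 ℤ.* v 0))
        where
        trivial : ∀ x → x ≡ ℤ.1ℤ ℤ.+ (x ℤ.- ℤ.1ℤ) ℤ.* ℤ.1ℤ
        trivial = ℤ-solver.solve-∀
      inverts (suc n) = let q , e = inverts′ n in ℤ/.≡+*⇒≡ₛ (suc n) (ℤ.- (residue a (suc n) ℤ.* q))
        (≡.trans (expand (+ p) (residue a (suc n)) (v n)) (≡.trans (≡.cong (λ x → ℤ.1ℤ ℤ.+ + p ℤ.* residue a (suc n) ℤ.* (ℤ.1ℤ ℤ.- x)) e)
          (≡.trans (collect (+ p) (residue a (suc n)) q (+ (p ℕ.^ n)))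
            (≡.cong (λ s → ℤ.1ℤ ℤ.+ (ℤ.- (residue a (suc n) ℤ.* q)) ℤ.* s) (≡.sym (ℤ-properties.pos-* p (p ℕ.^ n)))))))
        where
        expand : ∀ p a v → (ℤ.1ℤ ℤ.+ p ℤ.* a) ℤ.* (ℤ.1ℤ ℤ.- p ℤ.* a ℤ.* v) ≡ ℤ.1ℤ ℤ.+ p ℤ.* a ℤ.* (ℤ.1ℤ ℤ.- (ℤ.1ℤ ℤ.+ p ℤ.* a) ℤ.* v)
        expand = ℤ-solver.solve-∀
        collect : ∀ p a q s → ℤ.1ℤ ℤ.+ p ℤ.* a ℤ.* (ℤ.1ℤ ℤ.- (ℤ.1ℤ ℤ.+ q ℤ.* s)) ≡ ℤ.1ℤ ℤ.+ (ℤ.- (a ℤ.* q)) ℤ.* (p ℤ.* s)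
        collect = ℤ-solver.solve-∀

module _ {R : CommutativeRing r ℓr} {S : CommutativeRing c ℓ}
  {f : CommutativeRing.Carrier R → CommutativeRing.Carrier S}
  (f-hom : RingMorphisms.IsRingHomomorphism (CommutativeRing.rawRing R) (CommutativeRing.rawRing S) f) where

  private
    module R = CommutativeRing R
    module S = CommutativeRing S
    module R× = MonoidMult R.+-monoid
    module S× = MonoidMult S.+-monoid
  open RingMorphisms.IsRingHomomorphism f-hom

  ×-homo : ∀ n → f (n R×.× R.1#) S.≈ n S×.× S.1#
  ×-homo zero    = 0#-homo
  ×-homo (suc n) = S.trans (+-homo _ _) (S.+-cong 1#-homo (×-homo n))

module ResidueField {p : ℕ} {K : FiniteExtension p c ℓ₁ ℓ₂} (O : RingOfIntegers p K r ℓr)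
  {π : RingOfIntegers.Carrier O} (π-uniformizer : RingOfIntegers.IsUniformizer O π) where

  private
    module K = FiniteExtension K
    module O = RingOfIntegers O
    module O× = MonoidMult O.+-monoid
    module π = RingOfIntegers.IsUniformizer π-uniformizer
    module inc = RingMorphisms.IsRingMonomorphism O.isMonomorphism
  open PAdicNumbers p using (PAdicInteger; p#; ℤₚ; module Fractions)
  open Divisibility O.semiring using (_∣_; _,_)
  open PAdicProperties p using (nat; nat-0; nat-suc; p#≈nat-p)
  private
    module ℤₚ = CommutativeRing ℤₚ

  k : CommutativeRing r (r ⊔ ℓr)
  k = O.𝔬 ⧸ π

  private
    module k = CommutativeRing k

    f : PAdicInteger → K.Carrier
    f x = K.embed (Fractions.ι x)

    f-hom : RingMorphisms.IsRingHomomorphism ℤₚ.rawRing K.rawRing f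
    f-hom = isRingHomomorphism K.trans Fractions.ι-isRingHomomorphism K.embed-isHomomorphism

    x-0≈x : ∀ x → x O.- O.0# O.≈ x
    x-0≈x x = O.trans (O.+-congˡ (RingProperties.-0#≈0# O.ring)) (O.+-identityʳ x)

  abstract
    ∣⇒≈0 : ∀ {x} → π ∣ x → x k.≈ k.0#
    ∣⇒≈0 {x} (q , e) = QuotientRing.congruent (q , O.trans e (O.sym (x-0≈x x)))

    discrete : Discrete k
    discrete x with π.unit-or-∣ x
    ... | inj₁ (x⁻¹ , x⁻¹x≈1 , _) = inj₁ (x⁻¹ , QuotientRing.≈⇒≡ₛ O.𝔬 π x⁻¹x≈1)
    ... | inj₂ π∣x                = inj₂ (∣⇒≈0 π∣x)

    1≉0 : ¬ k.1# k.≈ k.0#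
    1≉0 (QuotientRing.congruent (q , e)) = π.non-unit (q , qπ≈1 , O.trans (O.*-comm π q) qπ≈1)
      where
      qπ≈1 : q O.* π O.≈ O.1#
      qπ≈1 = O.trans e (x-0≈x O.1#)

    1≉0ᴷ : ¬ K.1# K.≈ K.0#
    1≉0ᴷ 1≈0 = field-K.#-irrefl 1≈0 (field-K.invertible⇒# (K.1# , K.trans (K.*-identityˡ _) 1-0≈1 , K.trans (K.*-identityʳ _) 1-0≈1))
      where
      module field-K = HeytingField K.field-K
      1-0≈1 : K.1# K.- K.0# K.≈ K.1#
      1-0≈1 = K.trans (K.+-congˡ (RingProperties.-0#≈0# K.ring)) (K.+-identityʳ _)

    p#≈p× : p# ℤₚ.≈ MonoidMult._×_ ℤₚ.+-monoid p ℤₚ.1#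
    p#≈p× = ℤₚ.trans p#≈nat-p (nat≈× p)
      where
      nat≈× : ∀ n → nat n ℤₚ.≈ MonoidMult._×_ ℤₚ.+-monoid n ℤₚ.1#
      nat≈× zero    = nat-0
      nat≈× (suc n) = ℤₚ.trans (nat-suc n) (ℤₚ.+-congˡ {ℤₚ.1#} {nat n} {MonoidMult._×_ ℤₚ.+-monoid n ℤₚ.1#} (nat≈× n))

    -- No map from ℤₚ to 𝔬 is given, so p is compared inside K, where it is a multiple of 1 from
    -- both sides.
    fp≈inc-p : f p# K.≈ O.inclusion (p O×.× O.1#)
    fp≈inc-p = K.trans (RingMorphisms.IsRingHomomorphism.⟦⟧-cong f-hom p#≈p×)
      (K.trans (×-homo {R = ℤₚ} {S = K.K} f-hom p) (K.sym (×-homo {R = O.𝔬} {S = K.K} inc.isRingHomomorphism p)))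

    -- An inverse of p in 𝔬 would be 1/p in K, integral by `image`, against `no-integral-inverse`.
    p-non-unit : ¬ O.Unit (p O×.× O.1#)
    p-non-unit (y , yp≈1 , py≈1) =
      let n , a , e = Equivalence.from (O.image (O.inclusion y)) (y , K.refl)
      in IntegralInverse.no-integral-inverse ℤₚ K.K f f-hom p# 1≉0ᴷ (1+p-invertible p)
           (K.trans (K.*-congʳ fp≈inc-p) (K.trans (K.sym (inc.*-homo _ y)) (K.trans (inc.⟦⟧-cong py≈1) inc.1#-homo))) n a e

    p×1≈0 : (p O×.× O.1#) k.≈ k.0#
    p×1≈0 with π.unit-or-∣ (p O×.× O.1#)
    ... | inj₁ unit = ⊥-elim (p-non-unit unit)
    ... | inj₂ π∣p  = ∣⇒≈0 π∣p

  module _ (M : LeftModule k.ring a ℓ) where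
    open LeftModule M
    open MonoidMult +ᴹ-monoid using () renaming (_×_ to infixr 8 _·_)

    abstract
      ·≈*ₗ : ∀ n x → n · x ≈ᴹ (n O×.× O.1#) *ₗ x
      ·≈*ₗ zero    x = ≈ᴹ-sym (*ₗ-zeroˡ x)
      ·≈*ₗ (suc n) x = ≈ᴹ-sym (≈ᴹ-trans (*ₗ-distribʳ x _ _) (+ᴹ-cong (*ₗ-identityˡ x) (≈ᴹ-sym (·≈*ₗ n x))))

      p·≈0 : ∀ x → p · x ≈ᴹ 0ᴹ
      p·≈0 x = ≈ᴹ-trans (·≈*ₗ p x) (≈ᴹ-trans (*ₗ-cong p×1≈0 ≈ᴹ-refl) (*ₗ-zeroˡ x))

-- Equality of vertices as congruence modulo powers of p.

module CosetCriterion {c ℓ c′ ℓ′ : Level} (Z : CommutativeRing c ℓ) (Q : CommutativeRing c′ ℓ′)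
  (ι : CommutativeRing.Carrier Z → CommutativeRing.Carrier Q)
  (ι-hom : RingMorphisms.IsRingHomomorphism (CommutativeRing.rawRing Z) (CommutativeRing.rawRing Q) ι)
  (ϖ : CommutativeRing.Carrier Z) (ϖ⁻¹ : CommutativeRing.Carrier Q)
  (ϖ⁻¹*ϖ≈1 : CommutativeRing._≈_ Q (CommutativeRing._*_ Q ϖ⁻¹ (ι ϖ)) (CommutativeRing.1# Q))
  where

  private
    module Z = CommutativeRing Z
    module MZ = Matrices Z
    module M = Monoid (Matrices.M₂-monoid Q)
  open CommutativeRing Q
  open Matrices Q using (M₂; mat; entries; _≈ₘ_; _*ₘ_; GL₂; _∙_; diagonal-^) renaming (_•_ to infixr 7 _•ₘ_)
  open PGL₂Cosets Z Q ι ι-hom ϖ ϖ⁻¹ ϖ⁻¹*ϖ≈1 renaming (•-cong to •ₘ-cong)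
  open Exp Z.semiring using () renaming (_^_ to _^ᶻ_)
  open Exp semiring using (_^_)
  open RingMorphisms.IsRingHomomorphism ι-hom
  open RingSolver commutativeSemiring
  open SetoidReasoning setoid

  private
    P^ : ℕ → Carrier
    P^ i = ι ϖ ^ i

    matrix≈ : ∀ x i → GL₂.matrix (𝔫 x ∙ (Matrices._^ᴳ_ Q φ i)) ≈ₘ mat (P^ i) (ι x) 0# 1#
    matrix≈ x i = M.trans (M.∙-congˡ (diagonal-^ (ι ϖ) ϖ⁻¹ ϖ⁻¹*ϖ≈1 i)) (entries
      (solve 2 (λ u x → con 1 :* u :+ x :* con 0 := u) refl (P^ i) (ι x))
      (solve 1 (λ x → con 1 :* con 0 :+ x :* con 1 := x) refl (ι x))
      (solve 1 (λ u → con 0 :* u :+ con 1 :* con 0 := con 0) refl (P^ i))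
      (solve 0 (con 0 :* con 0 :+ con 1 :* con 1 := con 1) refl))

    ϖ⁻¹^*ϖ^≈1 : ∀ i → (ϖ⁻¹ ^ i) * P^ i ≈ 1#
    ϖ⁻¹^*ϖ^≈1 zero    = *-identityˡ 1#
    ϖ⁻¹^*ϖ^≈1 (suc i) = trans (solve 4 (λ u v x y → (u :* x) :* (v :* y) := (u :* v) :* (x :* y)) refl ϖ⁻¹ (ι ϖ) (ϖ⁻¹ ^ i) (P^ i))
      (trans (*-cong ϖ⁻¹*ϖ≈1 (ϖ⁻¹^*ϖ^≈1 i)) (*-identityˡ 1#))

    -- Comparing entries in (Pⁱ x ; 0 1) = s (Pⁱ y ; 0 1) (A B ; C E), where (A B ; C E) has an
    -- inverse with lower row (C′ E′), shows C = C′ = 0 and s = E′.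
    solve-equation : ∀ {P P⁻¹ x y s A B C E C′ E′} → P⁻¹ * P ≈ 1# →
      C′ * A + E′ * C ≈ 0# → C′ * B + E′ * E ≈ 1# →
      P ≈ s * (P * A + y * C) → x ≈ s * (P * B + y * E) → 0# ≈ s * (0# * A + 1# * C) → 1# ≈ s * (0# * B + 1# * E) →
      x ≈ P * (E′ * B) + y
    solve-equation {P} {P⁻¹} {x} {y} {s} {A} {B} {C} {E} {C′} {E′} P⁻¹P≈1 inv₁ inv₂ e₁₁ e₁₂ e₂₁ e₂₂ = begin
      x                                   ≈⟨ e₁₂ ⟩
      s * (P * B + y * E)                 ≈⟨ solve 5 (λ s P B y E → s :* (P :* B :+ y :* E) := P :* (s :* B) :+ y :* (s :* E)) refl s P B y E ⟩
      P * (s * B) + y * (s * E)           ≈⟨ +-cong (*-congˡ (*-congʳ s≈E′)) (trans (*-congˡ sE≈1) (*-identityʳ y)) ⟩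
      P * (E′ * B) + y                    ∎
      where
      sE≈1 : s * E ≈ 1#
      sE≈1 = sym (trans e₂₂ (*-congˡ (solve 2 (λ B E → con 0 :* B :+ con 1 :* E := E) refl B E)))

      C≈0 : C ≈ 0#
      C≈0 = begin
        C                       ≈⟨ *-identityˡ C ⟨
        1# * C                  ≈⟨ *-congʳ sE≈1 ⟨
        (s * E) * C             ≈⟨ solve 4 (λ s E A C → (s :* E) :* C := E :* (s :* (con 0 :* A :+ con 1 :* C))) refl s E A C ⟩
        E * (s * (0# * A + 1# * C)) ≈⟨ *-congˡ e₂₁ ⟨
        E * 0#                  ≈⟨ zeroʳ E ⟩
        0#                      ∎

      As≈1 : A * s ≈ 1#
      As≈1 = begin
        A * s                              ≈⟨ *-identityˡ _ ⟨
        1# * (A * s)                       ≈⟨ *-congʳ P⁻¹P≈1 ⟨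
        (P⁻¹ * P) * (A * s)                ≈⟨ solve 5 (λ P P⁻¹ A s y → (P⁻¹ :* P) :* (A :* s) := P⁻¹ :* (s :* (P :* A :+ y :* con 0))) refl P P⁻¹ A s y ⟩
        P⁻¹ * (s * (P * A + y * 0#))       ≈⟨ *-congˡ (*-congˡ (+-congˡ (*-congˡ C≈0))) ⟨
        P⁻¹ * (s * (P * A + y * C))        ≈⟨ *-congˡ e₁₁ ⟨
        P⁻¹ * P                            ≈⟨ P⁻¹P≈1 ⟩
        1#                                 ∎

      C′≈0 : C′ ≈ 0#
      C′≈0 = begin
        C′                                 ≈⟨ *-identityʳ C′ ⟨
        C′ * 1#                            ≈⟨ *-congˡ As≈1 ⟨
        C′ * (A * s)                       ≈⟨ solve 4 (λ C′ A s E′ → C′ :* (A :* s) := s :* (C′ :* A :+ E′ :* con 0)) refl C′ A s E′ ⟩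
        s * (C′ * A + E′ * 0#)             ≈⟨ *-congˡ (+-congˡ (*-congˡ C≈0)) ⟨
        s * (C′ * A + E′ * C)              ≈⟨ *-congˡ inv₁ ⟩
        s * 0#                             ≈⟨ zeroʳ s ⟩
        0#                                 ∎

      s≈E′ : s ≈ E′
      s≈E′ = begin
        s                                  ≈⟨ *-identityʳ s ⟨
        s * 1#                             ≈⟨ *-congˡ inv₂ ⟨
        s * (C′ * B + E′ * E)              ≈⟨ *-congˡ (+-congʳ (*-congʳ C′≈0)) ⟩
        s * (0# * B + E′ * E)              ≈⟨ solve 4 (λ s B E′ E → s :* (con 0 :* B :+ E′ :* E) := E′ :* (s :* E)) refl s B E′ E ⟩
        E′ * (s * E)                       ≈⟨ *-congˡ sE≈1 ⟩
        E′ * 1#                            ≈⟨ *-identityʳ E′ ⟩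
        E′                                 ∎

  abstract
    -- A priori the scalar lies only in Q, but comparing entries forces it to be an entry of the
    -- inverse of `k`. So x and y differ by ϖⁱ times the image of `e₂₂ * b₁₂`, an element of Z.
    SameVertex⇒ : ∀ {i x y} → SameVertex i x y → ∃[ z ] ι x ≈ ι ((ϖ ^ᶻ i) Z.* z Z.+ y)
    SameVertex⇒ {i} {x} {y} (same-coset s) = e₂₂ Z.* b₁₂ , trans
      (solve-equation (ϖ⁻¹^*ϖ^≈1 i) (relation (MZ._≈ₘ_.eq₂₁ inverse*k) 0#-homo) (relation (MZ._≈ₘ_.eq₂₂ inverse*k) 1#-homo)
        (_≈ₘ_.eq₁₁ equation′) (_≈ₘ_.eq₁₂ equation′) (_≈ₘ_.eq₂₁ equation′) (_≈ₘ_.eq₂₂ equation′))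
      (sym (trans (+-homo _ y) (+-congʳ (trans (*-homo (ϖ ^ᶻ i) (e₂₂ Z.* b₁₂)) (*-cong (ι-^ ϖ i) (*-homo e₂₂ b₁₂))))))
      where
      open _∼_ s
      inverse*k : MZ.GL₂.inverse k MZ.*ₘ MZ.GL₂.matrix k MZ.≈ₘ MZ.1ₘ
      inverse*k = MZ.GL₂.inverseˡ k
      b₁₂ e₂₂ : Z.Carrier
      b₁₂ = MZ.M₂.e₁₂ (MZ.GL₂.matrix k)
      e₂₂ = MZ.M₂.e₂₂ (MZ.GL₂.inverse k)

      equation′ : mat (P^ i) (ι x) 0# 1# ≈ₘ scalar •ₘ (mat (P^ i) (ι y) 0# 1# *ₘ mapι (MZ.GL₂.matrix k))
      equation′ = M.trans (M.sym (matrix≈ x i)) (M.trans equation (•ₘ-cong (M.∙-congʳ (matrix≈ y i))))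

      relation : ∀ {a b a′ b′ c d} → (a Z.* a′) Z.+ (b Z.* b′) Z.≈ c → ι c ≈ d → ι a * ι a′ + ι b * ι b′ ≈ d
      relation {a} {b} {a′} {b′} e f = trans (sym (trans (+-homo _ _) (+-cong (*-homo a a′) (*-homo b b′)))) (trans (⟦⟧-cong e) f)

    ⇒SameVertex : ∀ {i x y} z → x Z.≈ (ϖ ^ᶻ i) Z.* z Z.+ y → SameVertex i x y
    ⇒SameVertex {i} {x} {y} z e = same-coset (record
      { scalar = 1# ; unit = 1-invertible ; k = MZ.unipotent z
      ; equation = M.trans (matrix≈ x i) (M.sym (M.trans (•ₘ-cong (M.∙-cong (matrix≈ y i)
          (entries 1#-homo refl 0#-homo 1#-homo))) (entries
            (solve 2 (λ u y → con 1 :* (u :* con 1 :+ y :* con 0) := u) refl (P^ i) (ι y))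
            (trans (solve 3 (λ u y z → con 1 :* (u :* z :+ y :* con 1) := u :* z :+ y) refl (P^ i) (ι y) (ι z)) (sym ιx≈))
            (solve 0 (con 1 :* (con 0 :* con 1 :+ con 1 :* con 0) := con 0) refl)
            (solve 1 (λ z → con 1 :* (con 0 :* z :+ con 1 :* con 1) := con 1) refl (ι z))))) })
      where
      ιx≈ : ι x ≈ P^ i * ι z + ι y
      ιx≈ = trans (⟦⟧-cong e) (trans (+-homo _ y) (+-congʳ (trans (*-homo (ϖ ^ᶻ i) z) (*-congʳ (ι-^ ϖ i)))))

module HalfTreeProperties (p : ℕ) .{{_ : ℕ.NonZero p}} where
  open HalfTree p
  open PAdicNumbers p
  open PAdicProperties p
  open PGL₂Cosets ℤₚ ℚₚ ι Fractions.ι-isRingHomomorphism p# 1/p 1/p*p≈1 using (SameVertex)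
  private
    module Z = CommutativeRing ℤₚ
    module Criterion = CosetCriterion ℤₚ ℚₚ ι Fractions.ι-isRingHomomorphism p# 1/p 1/p*p≈1
  open Exp Z.semiring using (_^_)

  abstract
    -- Fractions are equal up to a multiplier that is a power of p, and powers of p can be cancelled
    -- in ℤₚ.
    ι-injective : ∀ {x y} → CommutativeRing._≈_ ℚₚ (ι x) (ι y) → x Z.≈ y
    ι-injective {x} {y} (Fractions.equal u (k , u≈p^k) e) =
      ^-cancel k (RingIdentities.cancel-fraction ℤₚ u (p# ^ k) x y u≈p^k e)

    SameVertex⇒≡[mod] : ∀ {i x y} → SameVertex i x y → x ≡ y [mod-p^ i ]
    SameVertex⇒≡[mod] {i} s = let z , e = Criterion.SameVertex⇒ s in p^*+⇒≡[mod] i z (ι-injective e)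

    ≡[mod]⇒SameVertex : ∀ {i x y} → x ≡ y [mod-p^ i ] → SameVertex i x y
    ≡[mod]⇒SameVertex x≡y = let z , e = ≡[mod]⇒p^*+ x≡y in Criterion.⇒SameVertex z e

    ≡[mod]⇒≈ᵛ : ∀ {i x y} → x ≡ y [mod-p^ i ] → x ·𝔳 i ≈ᵛ y ·𝔳 i
    ≡[mod]⇒≈ᵛ e = same (≡[mod]⇒SameVertex e)

    ≈ᵛ-sym : ∀ {y y′} → y ≈ᵛ y′ → y′ ≈ᵛ y
    ≈ᵛ-sym (same s) = ≡[mod]⇒≈ᵛ (≡[mod]-sym (SameVertex⇒≡[mod] s))

    ≈ᵛ-trans : ∀ {y y′ y″} → y ≈ᵛ y′ → y′ ≈ᵛ y″ → y ≈ᵛ y″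
    ≈ᵛ-trans (same s) (same s′) = ≡[mod]⇒≈ᵛ (≡[mod]-trans (SameVertex⇒≡[mod] s) (SameVertex⇒≡[mod] s′))

    -- The outer vertex of n 𝔢ᵢ depends on n modulo pⁱ, the inner one only on n modulo pⁱ⁻¹.
    ∈-transport : ∀ {i x x′ y} → x ≡ x′ [mod-p^ i ] → y ∈ x ·𝔢 i → y ∈ x′ ·𝔢 i
    ∈-transport e (outer q) = outer (≈ᵛ-trans q (≡[mod]⇒≈ᵛ e))
    ∈-transport e (inner q) = inner (≈ᵛ-trans q (≡[mod]⇒≈ᵛ (≡[mod-p^suc]⇒≡[mod-p^] e)))

    ≡[mod]⇒≈ᵉ : ∀ {i x y} → x ≡ y [mod-p^ i ] → x ·𝔢 i ≈ᵉ y ·𝔢 i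
    ≡[mod]⇒≈ᵉ e = same (λ y → mk⇔ (∈-transport e) (∈-transport (≡[mod]-sym e)))

    fixes-vertex : ∀ {j x} → x ≡ 0# [mod-p^ j ] → x · vertex (𝔳 j) ≈ˢ vertex (𝔳 j)
    fixes-vertex x≡0 = vertex (≡[mod]⇒≈ᵛ (≡[mod]-trans (≡[mod]-+ x≡0 (≡[mod]-refl Z.refl)) (≡[mod]-refl (Z.+-identityʳ 0#))))

    fixes-edge : ∀ {j x} → x ≡ 0# [mod-p^ j ] → x · edge (𝔢 j) ≈ˢ edge (𝔢 j)
    fixes-edge x≡0 = edge (≡[mod]⇒≈ᵉ (≡[mod]-trans (≡[mod]-+ x≡0 (≡[mod]-refl Z.refl)) (≡[mod]-refl (Z.+-identityʳ 0#))))

    pow≡0 : ∀ j z → pow j z ≡ 0# [mod-p^ j ]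
    pow≡0 j z = p^*+⇒≡[mod] j z (Z.sym (Z.+-identityʳ (pow j z)))

    ≡0⇒pow : ∀ {j x} → x ≡ 0# [mod-p^ j ] → ∃[ z ] x Z.≈ pow j z
    ≡0⇒pow {j} x≡0 = let z , e = ≡[mod]⇒p^*+ x≡0 in z , Z.trans e (Z.+-identityʳ (pow j z))

    pow-0 : ∀ j → pow j (nat 0) Z.≈ 0#
    pow-0 j = Z.trans (Z.*-congˡ {p# ^ j} {nat 0} {0#} nat-0) (Z.zeroʳ (p# ^ j))

    pow-suc : ∀ j k → pow j 1# + pow j (nat k) Z.≈ pow j (nat (suc k))
    pow-suc j k = Z.trans (Z.sym (Z.distribˡ (p# ^ j) 1# (nat k)))
      (Z.*-congˡ {p# ^ j} {1# + nat k} {nat (suc k)} (Z.sym (nat-suc k)))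

    -- z = k + p z′ with a digit k. The summand from z′ lies in 𝔑₀^(pʲ⁺¹), which acts trivially on
    -- 𝒱(𝔳ⱼ) at level 1 over k.
    pow-digit : ∀ j z → ∃[ k ] ∃[ z′ ] pow j (nat k) + pow (suc j) z′ Z.≈ pow j z
    pow-digit j z =
      let k , _ , z≡k = representative z 1
          z′ , e = ≡[mod]⇒p^*+ z≡k
      in k , z′ , Z.sym (RingIdentities.split-digit ℤₚ p# (p# ^ j) z z′ (nat k) e)

    pow-p : ∀ j → pow j (nat p) Z.≈ pow (suc j) 1#
    pow-p j = Z.trans (Z.*-congˡ {p# ^ j} {nat p} {p#} (Z.sym p#≈nat-p)) (RingIdentities.shift-power ℤₚ p# (p# ^ j))

    infix 4 _≈ᵛ?_

    -- Decidability is what allows the component of a formal sum at a given vertex to be read off.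
    _≈ᵛ?_ : ∀ y y′ → Dec (y ≈ᵛ y′)
    (m ·𝔳 i) ≈ᵛ? (n ·𝔳 j) with i ℕₚ.≟ j
    ... | no i≢j = no λ { (same _) → i≢j ≡.refl }
    ... | yes ≡.refl with ≡[mod]? m n i
    ...   | yes m≡n = yes (≡[mod]⇒≈ᵛ m≡n)
    ...   | no m≢n  = no λ { (same s) → m≢n (SameVertex⇒≡[mod] s) }

    ≈ᵛ⇒level : ∀ {i j m n} → m ·𝔳 i ≈ᵛ n ·𝔳 j → i ≡ j
    ≈ᵛ⇒level (same _) = ≡.refl

    ≈ᵛ⇒≡[mod] : ∀ {i j m n} → m ·𝔳 i ≈ᵛ n ·𝔳 j → m ≡ n [mod-p^ j ]
    ≈ᵛ⇒≡[mod] (same s) = SameVertex⇒≡[mod] s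

    untranslate : ∀ {j m n} → m ≡ n [mod-p^ j ] → (Z.- n) + m ≡ 0# [mod-p^ j ]
    untranslate {n = n} m≡n = ≡[mod]-trans (≡[mod]-+ (≡[mod]-refl (Z.refl {Z.- n})) m≡n) (≡[mod]-refl (Z.-‿inverseˡ n))

    untranslate-vertex : ∀ {y j n} → y ≈ᵛ n ·𝔳 j → (Z.- n) · vertex y ≈ˢ vertex (𝔳 j)
    untranslate-vertex (same s) = vertex (≡[mod]⇒≈ᵛ (untranslate (SameVertex⇒≡[mod] s)))

    untranslate-edge : ∀ {i j m n} → m ·𝔳 i ≈ᵛ n ·𝔳 j → (Z.- n) · edge (m ·𝔢 i) ≈ˢ edge (𝔢 j)
    untranslate-edge (same s) = edge (≡[mod]⇒≈ᵉ (untranslate (SameVertex⇒≡[mod] s)))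

    translate-edge : ∀ {j} n → n · edge (𝔢 j) ≈ˢ edge (n ·𝔢 j)
    translate-edge n = edge (≡[mod]⇒≈ᵉ (≡[mod]-refl (Z.+-identityʳ n)))

    translate-vertex : ∀ {j} n → n · vertex (𝔳 j) ≈ˢ vertex (n ·𝔳 j)
    translate-vertex n = vertex (≡[mod]⇒≈ᵛ (≡[mod]-refl (Z.+-identityʳ n)))

    ·ᵛ-cancel : ∀ {g n n′ j y} → n′ Z.≈ g + n → g ·ᵛ y ≈ᵛ n′ ·𝔳 j → y ≈ᵛ n ·𝔳 j
    ·ᵛ-cancel {g} {n} {n′} {j} {m ·𝔳 i} e (same s) = ≡[mod]⇒≈ᵛ (≡[mod]-trans (≡[mod]-refl (Z.sym (cancel m)))
      (≡[mod]-trans (≡[mod]-+ (≡[mod]-refl (Z.refl {Z.- g})) (≡[mod]-trans (SameVertex⇒≡[mod] s) (≡[mod]-refl e)))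
        (≡[mod]-refl (cancel n))))
      where
      cancel : ∀ m → (Z.- g) + (g + m) Z.≈ m
      cancel = RingIdentities.-g+g+m≈m ℤₚ g

    ·ᵛ-apply : ∀ {g n n′ j y} → n′ Z.≈ g + n → y ≈ᵛ n ·𝔳 j → g ·ᵛ y ≈ᵛ n′ ·𝔳 j
    ·ᵛ-apply {g} e (same s) = ≡[mod]⇒≈ᵛ (≡[mod]-trans (≡[mod]-+ (≡[mod]-refl (Z.refl {g})) (SameVertex⇒≡[mod] s)) (≡[mod]-refl (Z.sym e)))

    -- The outer vertex determines the edge; by its level it cannot be the inner vertex of the other
    -- edge.
    ≈ᵉ⇒≡[mod] : ∀ {i m n} → m ·𝔢 i ≈ᵉ n ·𝔢 i → m ≡ n [mod-p^ i ]
    ≈ᵉ⇒≡[mod] {i} {m} (same e) = outer-residue (Equivalence.to (e (m ·𝔳 i)) (outer ≈ᵛ-refl)) ≡.refl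
      where
      outer-residue : ∀ {i j m n} → m ·𝔳 i ∈ n ·𝔢 j → i ≡ j → m ≡ n [mod-p^ j ]
      outer-residue (outer q) _ = ≈ᵛ⇒≡[mod] q
      outer-residue {i} (inner q) e = ⊥-elim (ℕₚ.1+n≢n (≡.sym (≡.trans (≡.sym (≈ᵛ⇒level q)) e)))

    ·-assoc : ∀ {g h σ τ υ} → h · σ ≈ˢ τ → g · τ ≈ˢ υ → (g + h) · σ ≈ˢ υ
    ·-assoc {g} {h} {vertex (m ·𝔳 i)} (vertex (same s)) (vertex (same s′)) = vertex (≡[mod]⇒≈ᵛ
      (≡[mod]-trans (≡[mod]-refl (Z.+-assoc g h m)) (≡[mod]-trans (≡[mod]-+ (≡[mod]-refl (Z.refl {g})) (SameVertex⇒≡[mod] s)) (SameVertex⇒≡[mod] s′))))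
    ·-assoc {g} {h} {edge (m ·𝔢 i)} (edge (same s)) (edge (same s′)) = edge (≡[mod]⇒≈ᵉ
      (≡[mod]-trans (≡[mod]-refl (Z.+-assoc g h m)) (≡[mod]-trans (≡[mod]-+ (≡[mod]-refl (Z.refl {g})) (≈ᵉ⇒≡[mod] (same s))) (≈ᵉ⇒≡[mod] (same s′)))))

    pow-1 : ∀ j → pow j 1# + (Z.- nat (p ℕ.^ j)) Z.≈ Z.- nat 0
    pow-1 j = RingIdentities.x-y≈-z ℤₚ (pow j 1#) (nat (p ℕ.^ j)) (nat 0)
      (Z.trans (Z.*-identityʳ (p# ^ j)) (Z.sym (nat-p^ j))) nat-0

    nat-p^≡0 : ∀ j → nat (p ℕ.^ j) ≡ nat 0 [mod-p^ j ]
    nat-p^≡0 j = ≡[mod]-trans (≡[mod]-refl (Z.trans (nat-p^ j) (Z.sym (Z.*-identityʳ (p# ^ j)))))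
      (≡[mod]-trans (pow≡0 j 1#) (≡[mod]-refl (Z.sym nat-0)))

    nat-digit : ∀ n k j → nat (n ℕ.+ k ℕ.* p ℕ.^ j) Z.≈ nat n + pow j (nat k)
    nat-digit n k j = Z.trans (nat-+ n (k ℕ.* p ℕ.^ j))
      (Z.+-congˡ {nat n} {nat (k ℕ.* p ℕ.^ j)} {pow j (nat k)} (nat-*p^ k j))

    n≈g+[-g+n] : ∀ g n → n Z.≈ g + ((Z.- g) + n)
    n≈g+[-g+n] g n = Z.sym (RingIdentities.g+-g+n≈n ℤₚ g n)

    [n′-n]-n′≈-n : ∀ n n′ → (n + (Z.- n′)) + (Z.- n) Z.≈ Z.- n′
    [n′-n]-n′≈-n n n′ = RingIdentities.n-n′-n≈-n′ ℤₚ n n′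

    fixes-difference : ∀ {j n n′} → n ≡ n′ [mod-p^ j ] → (n + (Z.- n′)) · vertex (𝔳 j) ≈ˢ vertex (𝔳 j)
    fixes-difference {n = n} {n′} e = fixes-vertex (≡[mod]-trans (≡[mod]-+ e (≡[mod]-refl (Z.refl {Z.- n′}))) (≡[mod]-refl (Z.-‿inverseʳ n′)))

-- Action and transition maps at the standard vertices.

module Equivariance {p : ℕ} .{{_ : ℕ.NonZero p}} {A : CommutativeRing r ℓr} (V : CoefficientSystem p A ℓ) where
  open HalfTree p
  open CoefficientSystem V
  open PAdicProperties p
  open HalfTreeProperties p
  private
    module Z = CommutativeRing (PAdicNumbers.ℤₚ p)
    module V {σ} = LeftModule (𝒱 σ)

  -- The edge 𝔢ⱼ leads from 𝔳ⱼ towards the root and 𝔢ⱼ₊₁ away from it. At level 1 over k, the image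
  -- of `out j` is the space of invariants of 𝔑₀^(pʲ) and that of `inn j` a generating subspace.
  out : ∀ j → ⟨ 𝒱 (edge (𝔢 j)) ⟩ → ⟨ 𝒱 (vertex (𝔳 j)) ⟩
  out j = res {𝔳 j} {𝔢 j} (outer ≈ᵛ-refl)

  inn : ∀ j → ⟨ 𝒱 (edge (𝔢 (suc j))) ⟩ → ⟨ 𝒱 (vertex (𝔳 j)) ⟩
  inn j = res {𝔳 j} {𝔢 (suc j)} (inner ≈ᵛ-refl)

  rotate : ∀ j → 𝔑₀ → ⟨ 𝒱 (vertex (𝔳 j)) ⟩ → ⟨ 𝒱 (vertex (𝔳 j)) ⟩
  rotate j z = act (pow j z) (pow-fixes-𝔳 j z)

  rotate-linear : ∀ j z → IsLinear (𝒱 (vertex (𝔳 j))) (𝒱 (vertex (𝔳 j))) (rotate j z)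
  rotate-linear j z = act-linear (pow j z) (pow-fixes-𝔳 j z)

  abstract
    rotate-0 : ∀ j x → rotate j (nat 0) x ≈ᴹ x
    rotate-0 j x = V.≈ᴹ-trans (act-cong {pow j (nat 0)} {0#} (pow-0 j) (pow-fixes-𝔳 j (nat 0)) (0· ≈ᵛ-refl) x) (act-id (0· ≈ᵛ-refl) x)

    rotate-suc : ∀ j k x → rotate j 1# (rotate j (nat k) x) ≈ᴹ rotate j (nat (suc k)) x
    rotate-suc j k x = V.≈ᴹ-trans
      (act-∘ {pow j 1#} {pow j (nat k)} (pow-fixes-𝔳 j (nat k)) (pow-fixes-𝔳 j 1#) q x)
      (act-cong {pow j 1# + pow j (nat k)} {pow j (nat (suc k))} (pow-suc j k) q (pow-fixes-𝔳 j (nat (suc k))) x)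
      where
      q : (pow j 1# + pow j (nat k)) · vertex (𝔳 j) ≈ˢ vertex (𝔳 j)
      q = fixes-vertex (≡[mod]-trans (≡[mod]-refl (pow-suc j k)) (pow≡0 j (nat (suc k))))

    act-commute : ∀ g h {σ} (q : g · σ ≈ˢ σ) (q′ : h · σ ≈ˢ σ) (q″ : (g + h) · σ ≈ˢ σ) (q‴ : (h + g) · σ ≈ˢ σ) x →
      act g q (act h q′ x) ≈ᴹ act h q′ (act g q x)
    act-commute g h q q′ q″ q‴ x = V.≈ᴹ-trans (act-∘ {g} {h} q′ q q″ x)
      (V.≈ᴹ-trans (act-cong {g + h} {h + g} (Z.+-comm g h) q″ q‴ x) (V.≈ᴹ-sym (act-∘ {h} {g} q q′ q‴ x)))

-- Level 1 over the residue field

-- The ring of V is left to unification: spelling 𝔬/πᵐ in any other way than StrictlyOfLevel1Over-k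
-- does makes Agda unfold coefficient systems in order to compare them.
module LevelOne {p : ℕ} (p-prime : Prime p) {K : FiniteExtension p c ℓ₁ ℓ₂} (O : RingOfIntegers p K r ℓr)
  {π : RingOfIntegers.Carrier O} (π-uniformizer : RingOfIntegers.IsUniformizer O π) (m : ℕ)
  (V : CoefficientSystem p _ ℓ)
  (V-level1 : StrictlyOfLevel1Over-k p (RingOfIntegers.𝔬 O) π m V) where

  private instance
    p≢0 : ℕ.NonZero p
    p≢0 = prime⇒nonZero p-prime

  open HalfTree p
  open CoefficientSystem V
  open StrictlyOfLevel1Over-k V-level1
  open PAdicProperties p
  open HalfTreeProperties p
  open Equivariance V
  open ResidueField O π-uniformizer
  private
    module Z = CommutativeRing (PAdicNumbers.ℤₚ p)
    module k = CommutativeRing k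

  reduced : Simplex → LeftModule k.ring ℓ ℓ
  reduced σ = reduction (RingOfIntegers.𝔬 O) π (Exp._^_ (CommutativeRing.semiring (RingOfIntegers.𝔬 O)) π m) (𝒱 σ) (killed {σ})

  private
    module V {σ} = LeftModule (reduced σ)
    module P {σ} = ModuleProperties {R = k} (reduced σ)
    module act g {σ τ} (q : g · σ ≈ˢ τ) = LinearMap {M = reduced σ} {N = reduced τ} (act-linear g q)
    module res {y τ} (y∈τ : y ∈ τ) = LinearMap {M = reduced (edge τ)} {N = reduced (vertex y)} (res-linear y∈τ)
    module g j = NilpotentOperator {K = k} (reduced (vertex (𝔳 j))) (rotate-linear j 1#)
    module U j = UnipotentOperator {K = k} (reduced (vertex (𝔳 j))) (rotate-linear j 1#)
    module t j = LinearMap {M = reduced (vertex (𝔳 j))} {N = reduced (vertex (𝔳 j))} (U.t-linear j)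

  t : ∀ j → ⟨ 𝒱 (vertex (𝔳 j)) ⟩ → ⟨ 𝒱 (vertex (𝔳 j)) ⟩
  t j = U.t j

  abstract
    g^≈rotate : ∀ j k x → g.t^ j k x ≈ᴹ rotate j (nat k) x
    g^≈rotate j zero    x = V.≈ᴹ-sym (rotate-0 j x)
    g^≈rotate j (suc k) x = V.≈ᴹ-trans (act.⟦⟧-cong (pow j 1#) (pow-fixes-𝔳 j 1#) (g^≈rotate j k x)) (rotate-suc j k x)

    act-trivial-out : ∀ j x (q : x · vertex (𝔳 j) ≈ˢ vertex (𝔳 j)) → x ≡ 0# [mod-p^ j ] →
      ∀ e → act x q (out j e) ≈ᴹ out j e
    act-trivial-out j x q x≡0 e = let z , x≈ = ≡0⇒pow x≡0 in
      V.≈ᴹ-trans (act-cong {x} {pow j z} x≈ q (pow-fixes-𝔳 j z) (out j e))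
        (Equivalence.to (fixed j (out j e)) (e , V.≈ᴹ-refl) z)

    -- Invariance in 𝒱(𝔳ⱼ) is carried back to the edge by injectivity of the transition map.
    act-trivial-edge : ∀ j x (q : x · edge (𝔢 j) ≈ˢ edge (𝔢 j)) → x ≡ 0# [mod-p^ j ] → ∀ e → act x q e ≈ᴹ e
    act-trivial-edge j x q x≡0 e = injective {𝔳 j} {𝔢 j} (outer ≈ᵛ-refl)
      (V.≈ᴹ-trans (V.≈ᴹ-sym (act-res x {𝔳 j} {𝔳 j} {𝔢 j} {𝔢 j} (outer ≈ᵛ-refl) (outer ≈ᵛ-refl) (fixes-vertex x≡0) q e))
        (act-trivial-out j x (fixes-vertex x≡0) x≡0 e))

    act-trivial-inn : ∀ j x (q : x · vertex (𝔳 j) ≈ˢ vertex (𝔳 j)) → x ≡ 0# [mod-p^ suc j ] →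
      ∀ e → act x q (inn j e) ≈ᴹ inn j e
    act-trivial-inn j x q x≡0 e = V.≈ᴹ-trans
      (act-res x {𝔳 j} {𝔳 j} {𝔢 (suc j)} {𝔢 (suc j)} (inner ≈ᵛ-refl) (inner ≈ᵛ-refl) q (fixes-edge x≡0) e)
      (res.⟦⟧-cong (inner ≈ᵛ-refl) (act-trivial-edge (suc j) x (fixes-edge x≡0) x≡0 e))

    -- It suffices to check the spanning translates of 𝒱(𝔢ⱼ₊₁), past which x commutes. As a result
    -- 𝔑₀^(pʲ) acts on 𝒱(𝔳ⱼ) through its quotient of order p.
    act-trivial : ∀ j x (q : x · vertex (𝔳 j) ≈ˢ vertex (𝔳 j)) → x ≡ 0# [mod-p^ suc j ] → ∀ u → act x q u ≈ᴹ u
    act-trivial j x q x≡0 u = let n , z , e , u≈ = generated j u in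
      V.≈ᴹ-trans (act.⟦⟧-cong x q u≈) (V.≈ᴹ-trans (act.sum-homo x q (λ i → rotate j (z i) (inn j (e i))))
        (V.≈ᴹ-trans (P.sum-cong-≋ (λ i → on-generators (z i) (e i))) (V.≈ᴹ-sym u≈)))
      where
      x≡0′ : x ≡ 0# [mod-p^ j ]
      x≡0′ = ≡[mod-p^suc]⇒≡[mod-p^] x≡0
      on-generators : ∀ z e → act x q (rotate j z (inn j e)) ≈ᴹ rotate j z (inn j e)
      on-generators z e = V.≈ᴹ-trans
        (act-commute x (pow j z) q (pow-fixes-𝔳 j z)
          (fixes-vertex (≡[mod]-trans (≡[mod]-+ x≡0′ (pow≡0 j z)) (≡[mod]-refl (Z.+-identityʳ 0#))))
          (fixes-vertex (≡[mod]-trans (≡[mod]-+ (pow≡0 j z) x≡0′) (≡[mod]-refl (Z.+-identityʳ 0#)))) (inn j e))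
        (act.⟦⟧-cong (pow j z) (pow-fixes-𝔳 j z) (act-trivial-inn j x q x≡0 e))

    rotate≈g^ : ∀ j z → ∃[ k ] (∀ u → rotate j z u ≈ᴹ g.t^ j k u)
    rotate≈g^ j z = let k , z′ , e = pow-digit j z in k , λ u →
      V.≈ᴹ-trans (V.≈ᴹ-sym (V.≈ᴹ-trans
        (act-∘ {pow j (nat k)} {pow (suc j) z′} (q z′) (pow-fixes-𝔳 j (nat k)) (q′ k z′ e) u)
        (act-cong {pow j (nat k) + pow (suc j) z′} {pow j z} e (q′ k z′ e) (pow-fixes-𝔳 j z) u)))
      (V.≈ᴹ-trans (act.⟦⟧-cong (pow j (nat k)) (pow-fixes-𝔳 j (nat k)) (act-trivial j (pow (suc j) z′) (q z′) (pow≡0 (suc j) z′) u))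
        (V.≈ᴹ-sym (g^≈rotate j k u)))
      where
      q : ∀ z′ → pow (suc j) z′ · vertex (𝔳 j) ≈ˢ vertex (𝔳 j)
      q z′ = fixes-vertex (≡[mod-p^suc]⇒≡[mod-p^] (pow≡0 (suc j) z′))
      q′ : ∀ k z′ → pow j (nat k) + pow (suc j) z′ Z.≈ pow j z → (pow j (nat k) + pow (suc j) z′) · vertex (𝔳 j) ≈ˢ vertex (𝔳 j)
      q′ k z′ e = fixes-vertex (≡[mod]-trans (≡[mod]-refl e) (pow≡0 j z))

    g^p≈1 : ∀ j u → g.t^ j p u ≈ᴹ u
    g^p≈1 j u = V.≈ᴹ-trans (g^≈rotate j p u) (V.≈ᴹ-trans
      (act-cong {pow j (nat p)} {pow (suc j) 1#} (pow-p j) (pow-fixes-𝔳 j (nat p)) q u)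
      (act-trivial j (pow (suc j) 1#) q (pow≡0 (suc j) 1#) u))
      where
      q : pow (suc j) 1# · vertex (𝔳 j) ≈ˢ vertex (𝔳 j)
      q = fixes-vertex (≡[mod-p^suc]⇒≡[mod-p^] (pow≡0 (suc j) 1#))

    rotate≈1+t : ∀ j z u → ∃[ w ] rotate j z u ≈ᴹ u V.+ᴹ t j w
    rotate≈1+t j z u = let k , e = rotate≈g^ j z
                           w , f = U.g^≈1+t j k u
                       in w , V.≈ᴹ-trans (e u) f

    -- Every rotation acts as a power of g, so a vector fixed by g is fixed by all of 𝔑₀^(pʲ).
    fixed⇒out : ∀ j {u} → rotate j 1# u ≈ᴹ u → ∃[ e ] out j e ≈ᴹ u
    fixed⇒out j {u} gu≈u = Equivalence.from (fixed j u) (λ z → let k , e = rotate≈g^ j z in V.≈ᴹ-trans (e u) (g^-fixed k))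
      where
      g^-fixed : ∀ k → g.t^ j k u ≈ᴹ u
      g^-fixed zero    = V.≈ᴹ-refl
      g^-fixed (suc k) = V.≈ᴹ-trans (act.⟦⟧-cong (pow j 1#) (pow-fixes-𝔳 j 1#) (g^-fixed k)) gu≈u

    -- Rotations are 1 modulo the image of t, so generation in condition (b) becomes 𝒱(𝔳ⱼ) = 𝒱(𝔢ⱼ₊₁)
    -- + t 𝒱(𝔳ⱼ).
    inn+t : ∀ j u → ∃[ e ] ∃[ w ] u ≈ᴹ inn j e V.+ᴹ t j w
    inn+t j u = let n , z , e , u≈ = generated j u
                    e′ , w , f = sum-split n (λ i → rotate j (z i) (inn j (e i))) (λ i → let w , f = rotate≈1+t j (z i) (inn j (e i)) in e i , w , f)
                in e′ , w , V.≈ᴹ-trans u≈ f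
      where
      sum-split : ∀ n (v : Vector ⟨ 𝒱 (vertex (𝔳 j)) ⟩ n) → (∀ i → ∃[ e ] ∃[ w ] v i ≈ᴹ inn j e V.+ᴹ t j w) →
        ∃[ e ] ∃[ w ] P.sum v ≈ᴹ inn j e V.+ᴹ t j w
      sum-split zero    v split = V.0ᴹ , V.0ᴹ ,
        V.≈ᴹ-sym (V.≈ᴹ-trans (V.+ᴹ-cong (res.0ᴹ-homo (inner ≈ᵛ-refl)) (t.0ᴹ-homo j)) (V.+ᴹ-identityʳ V.0ᴹ))
      sum-split (suc n) v split =
        let e , w , f = split Fin.zero
            e′ , w′ , f′ = sum-split n (λ i → v (Fin.suc i)) (λ i → split (Fin.suc i))
        in e V.+ᴹ e′ , w V.+ᴹ w′ , V.≈ᴹ-trans (V.+ᴹ-cong f f′) (V.≈ᴹ-trans (P.+-interchange _ _ _ _)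
             (V.+ᴹ-cong (V.≈ᴹ-sym (res.+ᴹ-homo (inner ≈ᵛ-refl) e e′)) (V.≈ᴹ-sym (t.+ᴹ-homo j w w′))))

    -- Here the constant dimension of condition (c) enters: 𝒱(𝔢ⱼ₊₁) generates, 𝒱(𝔢ⱼ) lies in ker t,
    -- and both have dimension d. The exponent of nilpotency is p.
    inn-meets-t : ∀ j e w → inn j e ≈ᴹ t j w → e ≈ᴹ V.0ᴹ
    inn-meets-t j = generators-meet-image {K = k} discrete 1≉0 (reduced (vertex (𝔳 j)))
      (reduced (edge (𝔢 (suc j)))) (reduced (edge (𝔢 j))) (U.t-linear j)
      (res-linear (inner ≈ᵛ-refl)) (res-linear (outer ≈ᵛ-refl)) {p}
      (λ u → U.t^p≈0 j p-prime (p·≈0 (reduced (vertex (𝔳 j)))) u (g^p≈1 j u))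
      (λ e → injective {𝔳 j} {𝔢 j} (outer ≈ᵛ-refl) (V.≈ᴹ-trans e (V.≈ᴹ-sym (res.0ᴹ-homo (outer ≈ᵛ-refl)))))
      (λ e → U.t-fixed j (act-trivial-out j (pow j 1#) (pow-fixes-𝔳 j 1#) (pow≡0 j 1#) e))
      (inn+t j) (proj₂ dimension (suc j)) (proj₂ dimension j)

  -- a and b are the components, translated to 𝔳ⱼ and 𝔢ⱼ, of a chain h and of a bounding chain of h - 1•h.
  -- The totals of b vanish level by level, since inn meets the image of t = g - 1 trivially.
  module _ (a : ∀ j → ℕ → ⟨ 𝒱 (vertex (𝔳 j)) ⟩) (b : ∀ j → ℕ → ⟨ 𝒱 (edge (𝔢 j)) ⟩)
    (a-periodic : ∀ j → rotate j 1# (a j (p ℕ.^ j)) ≈ᴹ a j 0)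
    (b-0 : ∀ n → b 0 n ≈ᴹ V.0ᴹ)
    (difference : ∀ j n → a j n ≈ᴹ a j (suc n) V.+ᴹ (out j (b j (suc n)) V.+ᴹ
      P.∑< p (λ k → rotate j (nat k) (inn j (b (suc j) (suc n ℕ.+ k ℕ.* p ℕ.^ j)))))) where

    private
      -- The shift to `suc n` matches `difference`; n + 1 still runs once through the residues
      -- modulo pʲ.
      total : ∀ j → ⟨ 𝒱 (edge (𝔢 j)) ⟩
      total j = P.∑< (p ℕ.^ j) (λ n → b j (suc n))

      inner-part : ∀ j → ℕ → ⟨ 𝒱 (vertex (𝔳 j)) ⟩
      inner-part j n = P.∑< p (λ k → rotate j (nat k) (inn j (b (suc j) (suc n ℕ.+ k ℕ.* p ℕ.^ j))))

    abstract
      out-total : ∀ j → out j (total j) ≈ᴹ P.∑< (p ℕ.^ j) (λ n → out j (b j (suc n)))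
      out-total j = res.sum-homo (outer ≈ᵛ-refl) {p ℕ.^ j} (λ i → b j (suc (Fin.toℕ i)))

      a-telescope : ∀ j → a j 0 ≈ᴹ a j (p ℕ.^ j) V.+ᴹ (out j (total j) V.+ᴹ P.∑< (p ℕ.^ j) (inner-part j))
      a-telescope j = V.≈ᴹ-trans (P.telescope N (a j) _ (difference j))
        (V.+ᴹ-congˡ (V.≈ᴹ-trans (P.∑-distrib-+ {n = N} (λ i → out j (b j (suc (Fin.toℕ i)))) (λ i → inner-part j (Fin.toℕ i)))
          (V.+ᴹ-congʳ (V.≈ᴹ-sym (out-total j)))))
        where
        N : ℕ
        N = p ℕ.^ j

      ∑<-1+t : ∀ j n (x y : ℕ → ⟨ 𝒱 (vertex (𝔳 j)) ⟩) → (∀ k → ∃[ w ] y k ≈ᴹ x k V.+ᴹ t j w) →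
        ∃[ w ] P.∑< n y ≈ᴹ P.∑< n x V.+ᴹ t j w
      ∑<-1+t j zero    x y e = V.0ᴹ , V.≈ᴹ-sym (V.≈ᴹ-trans (V.+ᴹ-identityˡ _) (t.0ᴹ-homo j))
      ∑<-1+t j (suc n) x y e =
        let w , f = e 0
            w′ , f′ = ∑<-1+t j n (λ k → x (suc k)) (λ k → y (suc k)) (λ k → e (suc k))
        in w V.+ᴹ w′ , V.≈ᴹ-trans (V.+ᴹ-cong f f′)
             (V.≈ᴹ-trans (P.+-interchange _ _ _ _) (V.+ᴹ-congˡ (V.≈ᴹ-sym (t.+ᴹ-homo j w w′))))

      -- Modulo t the rotations disappear, and n + k pʲ with n < pʲ and k < p runs through the
      -- indices below pʲ⁺¹.
      inner-total : ∀ j → ∃[ w ] P.∑< (p ℕ.^ j) (inner-part j) ≈ᴹ inn j (total (suc j)) V.+ᴹ t j w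
      inner-total j =
        let w , e = ∑<-1+t j N (λ n → P.∑< p (λ k → inn j (f (n ℕ.+ k ℕ.* N)))) (inner-part j)
              (λ n → ∑<-1+t j p _ _ (λ k → rotate≈1+t j (nat k) (inn j (f (n ℕ.+ k ℕ.* N)))))
        in w , V.≈ᴹ-trans e (V.+ᴹ-congʳ (V.≈ᴹ-sym (V.≈ᴹ-trans
             (res.sum-homo (inner ≈ᵛ-refl) {p ℕ.* N} (λ i → f (Fin.toℕ i)))
             (V.≈ᴹ-trans (P.∑<-blocks p N (λ n → inn j (f n)))
               (P.∑<-comm p N (λ k n → inn j (f (n ℕ.+ k ℕ.* N))))))))
        where
        N : ℕ
        N = p ℕ.^ j
        f : ℕ → ⟨ 𝒱 (edge (𝔢 (suc j))) ⟩
        f n = b (suc j) (suc n)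

      -- If the total of level j vanishes, then g = 1 + t and the telescoped sum give t aₙ = inn
      -- (total (j + 1)) + t w, where aₙ is the component at pʲ. So inn (total (j + 1)) is in the
      -- image of t.
      total≈0 : ∀ j → total j ≈ᴹ V.0ᴹ
      total≈0 zero    = P.∑<-zero (p ℕ.^ 0) (λ n → b-0 (suc n))
      total≈0 (suc j) =
        let w , e = inner-total j
            aₙ = a j (p ℕ.^ j)
        in inn-meets-t j (total (suc j)) (aₙ V.+ᴹ (k.- k.1#) V.*ₗ w) (V.≈ᴹ-trans
          (P.subtract (t-aₙ w e))
          (V.≈ᴹ-sym (V.≈ᴹ-trans (t.+ᴹ-homo j _ _) (V.+ᴹ-congˡ (t.*ₗ-homo j _ w)))))
        where
        t-aₙ : ∀ w → P.∑< (p ℕ.^ j) (inner-part j) ≈ᴹ inn j (total (suc j)) V.+ᴹ t j w →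
          t j (a j (p ℕ.^ j)) ≈ᴹ inn j (total (suc j)) V.+ᴹ t j w
        t-aₙ w e = P.+ᴹ-cancelˡ (a j (p ℕ.^ j)) (V.≈ᴹ-trans (V.≈ᴹ-sym (U.g≈1+t j _))
          (V.≈ᴹ-trans (a-periodic j) (V.≈ᴹ-trans (a-telescope j) (V.+ᴹ-congˡ
            (V.≈ᴹ-trans (V.+ᴹ-congʳ (V.≈ᴹ-trans (res.⟦⟧-cong (outer ≈ᵛ-refl) (total≈0 j)) (res.0ᴹ-homo (outer ≈ᵛ-refl))))
              (V.≈ᴹ-trans (V.+ᴹ-identityˡ _) e))))))

      inner≈0 : ∀ L → (∀ n → b (suc L) n ≈ᴹ V.0ᴹ) → ∀ n → inner-part L n ≈ᴹ V.0ᴹ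
      inner≈0 L b≈0 n = P.∑<-zero p (λ k → V.≈ᴹ-trans (act.⟦⟧-cong (pow L (nat k)) (pow-fixes-𝔳 L (nat k))
        (V.≈ᴹ-trans (res.⟦⟧-cong (inner ≈ᵛ-refl) (b≈0 (suc n ℕ.+ k ℕ.* p ℕ.^ L))) (res.0ᴹ-homo (inner ≈ᵛ-refl))))
        (act.0ᴹ-homo (pow L (nat k)) (pow-fixes-𝔳 L (nat k))))

      -- Without contributions from level L + 1 the telescoped sum gives a(0) = a(pᴸ), so a(0) is
      -- fixed by g. Each further component differs from the preceding one by the image of an edge
      -- element.
      top-level-fixed : ∀ L → (∀ n → b (suc L) n ≈ᴹ V.0ᴹ) → ∀ n → ∃[ e ] out L e ≈ᴹ a L n
      top-level-fixed L b≈0 zero = fixed⇒out L (V.≈ᴹ-trans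
        (act.⟦⟧-cong (pow L 1#) (pow-fixes-𝔳 L 1#) a₀≈aₙ) (a-periodic L))
        where
        a₀≈aₙ : a L 0 ≈ᴹ a L (p ℕ.^ L)
        a₀≈aₙ = V.≈ᴹ-trans (a-telescope L) (V.≈ᴹ-trans (V.+ᴹ-congˡ (V.≈ᴹ-trans (V.+ᴹ-cong
            (V.≈ᴹ-trans (res.⟦⟧-cong (outer ≈ᵛ-refl) (total≈0 L)) (res.0ᴹ-homo (outer ≈ᵛ-refl)))
            (P.∑<-zero (p ℕ.^ L) (inner≈0 L b≈0))) (V.+ᴹ-identityˡ V.0ᴹ))) (V.+ᴹ-identityʳ _))
      top-level-fixed L b≈0 (suc n) =
        let e , f = top-level-fixed L b≈0 n in
        e V.+ᴹ (k.- k.1#) V.*ₗ b L (suc n) , V.≈ᴹ-trans (res.+ᴹ-homo (outer ≈ᵛ-refl) _ _)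
          (V.≈ᴹ-trans (V.+ᴹ-congˡ (res.*ₗ-homo (outer ≈ᵛ-refl) _ _)) (V.≈ᴹ-sym (P.subtract (V.≈ᴹ-trans f
            (V.≈ᴹ-trans (difference L n) (V.+ᴹ-congˡ (V.≈ᴹ-trans (V.+ᴹ-congˡ (inner≈0 L b≈0 n)) (V.+ᴹ-identityʳ _))))))))

-- Components of chains

module Components {p : ℕ} .{{_ : ℕ.NonZero p}} {A : CommutativeRing r ℓr} (V : CoefficientSystem p A ℓ) where
  open HalfTree p
  open CoefficientSystem V
  open PAdicProperties p
  open HalfTreeProperties p
  open Equivariance V
  private
    module Z = CommutativeRing (PAdicNumbers.ℤₚ p)
    module A = CommutativeRing A
    module V {σ} = LeftModule (𝒱 σ)
    module P {σ} = ModuleProperties {R = A} (𝒱 σ)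
    module act g {σ τ} (q : g · σ ≈ˢ τ) = LinearMap {M = 𝒱 σ} {N = 𝒱 τ} (act-linear g q)
    module res {y τ} (y∈τ : y ∈ τ) = LinearMap {M = 𝒱 (edge τ)} {N = 𝒱 (vertex y)} (res-linear y∈τ)
    module ⊕ = DirectSum _≈ᵛ_ (λ y → 𝒱 (vertex y)) (λ q → act 0# (0· q)) (λ q → act-linear 0# (0· q))
  open ⊕ public using (FormalSum; _≋_; ++-cong; ++-comm; cong; transport; add; zero)
    renaming (refl to ≋-refl; sym to ≋-sym; trans to ≋-trans)

  select : ∀ {a} {Q : Set a} {σ} → Dec Q → (Q → ⟨ 𝒱 σ ⟩) → ⟨ 𝒱 σ ⟩
  select (yes q) f = f q
  select (no _)  f = V.0ᴹ

  -- The value at n ·𝔳 j, translated back to 𝔳 j, of a summand at y.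
  term : ∀ j → 𝔑₀ → (y : Vertex) → ⟨ 𝒱 (vertex y) ⟩ → ⟨ 𝒱 (vertex (𝔳 j)) ⟩
  term j n y x = select (y ≈ᵛ? n ·𝔳 j) (λ q → act (Z.- n) (untranslate-vertex q) x)

  -- Whatever n is, the value lies in the one module 𝒱(𝔳ⱼ), so the components of a level can be
  -- added. The price is a rotation when n changes within its class modulo pʲ.
  component : ∀ j → 𝔑₀ → FormalSum → ⟨ 𝒱 (vertex (𝔳 j)) ⟩
  component j n []            = V.0ᴹ
  component j n ((y , x) ∷ h) = term j n y x V.+ᴹ component j n h

  -- The edge m 𝔢ᵢ₊₁ is recognised by its outer vertex, where equality is decidable.
  edge-term : ∀ j → 𝔑₀ → (τ : InnerEdge) → ⟨ 𝒱 (edge (toEdge τ)) ⟩ → ⟨ 𝒱 (edge (𝔢 j)) ⟩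
  edge-term j n (m ·𝔢⁺ i) x = select (m ·𝔳 suc i ≈ᵛ? n ·𝔳 j) (λ q → act (Z.- n) (untranslate-edge q) x)

  edge-component : ∀ j → 𝔑₀ → Chain₁ p V → ⟨ 𝒱 (edge (𝔢 j)) ⟩
  edge-component j n []            = V.0ᴹ
  edge-component j n ((τ , x) ∷ d) = edge-term j n τ x V.+ᴹ edge-component j n d

  abstract
    term-yes : ∀ j n y x (q : y ≈ᵛ n ·𝔳 j) (q′ : (Z.- n) · vertex y ≈ˢ vertex (𝔳 j)) → term j n y x ≈ᴹ act (Z.- n) q′ x
    term-yes j n y x q q′ with y ≈ᵛ? n ·𝔳 j
    ... | yes _ = act-cong {Z.- n} {Z.- n} Z.refl _ q′ x
    ... | no ¬q = ⊥-elim (¬q q)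

    term-no : ∀ j n y x → ¬ y ≈ᵛ n ·𝔳 j → term j n y x ≈ᴹ V.0ᴹ
    term-no j n y x ¬q with y ≈ᵛ? n ·𝔳 j
    ... | yes q = ⊥-elim (¬q q)
    ... | no _  = V.≈ᴹ-refl

    edge-term-yes : ∀ j n m i x (q : m ·𝔳 suc i ≈ᵛ n ·𝔳 j) (q′ : (Z.- n) · edge (m ·𝔢 suc i) ≈ˢ edge (𝔢 j)) →
      edge-term j n (m ·𝔢⁺ i) x ≈ᴹ act (Z.- n) q′ x
    edge-term-yes j n m i x q q′ with m ·𝔳 suc i ≈ᵛ? n ·𝔳 j
    ... | yes _ = act-cong {Z.- n} {Z.- n} Z.refl _ q′ x
    ... | no ¬q = ⊥-elim (¬q q)

    edge-term-no : ∀ j n m i x → ¬ m ·𝔳 suc i ≈ᵛ n ·𝔳 j → edge-term j n (m ·𝔢⁺ i) x ≈ᴹ V.0ᴹ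
    edge-term-no j n m i x ¬q with m ·𝔳 suc i ≈ᵛ? n ·𝔳 j
    ... | yes q = ⊥-elim (¬q q)
    ... | no _  = V.≈ᴹ-refl

    module _ (j : ℕ) (n : 𝔑₀) (y : Vertex) where
      term-cong : ∀ {x x′} → x ≈ᴹ x′ → term j n y x ≈ᴹ term j n y x′
      term-cong e with y ≈ᵛ? n ·𝔳 j
      ... | yes q = act.⟦⟧-cong (Z.- n) (untranslate-vertex q) e
      ... | no _  = V.≈ᴹ-refl

      term-+ : ∀ x x′ → term j n y (x V.+ᴹ x′) ≈ᴹ term j n y x V.+ᴹ term j n y x′
      term-+ x x′ with y ≈ᵛ? n ·𝔳 j
      ... | yes q = act.+ᴹ-homo (Z.- n) (untranslate-vertex q) x x′
      ... | no _  = V.≈ᴹ-sym (V.+ᴹ-identityˡ V.0ᴹ)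

      term-0 : term j n y V.0ᴹ ≈ᴹ V.0ᴹ
      term-0 with y ≈ᵛ? n ·𝔳 j
      ... | yes q = act.0ᴹ-homo (Z.- n) (untranslate-vertex q)
      ... | no _  = V.≈ᴹ-refl

    -- Covers both the transport between equal vertices (g = 0) and the action on chains.
    term-act : ∀ j g n n′ y y′ (q : g · vertex y ≈ˢ vertex y′) → (y ≈ᵛ n ·𝔳 j → y′ ≈ᵛ n′ ·𝔳 j) → (y′ ≈ᵛ n′ ·𝔳 j → y ≈ᵛ n ·𝔳 j) →
      n′ Z.≈ g + n → ∀ x → term j n′ y′ (act g q x) ≈ᴹ term j n y x
    term-act j g n n′ y y′ q to from e x with y ≈ᵛ? n ·𝔳 j
    ... | no ¬r = term-no j n′ y′ (act g q x) (λ r′ → ¬r (from r′))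
    ... | yes r = V.≈ᴹ-trans (term-yes j n′ y′ (act g q x) (to r) q′)
      (V.≈ᴹ-trans (act-∘ {Z.- n′} {g} q q′ q″ x) (act-cong {(Z.- n′) + g} {Z.- n} -n′+g≈-n q″ (untranslate-vertex r) x))
      where
      q′ : (Z.- n′) · vertex y′ ≈ˢ vertex (𝔳 j)
      q′ = untranslate-vertex (to r)
      q″ : ((Z.- n′) + g) · vertex y ≈ˢ vertex (𝔳 j)
      q″ = ·-assoc {Z.- n′} {g} q q′
      -n′+g≈-n : (Z.- n′) + g Z.≈ Z.- n
      -n′+g≈-n = RingIdentities.-n′+g≈-n (PAdicNumbers.ℤₚ p) n n′ g e

    component-++ : ∀ j n h h′ → component j n (h ++ h′) ≈ᴹ component j n h V.+ᴹ component j n h′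
    component-++ j n []            h′ = V.≈ᴹ-sym (V.+ᴹ-identityˡ _)
    component-++ j n ((y , x) ∷ h) h′ = V.≈ᴹ-trans (V.+ᴹ-congˡ (component-++ j n h h′)) (V.≈ᴹ-sym (V.+ᴹ-assoc _ _ _))

    component-cong : ∀ j n {h h′} → h ≋ h′ → component j n h ≈ᴹ component j n h′
    component-cong j n ≋-refl = V.≈ᴹ-refl
    component-cong j n (≋-sym e) = V.≈ᴹ-sym (component-cong j n e)
    component-cong j n (≋-trans e f) = V.≈ᴹ-trans (component-cong j n e) (component-cong j n f)
    component-cong j n (++-cong {xs} {ys} {us} {vs} e f) = V.≈ᴹ-trans (component-++ j n xs us)
      (V.≈ᴹ-trans (V.+ᴹ-cong (component-cong j n e) (component-cong j n f)) (V.≈ᴹ-sym (component-++ j n ys vs)))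
    component-cong j n (++-comm xs ys) = V.≈ᴹ-trans (component-++ j n xs ys)
      (V.≈ᴹ-trans (V.+ᴹ-comm _ _) (V.≈ᴹ-sym (component-++ j n ys xs)))
    component-cong j n (cong {y} e) = V.+ᴹ-congʳ (term-cong j n y e)
    component-cong j n (transport {y} {y′} q x) = V.+ᴹ-congʳ (V.≈ᴹ-sym (term-act j 0# n n y y′ (0· q)
      (≈ᵛ-trans (≈ᵛ-sym q)) (≈ᵛ-trans q) (Z.sym (Z.+-identityˡ n)) x))
    component-cong j n (add y x x′) = V.≈ᴹ-trans (V.+ᴹ-congʳ (term-+ j n y x x′)) (V.+ᴹ-assoc _ _ _)
    component-cong j n (zero y) = V.≈ᴹ-trans (V.+ᴹ-identityʳ _) (term-0 j n y)

    component-• : ∀ j g n n′ → n′ Z.≈ g + n → ∀ h → component j n′ (_•_ p V g h) ≈ᴹ component j n h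
    component-• j g n n′ e []            = V.≈ᴹ-refl
    component-• j g n n′ e ((y , x) ∷ h) = V.+ᴹ-cong
      (term-act j g n n′ y (g ·ᵛ y) (vertex ≈ᵛ-refl) (·ᵛ-apply e) (·ᵛ-cancel e) e x)
      (component-• j g n n′ e h)

    -- Translating back by n′ instead of n differs by g = n - n′, which fixes 𝔳ⱼ. For n = pʲ and n′
    -- = 0 this is the periodicity of the components.
    component-shift : ∀ j n n′ g (q : g · vertex (𝔳 j) ≈ˢ vertex (𝔳 j)) → n ≡ n′ [mod-p^ j ] → g + (Z.- n) Z.≈ Z.- n′ →
      ∀ h → component j n′ h ≈ᴹ act g q (component j n h)
    component-shift j n n′ g q n≡n′ e []            = V.≈ᴹ-sym (act.0ᴹ-homo g q)
    component-shift j n n′ g q n≡n′ e ((y , x) ∷ h) = V.≈ᴹ-trans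
      (V.+ᴹ-cong (shift-term (y ≈ᵛ? n ·𝔳 j)) (component-shift j n n′ g q n≡n′ e h))
      (V.≈ᴹ-sym (act.+ᴹ-homo g q _ _))
      where
      shift-term : Dec (y ≈ᵛ n ·𝔳 j) → term j n′ y x ≈ᴹ act g q (term j n y x)
      shift-term (no ¬r) = V.≈ᴹ-trans (term-no j n′ y x (λ r → ¬r (≈ᵛ-trans r (≡[mod]⇒≈ᵛ (≡[mod]-sym n≡n′)))))
        (V.≈ᴹ-sym (V.≈ᴹ-trans (act.⟦⟧-cong g q (term-no j n y x ¬r)) (act.0ᴹ-homo g q)))
      shift-term (yes r) = V.≈ᴹ-trans (term-yes j n′ y x r′ (untranslate-vertex r′)) (V.≈ᴹ-sym (V.≈ᴹ-trans
        (act.⟦⟧-cong g q (term-yes j n y x r (untranslate-vertex r)))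
        (V.≈ᴹ-trans (act-∘ {g} {Z.- n} (untranslate-vertex r) q q″ x)
          (act-cong {g + (Z.- n)} {Z.- n′} e q″ (untranslate-vertex r′) x))))
        where
        r′ : y ≈ᵛ n′ ·𝔳 j
        r′ = ≈ᵛ-trans r (≡[mod]⇒≈ᵛ n≡n′)
        q″ : (g + (Z.- n)) · vertex y ≈ˢ vertex (𝔳 j)
        q″ = ·-assoc {g} {Z.- n} (untranslate-vertex r) q

    edge-term-translate : ∀ i n x → edge-term (suc i) n (n ·𝔢⁺ i) (act n (translate-edge n) x) ≈ᴹ x
    edge-term-translate i n x = V.≈ᴹ-trans (edge-term-yes (suc i) n n i _ ≈ᵛ-refl q)
      (V.≈ᴹ-trans (act-∘ {Z.- n} {n} (translate-edge n) q q′ x)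
        (V.≈ᴹ-trans (act-cong {(Z.- n) + n} {0#} (Z.-‿inverseˡ n) q′ q″ x) (act-id q″ x)))
      where
      q : (Z.- n) · edge (n ·𝔢 suc i) ≈ˢ edge (𝔢 (suc i))
      q = untranslate-edge ≈ᵛ-refl
      q′ : ((Z.- n) + n) · edge (𝔢 (suc i)) ≈ˢ edge (𝔢 (suc i))
      q′ = ·-assoc {Z.- n} {n} (translate-edge n) q
      q″ : 0# · edge (𝔢 (suc i)) ≈ˢ edge (𝔢 (suc i))
      q″ = fixes-edge (≡[mod]-refl Z.refl)

    outer-term : ∀ j n m i x →
      term j n (m ·𝔳 suc i) (res {τ = m ·𝔢 suc i} (outer ≈ᵛ-refl) x) ≈ᴹ out j (edge-term j n (m ·𝔢⁺ i) x)
    outer-term j n m i x with m ·𝔳 suc i ≈ᵛ? n ·𝔳 j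
    ... | yes q = act-res (Z.- n) {m ·𝔳 suc i} {𝔳 j} {m ·𝔢 suc i} {𝔢 j}
      (outer ≈ᵛ-refl) (outer ≈ᵛ-refl) (untranslate-vertex q) (untranslate-edge q) x
    ... | no _  = V.≈ᴹ-sym (res.0ᴹ-homo (outer ≈ᵛ-refl))

    -- The edges n′ ·𝔢 (j + 1) at n ·𝔳 j are those with n′ = n + pʲ k for a digit k.
    inner-term : ∀ j n (ν : ℕ → 𝔑₀) → (∀ k → ν k Z.≈ n + pow j (nat k)) → ∀ m i x →
      term j n (m ·𝔳 i) (res {τ = m ·𝔢 suc i} (inner ≈ᵛ-refl) x)
      ≈ᴹ P.∑< p (λ k → rotate j (nat k) (inn j (edge-term (suc j) (ν k) (m ·𝔢⁺ i) x)))
    inner-term j n ν ν≈ m i x = go (m ·𝔳 i ≈ᵛ? n ·𝔳 j)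
      where
      f : ℕ → ⟨ 𝒱 (vertex (𝔳 j)) ⟩
      f k = rotate j (nat k) (inn j (edge-term (suc j) (ν k) (m ·𝔢⁺ i) x))

      f≈0 : ∀ k → ¬ m ·𝔳 suc i ≈ᵛ ν k ·𝔳 suc j → f k ≈ᴹ V.0ᴹ
      f≈0 k ¬q = V.≈ᴹ-trans (act.⟦⟧-cong (pow j (nat k)) (pow-fixes-𝔳 j (nat k))
        (V.≈ᴹ-trans (res.⟦⟧-cong (inner ≈ᵛ-refl) (edge-term-no (suc j) (ν k) m i x ¬q)) (res.0ᴹ-homo (inner ≈ᵛ-refl))))
        (act.0ᴹ-homo (pow j (nat k)) (pow-fixes-𝔳 j (nat k)))

      ν≡ : ∀ k → ν k ≡ n + pow j (nat k) [mod-p^ suc j ]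
      ν≡ k = ≡[mod]-refl (ν≈ k)

      lower : ∀ {k} → m ·𝔳 suc i ≈ᵛ ν k ·𝔳 suc j → m ·𝔳 i ≈ᵛ n ·𝔳 j
      lower {k} q = level (ℕₚ.suc-injective (≈ᵛ⇒level q)) (≡[mod]-trans
        (≡[mod-p^suc]⇒≡[mod-p^] (≡[mod]-trans (≈ᵛ⇒≡[mod] q) (ν≡ k)))
        (≡[mod]-trans (≡[mod]-+ (≡[mod]-refl (Z.refl {n})) (pow≡0 j (nat k))) (≡[mod]-refl (Z.+-identityʳ n))))
        where
        level : i ≡ j → m ≡ n [mod-p^ j ] → m ·𝔳 i ≈ᵛ n ·𝔳 j
        level ≡.refl e = ≡[mod]⇒≈ᵛ e

      raise : ∀ {k} → m ·𝔳 i ≈ᵛ n ·𝔳 j → m ≡ n + pow j (nat k) [mod-p^ suc j ] → m ·𝔳 suc i ≈ᵛ ν k ·𝔳 suc j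
      raise {k} q e = level (≈ᵛ⇒level q) (≡[mod]-trans e (≡[mod]-sym (ν≡ k)))
        where
        level : i ≡ j → m ≡ ν k [mod-p^ suc j ] → m ·𝔳 suc i ≈ᵛ ν k ·𝔳 suc j
        level ≡.refl e = ≡[mod]⇒≈ᵛ e

      go : Dec (m ·𝔳 i ≈ᵛ n ·𝔳 j) → term j n (m ·𝔳 i) (res {τ = m ·𝔢 suc i} (inner ≈ᵛ-refl) x) ≈ᴹ P.∑< p f
      go (no ¬q) = V.≈ᴹ-trans (term-no j n (m ·𝔳 i) _ ¬q) (V.≈ᴹ-sym (P.∑<-zero p (λ k → f≈0 k (λ q → ¬q (lower q)))))
      go (yes q) =
        -- The digit of m over n picks out the only summand that survives.
        let k , k<p , m≡ = digit (≈ᵛ⇒≡[mod] q)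
        in V.≈ᴹ-trans (V.≈ᴹ-sym (at-digit k (raise q m≡))) (V.≈ᴹ-sym (P.∑<-single p k f k<p (λ l l<p l≢k →
             f≈0 l (λ q′ → l≢k (≡.sym (digit-unique k<p l<p
               (≡[mod]-trans (≡[mod]-sym m≡) (≡[mod]-trans (≈ᵛ⇒≡[mod] q′) (ν≡ l)))))))))
        where
        at-digit : ∀ k → m ·𝔳 suc i ≈ᵛ ν k ·𝔳 suc j → f k ≈ᴹ term j n (m ·𝔳 i) (res {τ = m ·𝔢 suc i} (inner ≈ᵛ-refl) x)
        at-digit k q′ = V.≈ᴹ-trans (act.⟦⟧-cong (pow j (nat k)) (pow-fixes-𝔳 j (nat k))
            (V.≈ᴹ-trans (res.⟦⟧-cong (inner ≈ᵛ-refl) (edge-term-yes (suc j) (ν k) m i x q′ (untranslate-edge q′)))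
              (V.≈ᴹ-sym (act-res (Z.- ν k) {m ·𝔳 i} {𝔳 j} {m ·𝔢 suc i} {𝔢 (suc j)} (inner ≈ᵛ-refl) (inner ≈ᵛ-refl) q₁ (untranslate-edge q′) x))))
          (V.≈ᴹ-trans (act-∘ {pow j (nat k)} {Z.- ν k} q₁ (pow-fixes-𝔳 j (nat k)) q₂ _)
            (V.≈ᴹ-trans (act-cong {pow j (nat k) + (Z.- ν k)} {Z.- n} e q₂ (untranslate-vertex q) _)
              (V.≈ᴹ-sym (term-yes j n (m ·𝔳 i) _ q (untranslate-vertex q)))))
          where
          level : i ≡ j → (Z.- ν k) + m ≡ 0# [mod-p^ j ] → (Z.- ν k) · vertex (m ·𝔳 i) ≈ˢ vertex (𝔳 j)
          level ≡.refl e = vertex (≡[mod]⇒≈ᵛ e)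
          q₁ : (Z.- ν k) · vertex (m ·𝔳 i) ≈ˢ vertex (𝔳 j)
          q₁ = level (≈ᵛ⇒level q) (≡[mod-p^suc]⇒≡[mod-p^] (untranslate (≈ᵛ⇒≡[mod] q′)))
          q₂ : (pow j (nat k) + (Z.- ν k)) · vertex (m ·𝔳 i) ≈ˢ vertex (𝔳 j)
          q₂ = ·-assoc {pow j (nat k)} {Z.- ν k} q₁ (pow-fixes-𝔳 j (nat k))
          e : pow j (nat k) + (Z.- ν k) Z.≈ Z.- n
          e = RingIdentities.d-ν≈-n (PAdicNumbers.ℤₚ p) n (ν k) (pow j (nat k)) (ν≈ k)

    -- At n 𝔳ⱼ the edge n 𝔢ⱼ meets the p edges (n + pʲ k) 𝔢ⱼ₊₁. The latter are translated back by
    -- `ν k` instead of n, which the rotation by pʲ k makes up for. `ν` is left free so that its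
    -- values can be taken among the natural numbers.
    component-∂ : ∀ j n (ν : ℕ → 𝔑₀) → (∀ k → ν k Z.≈ n + pow j (nat k)) → ∀ d →
      component j n (∂ p V d) ≈ᴹ out j (edge-component j n d)
        V.+ᴹ P.∑< p (λ k → rotate j (nat k) (inn j (edge-component (suc j) (ν k) d)))
    component-∂ j n ν ν≈ [] = V.≈ᴹ-sym (V.≈ᴹ-trans (V.+ᴹ-cong (res.0ᴹ-homo (outer ≈ᵛ-refl))
      (P.∑<-zero p (λ k → V.≈ᴹ-trans (act.⟦⟧-cong (pow j (nat k)) (pow-fixes-𝔳 j (nat k)) (res.0ᴹ-homo (inner ≈ᵛ-refl)))
        (act.0ᴹ-homo (pow j (nat k)) (pow-fixes-𝔳 j (nat k)))))) (V.+ᴹ-identityʳ V.0ᴹ))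
    component-∂ j n ν ν≈ ((m ·𝔢⁺ i , x) ∷ d) = V.≈ᴹ-trans
      (V.+ᴹ-cong (outer-term j n m i x) (V.+ᴹ-cong (inner-term j n ν ν≈ m i x) (component-∂ j n ν ν≈ d)))
      (V.≈ᴹ-trans (V.≈ᴹ-trans (V.≈ᴹ-sym (V.+ᴹ-assoc _ _ _)) (P.+-interchange _ _ _ _))
        (V.+ᴹ-cong (V.≈ᴹ-sym (res.+ᴹ-homo (outer ≈ᵛ-refl) _ _))
          (V.≈ᴹ-trans (V.≈ᴹ-sym (P.∑-distrib-+ {n = p} (λ k → F (Fin.toℕ k)) (λ k → G (Fin.toℕ k))))
            (P.∑<-cong p (λ k → V.≈ᴹ-sym (V.≈ᴹ-trans
              (act.⟦⟧-cong (pow j (nat k)) (pow-fixes-𝔳 j (nat k)) (res.+ᴹ-homo (inner ≈ᵛ-refl) (edge-term (suc j) (ν k) (m ·𝔢⁺ i) x) (edge-component (suc j) (ν k) d)))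
              (act.+ᴹ-homo (pow j (nat k)) (pow-fixes-𝔳 j (nat k)) _ _)))))))
      where
      F G : ℕ → ⟨ 𝒱 (vertex (𝔳 j)) ⟩
      F k = rotate j (nat k) (inn j (edge-term (suc j) (ν k) (m ·𝔢⁺ i) x))
      G k = rotate j (nat k) (inn j (edge-component (suc j) (ν k) d))

    edge-component-0 : ∀ n d → edge-component 0 n d ≈ᴹ V.0ᴹ
    edge-component-0 n []                   = V.≈ᴹ-refl
    edge-component-0 n ((m ·𝔢⁺ i , x) ∷ d) = V.≈ᴹ-trans (V.+ᴹ-cong (edge-term-no 0 n m i x (λ q → ℕₚ.1+n≢0 (≈ᵛ⇒level q))) (edge-component-0 n d))
      (V.+ᴹ-identityʳ V.0ᴹ)

    component-bounded : ∀ h → ∃[ B ] ∀ j → B ≤ j → ∀ n → component j n h ≈ᴹ V.0ᴹ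
    component-bounded []                  = 0 , λ j _ n → V.≈ᴹ-refl
    component-bounded ((m ·𝔳 i , x) ∷ h) = let B , e = component-bounded h in suc i ℕ.⊔ B , λ j B≤j n →
      V.≈ᴹ-trans (V.+ᴹ-cong
        (term-no j n (m ·𝔳 i) x (λ q → ℕₚ.<⇒≢ (ℕₚ.≤-trans (ℕₚ.m≤m⊔n (suc i) B) B≤j) (≈ᵛ⇒level q)))
        (e j (ℕₚ.≤-trans (ℕₚ.m≤n⊔m (suc i) B) B≤j) n)) (V.+ᴹ-identityʳ V.0ᴹ)

    edge-component-bounded : ∀ d → ∃[ B ] ∀ j → B ≤ j → ∀ n → edge-component j n d ≈ᴹ V.0ᴹ
    edge-component-bounded []                   = 0 , λ j _ n → V.≈ᴹ-refl
    edge-component-bounded ((m ·𝔢⁺ i , x) ∷ d) = let B , e = edge-component-bounded d in suc (suc i) ℕ.⊔ B , λ j B≤j n →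
      V.≈ᴹ-trans (V.+ᴹ-cong
        (edge-term-no j n m i x (λ q → ℕₚ.<⇒≢ (ℕₚ.≤-trans (ℕₚ.m≤m⊔n (suc (suc i)) B) B≤j) (≈ᵛ⇒level q)))
        (e j (ℕₚ.≤-trans (ℕₚ.m≤n⊔m (suc (suc i)) B) B≤j) n)) (V.+ᴹ-identityʳ V.0ᴹ)

    -- The bound on the length of `rest` is what the induction in `components≈0⇒≋[]` runs on.
    collect : ∀ j n h → ∃[ rest ] h ≋ (n ·𝔳 j , act n (translate-vertex n) (component j n h)) ∷ rest × length rest ≤ length h
    collect j n [] = [] , ≋-sym (≋-trans (cong (act.0ᴹ-homo n (translate-vertex n))) (zero (n ·𝔳 j))) , ℕ.z≤n
    collect j n ((y , x) ∷ h) with collect j n h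
    ... | rest , e , rest≤ with y ≈ᵛ? n ·𝔳 j
    ...   | yes q = rest , ≋-trans (++-cong (≋-trans (transport q x) (cong head≈)) e)
        (≋-trans (++-cong (≋-sym (add (n ·𝔳 j) _ _)) ≋-refl)
          (++-cong (cong (V.≈ᴹ-sym (act.+ᴹ-homo n (translate-vertex n) _ _))) ≋-refl)) , ℕₚ.m≤n⇒m≤1+n rest≤
      where
      q″ : (n + (Z.- n)) · vertex y ≈ˢ vertex (n ·𝔳 j)
      q″ = ·-assoc {n} {Z.- n} (untranslate-vertex q) (translate-vertex n)
      head≈ : act 0# (0· q) x ≈ᴹ act n (translate-vertex n) (act (Z.- n) (untranslate-vertex q) x)
      head≈ = V.≈ᴹ-sym (V.≈ᴹ-trans (act-∘ {n} {Z.- n} (untranslate-vertex q) (translate-vertex n) q″ x)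
        (act-cong {n + (Z.- n)} {0#} (Z.-‿inverseʳ n) q″ (0· q) x))
    ...   | no ¬q = (y , x) ∷ rest , ≋-trans (++-cong (≋-refl {(y , x) ∷ []}) e)
        (≋-trans (++-comm ((y , x) ∷ []) ((n ·𝔳 j , _) ∷ rest)) (++-cong {(n ·𝔳 j , _) ∷ []}
          (cong (act.⟦⟧-cong n (translate-vertex n) (V.≈ᴹ-sym (V.+ᴹ-identityˡ _)))) (++-comm rest ((y , x) ∷ [])))) , ℕ.s≤s rest≤

    -- All summands at the vertex of the first one are merged. Their sum is, up to translation, the
    -- component there, so it vanishes and a shorter formal sum remains.
    components≈0⇒≋[] : ∀ h → (∀ j n → component j n h ≈ᴹ V.0ᴹ) → h ≋ []
    components≈0⇒≋[] h = go (length h) h ℕₚ.≤-refl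
      where
      go : ∀ N h → length h ≤ N → (∀ j n → component j n h ≈ᴹ V.0ᴹ) → h ≋ []
      go N       []                  _   e = ≋-refl
      go (suc N) ((n ·𝔳 j , x) ∷ h) h≤N e =
        let rest , f , rest≤ = collect j n h
            h′ : FormalSum
            h′ = (n ·𝔳 j , x V.+ᴹ act n (translate-vertex n) (component j n h)) ∷ rest
            h≋h′ : (n ·𝔳 j , x) ∷ h ≋ h′
            h≋h′ = ≋-trans (++-cong (≋-refl {(n ·𝔳 j , x) ∷ []}) f) (++-cong (≋-sym (add (n ·𝔳 j) x _)) ≋-refl)
            h≋rest : (n ·𝔳 j , x) ∷ h ≋ rest
            h≋rest = ≋-trans h≋h′ (++-cong (≋-trans (cong (summand≈0 n j x h (e j n))) (zero (n ·𝔳 j))) ≋-refl)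
        in ≋-trans h≋rest (go N rest (ℕₚ.≤-trans rest≤ (ℕ.s≤s⁻¹ h≤N))
             (λ i m → V.≈ᴹ-trans (V.≈ᴹ-sym (component-cong i m h≋rest)) (e i m)))
        where
        summand≈0 : ∀ n j x h → component j n ((n ·𝔳 j , x) ∷ h) ≈ᴹ V.0ᴹ →
          x V.+ᴹ act n (translate-vertex n) (component j n h) ≈ᴹ V.0ᴹ
        summand≈0 n j x h e = V.≈ᴹ-trans (V.+ᴹ-congʳ x≈) (V.≈ᴹ-trans (V.≈ᴹ-sym (act.+ᴹ-homo n (translate-vertex n) _ _))
          (V.≈ᴹ-trans (act.⟦⟧-cong n (translate-vertex n) e) (act.0ᴹ-homo n (translate-vertex n))))
          where
          q : (Z.- n) · vertex (n ·𝔳 j) ≈ˢ vertex (𝔳 j)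
          q = untranslate-vertex ≈ᵛ-refl
          q″ : (n + (Z.- n)) · vertex (n ·𝔳 j) ≈ˢ vertex (n ·𝔳 j)
          q″ = ·-assoc {n} {Z.- n} q (translate-vertex n)
          x≈ : x ≈ᴹ act n (translate-vertex n) (term j n (n ·𝔳 j) x)
          x≈ = V.≈ᴹ-sym (V.≈ᴹ-trans (act.⟦⟧-cong n (translate-vertex n) (term-yes j n (n ·𝔳 j) x ≈ᵛ-refl q))
            (V.≈ᴹ-trans (act-∘ {n} {Z.- n} q (translate-vertex n) q″ x)
              (V.≈ᴹ-trans (act-cong {n + (Z.- n)} {0#} (Z.-‿inverseʳ n) q″ (0· ≈ᵛ-refl) x) (act-id (0· ≈ᵛ-refl) x))))

  private
    module H = LeftModule (H₀ p V)
    module Invariants = IsSubmodule (invariants p V)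

  abstract
    ≋⇒≈ : ∀ {h h′} → h ≋ h′ → h H.≈ᴹ h′
    ≋⇒≈ = Quotient.≈⇒≈ₚ (Chain₀ p V) (boundaries p V)

    homologous⇒∂ : ∀ {h h′} → h H.≈ᴹ h′ → ∃[ d ] h ≋ h′ ++ ∂ p V d
    homologous⇒∂ {h} {h′} (Quotient.modulo (d , z≋) e) = d , ≋-trans e (++-cong (≋-refl {h′}) z≋)

    toH₀-0 : toH₀ p V V.0ᴹ ≋ []
    toH₀-0 = ≋-trans (cong (res.0ᴹ-homo (outer ≈ᵛ-refl))) (zero (𝔳 0))

    ∂-homologous : ∀ d → ∂ p V d H.≈ᴹ toH₀ p V V.0ᴹ
    ∂-homologous d = Quotient.modulo {difference = ∂ p V d} (d , ≋-refl) (++-cong (≋-sym toH₀-0) (≋-refl {∂ p V d}))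

    toH₀-linear : IsLinear (𝒱 (edge (𝔢 0))) (H₀ p {A = A} V) (toH₀ p {A = A} V)
    toH₀-linear = linear (𝒱 (edge (𝔢 0))) (H₀ p {A = A} V)
      (λ e → ≋⇒≈ (cong (res.⟦⟧-cong (outer ≈ᵛ-refl) e)))
      (λ x y → ≋⇒≈ (≋-trans (cong (res.+ᴹ-homo (outer ≈ᵛ-refl) x y)) (add (𝔳 0) _ _)))
      (λ b x → ≋⇒≈ (cong (res.*ₗ-homo (outer ≈ᵛ-refl) b x)))

    ++-homologous-cancel : ∀ {h c y z} → h ++ c H.≈ᴹ toH₀ p V y → c H.≈ᴹ toH₀ p V z →
      h H.≈ᴹ toH₀ p V (y V.+ᴹ (A.- A.1#) V.*ₗ z)
    ++-homologous-cancel {h} {c} {y} {z} e f =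
      H.≈ᴹ-trans (ModuleProperties.subtract {R = A} (H₀ p {A = A} V) {h ++ c} {h} {c} H.≈ᴹ-refl)
        (H.≈ᴹ-trans (H.+ᴹ-cong e (H.*ₗ-cong A.refl f))
          (H.≈ᴹ-sym (H.≈ᴹ-trans (toH₀-map.+ᴹ-homo y ((A.- A.1#) V.*ₗ z))
            (H.+ᴹ-congˡ {toH₀ p V y} (toH₀-map.*ₗ-homo (A.- A.1#) z)))))
      where module toH₀-map = LinearMap {M = 𝒱 (edge (𝔢 0))} {N = H₀ p {A = A} V} toH₀-linear

    ++-invariant : ∀ {h c y} → IsInvariant p V h → c H.≈ᴹ toH₀ p V y → IsInvariant p V (toH₀ p V y) → IsInvariant p V (h ++ c)
    ++-invariant {h} {c} {y} h-inv e y-inv = Invariants.+-closed {h} {c} h-inv (Invariants.resp-≈ {toH₀ p V y} {c} (H.≈ᴹ-sym e) y-inv)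

    -- A is given explicitly, since unification would find its η-expansion, which is slow to compare with A.
    toH₀^𝔑₀-isomorphism : (inv : ∀ x → IsInvariant p V (toH₀ p V x)) →
      (∀ {x y} → toH₀ p V x H.≈ᴹ toH₀ p V y → x ≈ᴹ y) →
      (∀ h → IsInvariant p V h → ∃[ y ] h H.≈ᴹ toH₀ p V y) →
      IsLinearIsomorphism (𝒱 (edge (𝔢 0))) (H₀^𝔑₀ p {A = A} V) (toH₀^𝔑₀ p {A = A} V inv)
    toH₀^𝔑₀-isomorphism inv = corestriction-isomorphism (𝒱 (edge (𝔢 0))) (H₀ p {A = A} V)
      {P = IsInvariant p {A = A} V} (invariants p {A = A} V) {f = toH₀ p {A = A} V} toH₀-linear inv

-- Filtrations with graded pieces of level 1

module FilteredSystem {p : ℕ} (p-prime : Prime p) {K : FiniteExtension p c ℓ₁ ℓ₂} (O : RingOfIntegers p K r ℓr)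
  {π : RingOfIntegers.Carrier O} (π-uniformizer : RingOfIntegers.IsUniformizer O π) (m : ℕ)
  (V : CoefficientSystem p _ ℓ)
  {N : ℕ} (F : Filtration p V N)
  (level1 : ∀ i → StrictlyOfLevel1Over-k p (RingOfIntegers.𝔬 O) π m (Filtration.graded F i))
  where

  private
    instance
      p≢0 : ℕ.NonZero p
      p≢0 = prime⇒nonZero p-prime

    A : CommutativeRing _ _
    A = RingOfIntegers.𝔬 O ⧸ Exp._^_ (CommutativeRing.semiring (RingOfIntegers.𝔬 O)) π m

  open HalfTree p
  open CoefficientSystem V
  open PAdicProperties p
  open HalfTreeProperties p
  open Equivariance V
  open Components V
  private
    module Z = CommutativeRing (PAdicNumbers.ℤₚ p)
    module A = CommutativeRing A
    module V {σ} = LeftModule (𝒱 σ)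
    module P {σ} = ModuleProperties {R = A} (𝒱 σ)
    module act g {σ τ} (q : g · σ ≈ˢ τ) = LinearMap {M = 𝒱 σ} {N = 𝒱 τ} (act-linear g q)
    module res {y τ} (y∈τ : y ∈ τ) = LinearMap {M = 𝒱 (edge τ)} {N = 𝒱 (vertex y)} (res-linear y∈τ)
    module F = Filtration F
    module part i = Subsystem (F.part i)
    module In i {σ} = IsSubmodule (part.submodule i σ)
    module gr i = CoefficientSystem (Filtration.graded F i)
    module H = LeftModule (H₀ p V)

  In : Fin (suc N) → ∀ {σ} → ⟨ 𝒱 σ ⟩ → Set _
  In i {σ} x = part.pred i σ x

  abstract
    in-0 : ∀ i {σ} {x : ⟨ 𝒱 σ ⟩} → x ≈ᴹ V.0ᴹ → In i x
    in-0 i x≈0 = In.resp-≈ i (V.≈ᴹ-sym x≈0) (In.0-closed i)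

    in-cancel : ∀ i {σ} {x y z : ⟨ 𝒱 σ ⟩} → x ≈ᴹ y V.+ᴹ z → In i x → In i z → In i y
    in-cancel i e x∈ z∈ = In.resp-≈ i (V.≈ᴹ-sym (P.subtract e)) (In.+-closed i x∈ (In.*-closed i _ z∈))

    in-zero⇒≈0 : ∀ {σ} {x : ⟨ 𝒱 σ ⟩} → In Fin.zero x → x ≈ᴹ V.0ᴹ
    in-zero⇒≈0 = F.bottom

    ≈⇒gr≈ : ∀ i {σ} {x y : ⟨ gr.𝒱 i σ ⟩} → proj₁ x ≈ᴹ proj₁ y → gr._≈ᴹ_ i {σ} x y
    ≈⇒gr≈ i e = Quotient.modulo {difference = V.0ᴹ , In.0-closed (Fin.suc i)} (In.0-closed (Fin.inject₁ i))
      (Submodule.restrict (V.≈ᴹ-trans e (V.≈ᴹ-sym (V.+ᴹ-identityʳ _))))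

    gr≈⇒ : ∀ i {σ} {x y : ⟨ gr.𝒱 i σ ⟩} → gr._≈ᴹ_ i {σ} x y → ∃[ z ] In (Fin.inject₁ i) z × proj₁ x ≈ᴹ proj₁ y V.+ᴹ z
    gr≈⇒ i (Quotient.modulo {z , _} z∈ (Submodule.restrict e)) = z , z∈ , e

    in⇒gr≈0 : ∀ i {σ} {x : ⟨ 𝒱 σ ⟩} (x∈ : In (Fin.suc i) x) → In (Fin.inject₁ i) x →
      gr._≈ᴹ_ i {σ} (x , x∈) (LeftModule.0ᴹ (gr.𝒱 i σ))
    in⇒gr≈0 i {σ} {x} x∈ x∈′ = Quotient.modulo {difference = x , x∈} x∈′ (Submodule.restrict (V.≈ᴹ-sym (V.+ᴹ-identityˡ x)))

    gr≈0⇒in : ∀ i {σ} {x : ⟨ 𝒱 σ ⟩} {x∈ : In (Fin.suc i) x} →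
      gr._≈ᴹ_ i {σ} (x , x∈) (LeftModule.0ᴹ (gr.𝒱 i σ)) → In (Fin.inject₁ i) x
    gr≈0⇒in i e = let z , z∈ , x≈ = gr≈⇒ i e in
      In.resp-≈ (Fin.inject₁ i) (V.≈ᴹ-sym (V.≈ᴹ-trans x≈ (V.+ᴹ-identityˡ z))) z∈

    -- Descending from the whole system: if x is in part i + 1 and `out j x` in part i, then x is
    -- zero in the graded piece, where the transition map is injective. For i = 0 this makes `out j`
    -- injective on `V`.
    out-reflects-in : ∀ i j {x} → In i (out j x) → In i x
    out-reflects-in = >-weakInduction (λ i → ∀ j {x} → In i (out j x) → In i x) (λ j {x} _ → F.top x) step
      where
      step : ∀ i → (∀ j {x} → In (Fin.suc i) (out j x) → In (Fin.suc i) x) →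
        ∀ j {x} → In (Fin.inject₁ i) (out j x) → In (Fin.inject₁ i) x
      step i ih j {x} out∈ = gr≈0⇒in i {x = x} {x∈} (StrictlyOfLevel1Over-k.injective (level1 i) {𝔳 j} {𝔢 j} (outer ≈ᵛ-refl)
        (Quotient.modulo {difference = out j x , part.res-closed (Fin.suc i) (outer ≈ᵛ-refl) x∈} out∈
          (Submodule.restrict (V.≈ᴹ-sym (V.≈ᴹ-trans (V.+ᴹ-congʳ (res.0ᴹ-homo (outer ≈ᵛ-refl))) (V.+ᴹ-identityˡ _))))))
        where
        x∈ : In (Fin.suc i) x
        x∈ = ih j (F.step i out∈)

    inner-in : ∀ i j (x : ℕ → ⟨ 𝒱 (edge (𝔢 (suc j))) ⟩) → (∀ k → In i (x k)) →
      In i (P.∑< p (λ k → rotate j (nat k) (inn j (x k))))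
    inner-in i j x x∈ = submodule-sum (𝒱 (vertex (𝔳 j))) (part.submodule i (vertex (𝔳 j))) {n = p} _
      (λ k → part.act-closed i _ _ (part.res-closed i _ (x∈ (Fin.toℕ k))))

    -- From the top level of d downwards: `out` of the edge component is the component of the
    -- boundary minus contributions of level j + 1, which are already known to lie in part i.
    edge-components-in : ∀ i d j₀ → (∀ j → j₀ ≤ j → ∀ n → In i (component j n (∂ p V d))) →
      ∀ j → j₀ ≤ j → ∀ n → In i (edge-component j n d)
    edge-components-in i d j₀ ∂d∈ j j₀≤j = let B , d≈0 = edge-component-bounded d in go B d≈0 B j j₀≤j (ℕₚ.m≤m+n B j)
      where
      go : ∀ B → (∀ j → B ≤ j → ∀ n → edge-component j n d ≈ᴹ V.0ᴹ) →
        ∀ s j → j₀ ≤ j → B ≤ s ℕ.+ j → ∀ n → In i (edge-component j n d)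
      go B d≈0 zero    j j₀≤j B≤ n = in-0 i (d≈0 j B≤ n)
      go B d≈0 (suc s) j j₀≤j B≤ n = out-reflects-in i j (in-cancel i
        (component-∂ j n (λ k → n + pow j (nat k)) (λ k → Z.refl) d) (∂d∈ j j₀≤j n)
        (inner-in i j _ (λ k → go B d≈0 s (suc j) (ℕₚ.m≤n⇒m≤1+n j₀≤j) (≡.subst (B ≤_) (≡.sym (ℕₚ.+-suc s j)) B≤) (n + pow j (nat k)))))

    term-in : ∀ i j n y {x} → In i x → In i (term j n y x)
    term-in i j n y x∈ with y ≈ᵛ? n ·𝔳 j
    ... | yes q = part.act-closed i (Z.- n) (untranslate-vertex q) x∈
    ... | no _  = In.0-closed i

    edge-term-in : ∀ i j n τ {x} → In i x → In i (edge-term j n τ x)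
    edge-term-in i j n (m ·𝔢⁺ l) x∈ with m ·𝔳 suc l ≈ᵛ? n ·𝔳 j
    ... | yes q = part.act-closed i (Z.- n) (untranslate-edge q) x∈
    ... | no _  = In.0-closed i

    toH₀-component : ∀ x → component 0 (nat 0) (toH₀ p V x) ≈ᴹ out 0 x
    toH₀-component x = V.≈ᴹ-trans (V.+ᴹ-identityʳ _) (V.≈ᴹ-trans
      (term-yes 0 (nat 0) (𝔳 0) (out 0 x) (≡[mod]⇒≈ᵛ (≡[mod-p^0] 0# (nat 0))) q)
      (V.≈ᴹ-trans (act-cong {Z.- nat 0} {0#} -nat-0≈0 q (0· ≈ᵛ-refl) (out 0 x)) (act-id (0· ≈ᵛ-refl) (out 0 x))))
      where
      q : (Z.- nat 0) · vertex (𝔳 0) ≈ˢ vertex (𝔳 0)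
      q = fixes-vertex (≡[mod-p^0] (Z.- nat 0) 0#)
      -nat-0≈0 : Z.- nat 0 Z.≈ 0#
      -nat-0≈0 = Z.trans (Z.-‿cong {nat 0} {0#} nat-0) (RingProperties.-0#≈0# Z.ring)

  -- Serves to change the components of level L by prescribed elements of the image of `out` without
  -- disturbing higher levels, at the cost of the class of `value`. One index n < pᴸ for each vertex
  -- suffices.
  record Correction (i : Fin (suc N)) (L : ℕ) (x : ℕ → ⟨ 𝒱 (edge (𝔢 L)) ⟩) : Set (r ⊔ ℓr ⊔ ℓ) where
    field
      chain         : FormalSum
      value         : ⟨ 𝒱 (edge (𝔢 0)) ⟩
      components-in : ∀ j n → In i (component j n chain)
      above         : ∀ j → suc L ≤ j → ∀ n → component j n chain ≈ᴹ V.0ᴹ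
      at-level      : ∀ n → n ℕ.< p ℕ.^ L → component L (nat n) chain ≈ᴹ out L (x n)
      homologous    : chain H.≈ᴹ toH₀ p V value

  module _ {i : Fin (suc N)} {L : ℕ} (x : ℕ → ⟨ 𝒱 (edge (𝔢 (suc L))) ⟩) (x∈ : ∀ n → In i (x n)) where
    edges : ℕ → Chain₁ p V
    edges zero    = []
    edges (suc n) = (nat n ·𝔢⁺ L , act (nat n) (translate-edge (nat n)) (x n)) ∷ edges n

    abstract
      edges-in : ∀ j n N → In i (edge-component j n (edges N))
      edges-in j n zero    = In.0-closed i
      edges-in j n (suc N) = In.+-closed i (edge-term-in i j n _ (part.act-closed i _ _ (x∈ N))) (edges-in j n N)

      edges-other-level : ∀ j n N → ¬ suc L ≡ j → edge-component j n (edges N) ≈ᴹ V.0ᴹ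
      edges-other-level j n zero    L≢j = V.≈ᴹ-refl
      edges-other-level j n (suc N) L≢j = V.≈ᴹ-trans (V.+ᴹ-cong
        (edge-term-no j n (nat N) L _ (λ q → L≢j (≈ᵛ⇒level q))) (edges-other-level j n N L≢j)) (V.+ᴹ-identityʳ V.0ᴹ)

      edges-beyond : ∀ n N → N ≤ n → n ℕ.< p ℕ.^ suc L → edge-component (suc L) (nat n) (edges N) ≈ᴹ V.0ᴹ
      edges-beyond n zero    N≤n n< = V.≈ᴹ-refl
      edges-beyond n (suc N) N<n n< = V.≈ᴹ-trans (V.+ᴹ-cong
        (edge-term-no (suc L) (nat n) (nat N) L _
          (λ q → ℕₚ.<⇒≢ N<n (representative-unique (suc L) (ℕₚ.<-trans N<n n<) n< (≈ᵛ⇒≡[mod] q))))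
        (edges-beyond n N (ℕₚ.<⇒≤ N<n) n<)) (V.+ᴹ-identityʳ V.0ᴹ)

      -- Distinct numbers below pᴸ⁺¹ are incongruent modulo pᴸ⁺¹, so just one of the edges
      -- contributes.
      edges-at : ∀ n N → n ℕ.< N → N ≤ p ℕ.^ suc L → edge-component (suc L) (nat n) (edges N) ≈ᴹ x n
      edges-at n (suc N) n<N N≤ = last-or-earlier (ℕₚ.m≤n⇒m<n∨m≡n (ℕ.s≤s⁻¹ n<N))
        where
        last-or-earlier : n ℕ.< N ⊎ n ≡ N → edge-component (suc L) (nat n) (edges (suc N)) ≈ᴹ x n
        last-or-earlier (inj₁ n<N′) = V.≈ᴹ-trans (V.+ᴹ-cong
          (edge-term-no (suc L) (nat n) (nat N) L _
            (λ q → ℕₚ.<⇒≢ n<N′ (≡.sym (representative-unique (suc L) N≤ (ℕₚ.<-trans n<N′ N≤) (≈ᵛ⇒≡[mod] q)))))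
          (edges-at n N n<N′ (ℕₚ.<⇒≤ N≤))) (V.+ᴹ-identityˡ _)
        last-or-earlier (inj₂ ≡.refl) = V.≈ᴹ-trans (V.+ᴹ-cong
          (edge-term-translate L (nat n) (x n)) (edges-beyond n n ℕₚ.≤-refl N≤)) (V.+ᴹ-identityʳ _)

  correction : ∀ i L (x : ℕ → ⟨ 𝒱 (edge (𝔢 L)) ⟩) → (∀ n → In i (x n)) → Correction i L x
  -- The loose end 𝔢₀ is not an edge of the complex, so the element of 𝒱(𝔢₀) bounds nothing and is
  -- kept as the value.
  correction i zero x x∈ = record
    { chain         = toH₀ p V (x 0)
    ; value         = x 0
    ; components-in = λ j n → In.+-closed i (term-in i j n (𝔳 0) (part.res-closed i _ (x∈ 0))) (In.0-closed i)
    ; above         = λ j 1≤j n → V.≈ᴹ-trans (V.+ᴹ-identityʳ _)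
        (term-no j n (𝔳 0) _ (λ q → ℕₚ.<⇒≢ 1≤j (≈ᵛ⇒level q)))
    ; at-level      = λ { zero _ → toH₀-component (x 0) ; (suc n) (ℕ.s≤s ()) }
    ; homologous    = H.≈ᴹ-refl
    }
  -- The chain d has one edge for each vertex of level L + 1; the inner ends only touch level L,
  -- below the one to be corrected.
  correction i (suc L) x x∈ = record
    { chain         = ∂ p V d
    ; value         = V.0ᴹ
    ; components-in = λ j n → In.resp-≈ i (V.≈ᴹ-sym (component-∂ j n (λ k → n + pow j (nat k)) (λ k → Z.refl) d))
        (In.+-closed i (part.res-closed i _ (edges-in x x∈ j n B)) (inner-in i j _ (λ k → edges-in x x∈ (suc j) (n + pow j (nat k)) B)))
    ; above         = λ j L<j n → V.≈ᴹ-trans (no-inner j n (ℕₚ.≤-trans (ℕₚ.n≤1+n _) L<j))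
        (V.≈ᴹ-trans (res.⟦⟧-cong (outer ≈ᵛ-refl) (edges-other-level x x∈ j n B (ℕₚ.<⇒≢ L<j))) (res.0ᴹ-homo (outer ≈ᵛ-refl)))
    ; at-level      = λ n n< → V.≈ᴹ-trans (no-inner (suc L) (nat n) ℕₚ.≤-refl)
        (res.⟦⟧-cong (outer ≈ᵛ-refl) (edges-at x x∈ n B n< ℕₚ.≤-refl))
    ; homologous    = ∂-homologous d
    }
    where
    B : ℕ
    B = p ℕ.^ suc L
    d : Chain₁ p V
    d = edges x x∈ B
    abstract
      no-inner : ∀ j n → suc L ≤ j → component j n (∂ p V d) ≈ᴹ out j (edge-component j n d)
      no-inner j n L≤j = V.≈ᴹ-trans (component-∂ j n (λ k → n + pow j (nat k)) (λ k → Z.refl) d) (V.≈ᴹ-trans (V.+ᴹ-congˡ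
        (P.∑<-zero p (λ k → V.≈ᴹ-trans (act.⟦⟧-cong (pow j (nat k)) (pow-fixes-𝔳 j (nat k))
          (V.≈ᴹ-trans (res.⟦⟧-cong (inner ≈ᵛ-refl) (edges-other-level x x∈ (suc j) (n + pow j (nat k)) B (ℕₚ.<⇒≢ (ℕ.s≤s L≤j))))
            (res.0ᴹ-homo (inner ≈ᵛ-refl)))) (act.0ᴹ-homo (pow j (nat k)) (pow-fixes-𝔳 j (nat k)))))) (V.+ᴹ-identityʳ _))

  private
    k : CommutativeRing _ _
    k = ResidueField.k O π-uniformizer

    reduced : ∀ i σ → LeftModule (CommutativeRing.ring k) ℓ ℓ
    reduced i = LevelOne.reduced p-prime O π-uniformizer m (Filtration.graded F i) (level1 i)

  abstract
    ∑<-proj₁ : ∀ i {σ} n (f : ℕ → ⟨ gr.𝒱 i σ ⟩) →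
      proj₁ (ModuleProperties.∑< {R = k} (reduced i σ) n f) ≈ᴹ P.∑< n (λ l → proj₁ (f l))
    ∑<-proj₁ i zero    f = V.≈ᴹ-refl
    ∑<-proj₁ i (suc n) f = V.+ᴹ-congˡ (∑<-proj₁ i n (λ l → f (suc l)))

    component-difference : ∀ h d → _•_ p V 1# h ≋ h ++ ∂ p V d → ∀ j n n′ → n′ Z.≈ 1# + n →
      component j n h ≈ᴹ component j n′ h V.+ᴹ component j n′ (∂ p V d)
    component-difference h d e j n n′ n′≈ = V.≈ᴹ-trans (V.≈ᴹ-sym (component-• j 1# n n′ n′≈ h))
      (V.≈ᴹ-trans (component-cong j n′ e) (component-++ j n′ h (∂ p V d)))

    -- A component of ∂d is the difference of two components of h at the same level.
    boundary-in : ∀ i h d → _•_ p V 1# h ≋ h ++ ∂ p V d → ∀ j₀ → (∀ j → j₀ ≤ j → ∀ n → In i (component j n h)) →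
      ∀ j → j₀ ≤ j → ∀ n → In i (component j n (∂ p V d))
    boundary-in i h d e j₀ h∈ j j₀≤j n = in-cancel i
      (V.≈ᴹ-trans (component-difference h d e j ((Z.- 1#) + n) n (n≈g+[-g+n] 1# n)) (V.+ᴹ-comm _ _))
      (h∈ j j₀≤j ((Z.- 1#) + n)) (h∈ j j₀≤j n)

    -- Above level L the components of h, and with them the edge components of d, vanish modulo the
    -- smaller part. So L is the top level in the graded piece and `top-level-fixed` applies; the
    -- negative of the fixed point found there is the element to be added.
    top-level : ∀ i L h d → _•_ p V 1# h ≋ h ++ ∂ p V d →
      (∀ j n → In (Fin.suc i) (component j n h)) →
      (∀ j → suc L ≤ j → ∀ n → In (Fin.inject₁ i) (component j n h)) →
      ∀ n → ∃[ x ] In (Fin.suc i) x × In (Fin.inject₁ i) (component L (nat n) h V.+ᴹ out L x)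
    top-level i L h d h≋ h∈ h∈′ n =
      let (e , e∈) , f = fixed-point
          z , z∈ , out≈ = gr≈⇒ i f
      in (A.- A.1#) V.*ₗ e , In.*-closed (Fin.suc i) _ e∈ , In.resp-≈ (Fin.inject₁ i) (V.≈ᴹ-sym (cancel e z out≈))
           (In.*-closed (Fin.inject₁ i) (A.- A.1#) z∈)
      where
      d∈ : ∀ j n → In (Fin.suc i) (edge-component j n d)
      d∈ j = edge-components-in (Fin.suc i) d 0 (boundary-in (Fin.suc i) h d h≋ 0 (λ j _ → h∈ j)) j ℕ.z≤n

      d∈′ : ∀ j → suc L ≤ j → ∀ n → In (Fin.inject₁ i) (edge-component j n d)
      d∈′ = edge-components-in (Fin.inject₁ i) d (suc L) (boundary-in (Fin.inject₁ i) h d h≋ (suc L) h∈′)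

      α : ∀ j → ℕ → ⟨ gr.𝒱 i (vertex (𝔳 j)) ⟩
      α j n = component j (nat n) h , h∈ j (nat n)

      β : ∀ j → ℕ → ⟨ gr.𝒱 i (edge (𝔢 j)) ⟩
      β j n = edge-component j (nat n) d , d∈ j (nat n)

      α-periodic : ∀ j → gr._≈ᴹ_ i (Equivariance.rotate (Filtration.graded F i) j 1# (α j (p ℕ.^ j))) (α j 0)
      α-periodic j = ≈⇒gr≈ i (V.≈ᴹ-sym (component-shift j (nat (p ℕ.^ j)) (nat 0) (pow j 1#) (pow-fixes-𝔳 j 1#) (nat-p^≡0 j) (pow-1 j) h))

      summand : ∀ (j n : ℕ) → ℕ → ⟨ gr.𝒱 i (vertex (𝔳 j)) ⟩
      summand j n l = Equivariance.rotate (Filtration.graded F i) j (nat l) (Equivariance.inn (Filtration.graded F i) j (β (suc j) (suc n ℕ.+ l ℕ.* p ℕ.^ j)))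

      difference : ∀ (j n : ℕ) → gr._≈ᴹ_ i (α j n) (LeftModule._+ᴹ_ (reduced i (vertex (𝔳 j))) (α j (suc n))
        (LeftModule._+ᴹ_ (reduced i (vertex (𝔳 j))) (Equivariance.out (Filtration.graded F i) j (β j (suc n)))
          (ModuleProperties.∑< {R = k} (reduced i (vertex (𝔳 j))) p (summand j n))))
      difference j n = ≈⇒gr≈ i (V.≈ᴹ-trans (component-difference h d h≋ j (nat n) (nat (suc n)) (nat-suc n))
        (V.+ᴹ-congˡ (V.≈ᴹ-trans (component-∂ j (nat (suc n)) (λ l → nat (suc n ℕ.+ l ℕ.* p ℕ.^ j)) (λ l → nat-digit (suc n) l j) d)
          (V.+ᴹ-congˡ (V.≈ᴹ-sym (∑<-proj₁ i p (summand j n)))))))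

      β-0 : ∀ n → gr._≈ᴹ_ i (β 0 n) (LeftModule.0ᴹ (reduced i (edge (𝔢 0))))
      β-0 n = ≈⇒gr≈ i (edge-component-0 (nat n) d)

      β≈0 : ∀ n → gr._≈ᴹ_ i (β (suc L) n) (LeftModule.0ᴹ (reduced i (edge (𝔢 (suc L)))))
      β≈0 n = in⇒gr≈0 i (d∈ (suc L) (nat n)) (d∈′ (suc L) ℕₚ.≤-refl (nat n))

      fixed-point : ∃[ e ] gr._≈ᴹ_ i (Equivariance.out (Filtration.graded F i) L e) (α L n)
      fixed-point = LevelOne.top-level-fixed p-prime O π-uniformizer m (Filtration.graded F i) (level1 i) α β
        α-periodic β-0 difference L β≈0 n

      cancel : ∀ e z → out L e ≈ᴹ component L (nat n) h V.+ᴹ z → component L (nat n) h V.+ᴹ out L ((A.- A.1#) V.*ₗ e) ≈ᴹ (A.- A.1#) V.*ₗ z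
      cancel e z f = V.≈ᴹ-trans (V.+ᴹ-cong (P.subtract f) (res.*ₗ-homo (outer ≈ᵛ-refl) (A.- A.1#) e))
        (V.≈ᴹ-trans (V.+ᴹ-congʳ (V.+ᴹ-comm _ _)) (V.≈ᴹ-trans (V.+ᴹ-assoc _ _ _)
          (V.≈ᴹ-trans (V.+ᴹ-congˡ (P.-1* (out L e))) (V.+ᴹ-identityʳ _))))

    -- Above level 0 the chain ∂d has no components, so the edge components of d vanish. Then ∂d
    -- vanishes at 𝔳₀ too, and `out 0` is injective. Vanishing is expressed throughout as membership
    -- in part 0.
    toH₀-injective : ∀ {x y} → toH₀ p V x H.≈ᴹ toH₀ p V y → x ≈ᴹ y
    toH₀-injective {x} {y} e = V.≈ᴹ-trans (P.subtract-≈ x y) (V.≈ᴹ-trans (V.+ᴹ-congˡ x-y≈0) (V.+ᴹ-identityʳ y))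
      where
      bounding : ∃[ d ] toH₀ p V x ≋ toH₀ p V y ++ ∂ p V d
      bounding = homologous⇒∂ e

      d : Chain₁ p V
      d = proj₁ bounding

      x≋ : toH₀ p V x ≋ toH₀ p V y ++ ∂ p V d
      x≋ = proj₂ bounding

      component-0 : ∀ j n x → 1 ≤ j → component j n (toH₀ p V x) ≈ᴹ V.0ᴹ
      component-0 j n x 1≤j = V.≈ᴹ-trans (V.+ᴹ-identityʳ _) (term-no j n (𝔳 0) _ (λ q → ℕₚ.<⇒≢ 1≤j (≈ᵛ⇒level q)))

      ∂d∈ : ∀ j → 1 ≤ j → ∀ n → In Fin.zero (component j n (∂ p V d))
      ∂d∈ j 1≤j n = in-cancel Fin.zero
        (V.≈ᴹ-trans (component-cong j n x≋) (V.≈ᴹ-trans (component-++ j n (toH₀ p V y) (∂ p V d)) (V.+ᴹ-comm _ _)))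
        (in-0 Fin.zero (component-0 j n x 1≤j)) (in-0 Fin.zero (component-0 j n y 1≤j))

      ∂d₀∈ : In Fin.zero (component 0 (nat 0) (∂ p V d))
      ∂d₀∈ = In.resp-≈ Fin.zero (V.≈ᴹ-sym (component-∂ 0 (nat 0) (λ k → nat 0 + pow 0 (nat k)) (λ k → Z.refl) d))
        (In.+-closed Fin.zero (part.res-closed Fin.zero _ (in-0 Fin.zero (edge-component-0 (nat 0) d)))
          (inner-in Fin.zero 0 _ (λ k → edge-components-in Fin.zero d 1 ∂d∈ 1 ℕₚ.≤-refl (nat 0 + pow 0 (nat k)))))

      res-difference : out 0 (x V.+ᴹ (A.- A.1#) V.*ₗ y) ≈ᴹ component 0 (nat 0) (∂ p V d)
      res-difference = V.≈ᴹ-trans (res.+ᴹ-homo (outer ≈ᵛ-refl) x _) (V.≈ᴹ-trans (V.+ᴹ-congˡ (res.*ₗ-homo (outer ≈ᵛ-refl) _ y))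
        (V.≈ᴹ-sym (P.subtract (V.≈ᴹ-trans (V.≈ᴹ-sym (toH₀-component x)) (V.≈ᴹ-trans (component-cong 0 (nat 0) x≋)
          (V.≈ᴹ-trans (component-++ 0 (nat 0) (toH₀ p V y) (∂ p V d))
            (V.≈ᴹ-trans (V.+ᴹ-congʳ (toH₀-component y)) (V.+ᴹ-comm _ _))))))))

      x-y≈0 : x V.+ᴹ (A.- A.1#) V.*ₗ y ≈ᴹ V.0ᴹ
      x-y≈0 = in-zero⇒≈0 (out-reflects-in Fin.zero 0 (In.resp-≈ Fin.zero (V.≈ᴹ-sym res-difference) ∂d₀∈))

    module _ (inv : ∀ x → IsInvariant p V (toH₀ p V x)) where
      private
        -- Homology and invariance refer to `V`, and y may be any element of 𝒱(𝔢₀): the part only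
        -- restricts the components of h.
        Hit : Fin (suc N) → Set _
        Hit i = ∀ h → (∀ j n → In i (component j n h)) → IsInvariant p V h → ∃[ y ] h H.≈ᴹ toH₀ p V y

      hit-zero : Hit Fin.zero
      hit-zero h h∈ _ = V.0ᴹ , ≋⇒≈
        (≋-trans (components≈0⇒≋[] h (λ j n → in-zero⇒≈0 (h∈ j n))) (≋-sym toH₀-0))

      module _ (i : Fin N) (hit : Hit (Fin.inject₁ i)) where
        -- By top-level, the components at level L can be corrected to lie in the smaller part.
        descend : ∀ L h → (∀ j n → In (Fin.suc i) (component j n h)) →
          (∀ j → L ≤ j → ∀ n → In (Fin.inject₁ i) (component j n h)) → IsInvariant p V h → ∃[ y ] h H.≈ᴹ toH₀ p V y
        descend zero    h h∈ h∈′ h-inv = hit h (λ j → h∈′ j ℕ.z≤n) h-inv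
        descend (suc L) h h∈ h∈′ h-inv =
          let y , e = descend L h′ h′∈ h′∈′ h′-inv
          in y V.+ᴹ (A.- A.1#) V.*ₗ C.value , ++-homologous-cancel e C.homologous
          where
          bounding : ∃[ d ] _•_ p V 1# h ≋ h ++ ∂ p V d
          bounding = homologous⇒∂ (h-inv 1#)

          solution : ∀ n → ∃[ x ] In (Fin.suc i) x × In (Fin.inject₁ i) (component L (nat n) h V.+ᴹ out L x)
          solution = top-level i L h (proj₁ bounding) (proj₂ bounding) h∈ h∈′

          C : Correction (Fin.suc i) L (λ n → proj₁ (solution n))
          C = correction (Fin.suc i) L (λ n → proj₁ (solution n)) (λ n → proj₁ (proj₂ (solution n)))
          module C = Correction C

          h′ : FormalSum
          h′ = h ++ C.chain

          h′∈ : ∀ j n → In (Fin.suc i) (component j n h′)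
          h′∈ j n = In.resp-≈ (Fin.suc i) (V.≈ᴹ-sym (component-++ j n h C.chain)) (In.+-closed (Fin.suc i) (h∈ j n) (C.components-in j n))

          -- The correction need not be a boundary: for L = 0 it is the class of an element of
          -- 𝒱(𝔢₀), whose invariance is the assumption `inv`.
          h′-inv : IsInvariant p V h′
          h′-inv = ++-invariant h-inv C.homologous (inv C.value)

          at-L : ∀ n → n ℕ.< p ℕ.^ L → In (Fin.inject₁ i) (component L (nat n) h′)
          at-L n n< = In.resp-≈ (Fin.inject₁ i)
            (V.≈ᴹ-sym (V.≈ᴹ-trans (component-++ L (nat n) h C.chain) (V.+ᴹ-congˡ (C.at-level n n<))))
            (proj₂ (proj₂ (solution n)))

          h′∈′ : ∀ j → L ≤ j → ∀ n → In (Fin.inject₁ i) (component j n h′)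
          h′∈′ j L≤j n = at-or-above (ℕₚ.m≤n⇒m<n∨m≡n L≤j)
            where
            at-or-above : L ℕ.< j ⊎ L ≡ j → In (Fin.inject₁ i) (component j n h′)
            at-or-above (inj₁ L<j) = In.resp-≈ (Fin.inject₁ i)
              (V.≈ᴹ-sym (V.≈ᴹ-trans (component-++ j n h C.chain) (V.≈ᴹ-trans (V.+ᴹ-congˡ (C.above j L<j n)) (V.+ᴹ-identityʳ _))))
              (h∈′ j L<j n)
            -- Only the indices l < pᴸ were corrected. A general n is congruent to one of them, and
            -- the parts are stable under the rotation between the two.
            at-or-above (inj₂ ≡.refl) = let l , l< , n≡l = representative n L in In.resp-≈ (Fin.inject₁ i)
              (V.≈ᴹ-sym (component-shift L (nat l) n (nat l + (Z.- n)) (fixes-difference (≡[mod]-sym n≡l)) (≡[mod]-sym n≡l) ([n′-n]-n′≈-n (nat l) n) h′))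
              (part.act-closed (Fin.inject₁ i) (nat l + (Z.- n)) (fixes-difference (≡[mod]-sym n≡l)) (at-L l l<))

        hit-suc : Hit (Fin.suc i)
        hit-suc h h∈ h-inv = let B , h≈0 = component-bounded h in
          descend B h h∈ (λ j B≤j n → in-0 (Fin.inject₁ i) (h≈0 j B≤j n)) h-inv

      toH₀-surjective : ∀ h → IsInvariant p V h → ∃[ y ] h H.≈ᴹ toH₀ p V y
      toH₀-surjective h = <-weakInduction Hit hit-zero hit-suc (Fin.fromℕ N) h (λ j n → F.top _)

-- W and V only differ in the spelling of the ring 𝔬/πᵐ.  Matching on the equation once is cheaper than
-- comparing the modules over the two rings.
toH₀-bijective : ∀ {p} → Prime p → {K : FiniteExtension p c ℓ₁ ℓ₂} (O : RingOfIntegers p K r ℓr)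
  {π : RingOfIntegers.Carrier O} → RingOfIntegers.IsUniformizer O π → ∀ m (W : CoefficientSystem p _ ℓ) →
  StrictlyOfLevel1 p (RingOfIntegers.𝔬 O) π m W →
  ∀ {A} (V : CoefficientSystem p A ℓ) →
  _≡_ {A = Σ[ A ∈ CommutativeRing r (r ⊔ ℓr) ] CoefficientSystem p A ℓ} (A , V) (_ , W) →
  (∀ x → IsInvariant p V (toH₀ p V x)) →
  (∀ {x y} → LeftModule._≈ᴹ_ (H₀ p V) (toH₀ p V x) (toH₀ p V y) → CoefficientSystem._≈ᴹ_ V x y)
  × (∀ h → IsInvariant p V h → ∃[ y ] LeftModule._≈ᴹ_ (H₀ p V) h (toH₀ p V y))
toH₀-bijective p-prime O π-uniformizer m W (N , F , level1) .W ≡.refl inv =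
  FilteredSystem.toH₀-injective p-prime O π-uniformizer m W F level1 ,
  FilteredSystem.toH₀-surjective p-prime O π-uniformizer m W F level1 inv

open import Algebra.Properties.Semiring.Exp using (_^_)
open CoefficientSystem using (𝒱)
open HalfTree using (edge; 𝔢)
open RingOfIntegers using (𝔬; Carrier; IsUniformizer; semiring)

theorem4p3 : ∀ {c ℓ₁ ℓ₂ r ℓr ℓ : Level}
    (p : ℕ) → Prime p →
    (K : FiniteExtension p c ℓ₁ ℓ₂) (O : RingOfIntegers p K r ℓr) →
    (π : Carrier O) → IsUniformizer O π →
    (m : ℕ) → 1 ≤ m →
    (V : CoefficientSystem p (𝔬 O ⧸ _^_ (semiring O) π m) ℓ) →
    StrictlyOfLevel1 p (𝔬 O) π m V →
    (inv : ∀ x → IsInvariant p V (toH₀ p V x)) →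
    IsLinearIsomorphism (𝒱 V (edge (𝔢 p 0))) (H₀^𝔑₀ p V) (toH₀^𝔑₀ p V inv)
theorem4p3 p p-prime K O π π-uniformizer m 1≤m V level1 inv =
  let injective , surjective = toH₀-bijective p-prime O π-uniformizer m V level1 V ≡.refl inv
  in Components.toH₀^𝔑₀-isomorphism {{prime⇒nonZero p-prime}} V inv injective surjective
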